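{- For every $j\ge0$, define polynomials $A_{j,r}(x)$ ($r\ge 0$) by $$\sum_{r\ge0}A_{j,r}(x)W^r=(1+4xW)^{2j}\,P_j\!\left(\frac{x(1+2W+4xW^2)}{(1+4xW)^2}\right).$$ Then $$\sum_{r\ge0}A_{j,r}(x)W^r=\sum_{s=0}^{j}D_{2j,s}\,x^s(1+4xW)^{2j-2s}(1+2W+4xW^2)^s,$$ and therefore $A_{j,r}(x)\in\mathbb N[x]$ for all $r\ge0$. Moreover, for all $j,f\ge0$, $$\Phi_{j,f}(x)=\sum_{r=0}^{f}\binom fr A_{j,r}(x).$$
   Context: $\mathbb N=\{0,1,2,\dots\}$. For $n\ge1$, $\mathfrak B_n$ is the hyperoctahedral group of signed permutations: words $\pi=\pi_1\cdots\pi_n$ of nonzero integers such that $|\pi_1|,\dots,|\pi_n|$ is a permutation of $[n]=\{1,\dots,n\}$, with $\pi(i)=\pi_i$, $\pi(-i)=-\pi(i)$. $\mathcal I_n^B$ is the set of $\pi\in\mathfrak B_n$ with $\pi^2=\mathrm{id}$ (for $n=0$, a single empty involution). With $\pi_0=0$ and the usual order on $\mathbb Z$, $\operatorname{des}^B(\pi)=\#\{0\le i\le n-1:\pi_i>\pi_{i+1}\}$. $\operatorname{fix}_B(\pi)=\#\{i\in[n]:|\pi(i)|=i\}$, and $\operatorname{cyc}_2(\pi)$ is the number of two-cycles of the ordinary involution $i\mapsto|\pi(i)|$ of $[n]$, so $2\operatorname{cyc}_2(\pi)+\operatorname{fix}_B(\pi)=n$. For $j,f\ge0$, $$F_{j,f}(t)=\sum_{\substack{\pi\in\mathcal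 I_{2j+f}^B\\ \operatorname{cyc}_2(\pi)=j,\ \operatorname{fix}_B(\pi)=f}}t^{\operatorname{des}^B(\pi)}.$$ This polynomial is palindromic with center $(2j+f)/2$, and $\Phi_{j,f}$ denotes the unique polynomial such that $F_{j,f}(t)=(1+t)^{2j+f}\,\Phi_{j,f}\!\left(\frac{t}{(1+t)^2}\right)$. The fixed-point-free case is $J_{2j}^B(t)=F_{j,0}(t)$, and $P_j(x)=\sum_{s=0}^{j}D_{2j,s}x^s$ denotes its $\gamma$-polynomial, i.e. $J_{2j}^B(t)=(1+t)^{2j}P_j\!\left(\frac{t}{(1+t)^2}\right)$ (so $P_j=\Phi_{j,0}$). The following is a known theorem of Wan, Gao, Li and Yang taken as given: $D_{2j,s}\in\mathbb N$ for all $0\le s\le j$. -}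

module Defs where

open import Algebra.Bundles.Raw using (RawRing)
import Algebra.Definitions.RawSemiring as RawSemiringDefs
open import Data.Fin.Base as Fin using (Fin; toℕ; inject₁)
import Data.Fin.Properties as Fin
open import Data.Integer.Base as ℤ using (ℤ; +_; -[1+_]; 0ℤ; 1ℤ; _◃_)
import Data.Integer.Properties as ℤ
open import Data.List.Base as List
  using (List; []; _∷_; _++_; length; filter; foldr; replicate; applyUpTo;
         allFin; cartesianProduct; cartesianProductWith)
open import Data.Nat.Base as ℕ using (ℕ; zero; suc; _∸_)
import Data.Nat.Properties as ℕ
open import Data.Product.Base using (_×_; _,_; proj₂; ∃-syntax)
import Data.Product.Properties as Product
open import Data.Sign.Base as Sign using (Sign)
import Data.Sign.Properties as Sign
open import Data.Vec.Base as Vec using (Vec; lookup; tabulate)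
import Data.Vec.Properties as Vec
open import Level using (Level; 0ℓ)
open import Relation.Binary.PropositionalEquality using (_≡_)
open import Relation.Nullary.Decidable using (Dec; _×-dec_; _→-dec_)
open import Relation.Unary using (Pred; Decidable)

private variable
  c ℓ : Level
  n : ℕ

-- ℤ[x]: lists of coefficients, constant term first.  Lists differing by
-- trailing zeros are identified by the equality of ℤ[x] below.
Poly : Set
Poly = List ℤ

coeff : Poly → ℕ → ℤ
coeff []      _       = 0ℤ
coeff (a ∷ _) zero    = a
coeff (_ ∷ p) (suc k) = coeff p k

infixl 6 _+ₚ_
infixl 7 _*ₚ_

_+ₚ_ : Poly → Poly → Poly
[]      +ₚ q       = q
(a ∷ p) +ₚ []      = a ∷ p
(a ∷ p) +ₚ (b ∷ q) = a ℤ.+ b ∷ p +ₚ q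

_*ₚ_ : Poly → Poly → Poly
[]      *ₚ q = []
(a ∷ p) *ₚ q = List.map (a ℤ.*_) q +ₚ (0ℤ ∷ p *ₚ q)

ℤ[x] : RawRing 0ℓ 0ℓ
ℤ[x] = record
  { Carrier = Poly
  ; _≈_     = λ p q → ∀ k → coeff p k ≡ coeff q k
  ; _+_     = _+ₚ_
  ; _*_     = _*ₚ_
  ; -_      = List.map (λ a → ℤ.- a)
  ; 0#      = []
  ; 1#      = 1ℤ ∷ []
  }

monomial : ℕ → Poly
monomial d = replicate d 0ℤ ++ 1ℤ ∷ []

IsNatural : ℤ → Set
IsNatural z = ∃[ m ] z ≡ + m

_∈ℕ[x] : Poly → Set
p ∈ℕ[x] = ∀ k → IsNatural (coeff p k)

-- R[[X]], a series being the sequence of its coefficients.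
Series : RawRing c ℓ → RawRing c ℓ
Series R = record
  { Carrier = ℕ → Carrier
  ; _≈_     = λ f g → ∀ k → f k ≈ g k
  ; _+_     = λ f g k → f k + g k
  ; _*_     = λ f g k → sum {suc k} λ i → f (toℕ i) * g (k ∸ toℕ i)
  ; -_      = λ f k → - f k
  ; 0#      = λ _ → 0#
  ; 1#      = λ { zero → 1# ; (suc _) → 0# }
  }
  where
  open RawRing R
  open RawSemiringDefs rawSemiring using (sum)

module _ (R : RawRing c ℓ) where
  open RawRing R
  open RawSemiringDefs rawSemiring using (_^_) renaming (_×_ to _·_)

  const : Carrier → RawRing.Carrier (Series R)
  const a zero    = a
  const a (suc _) = 0#

  X : RawRing.Carrier (Series R)
  X 1 = 1#
  X _ = 0#

  -- 1/(1 + aX) = Σₖ (-a)ᵏ Xᵏ, the inverse of 1 + aX in R[[X]].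
  1/1+_X : Carrier → RawRing.Carrier (Series R)
  1/1+ a X = λ k → (- a) ^ k

  fromℤ : ℤ → Carrier
  fromℤ (+ m)    = m · 1#
  fromℤ -[1+ m ] = - (suc m · 1#)

  eval : Poly → Carrier → Carrier
  eval p y = foldr (λ a v → fromℤ a + y * v) 0# p

count : {A : Set} {P : Pred A 0ℓ} → Decidable P → List A → ℕ
count P? xs = length (filter P? xs)

-- The nonzero integers of absolute value at most n: (s , k) stands for
-- ±(k+1), since Fin n = {0,…,n-1} while [n] = {1,…,n}.
Letter : ℕ → Set
Letter n = Sign × Fin n

value : Letter n → ℤ
value (s , k) = s ◃ suc (toℕ k)

Word : ℕ → Set
Word n = Vec (Letter n) n

∣_∣at : Word n → Fin n → Fin n
∣ π ∣at i = proj₂ (lookup π i)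

-- A self-map of a finite set is a permutation iff it is injective.
IsSignedPermutation : Word n → Set
IsSignedPermutation π = ∀ i k → ∣ π ∣at i ≡ ∣ π ∣at k → i ≡ k

-- The extension of π to negative arguments by π(-i) = -π(i).
apply : Word n → Letter n → Letter n
apply π (s , i) with lookup π i
... | (s′ , k) = s Sign.* s′ , k

_∘ʷ_ : Word n → Word n → Word n
π ∘ʷ σ = Vec.map (apply π) σ

idʷ : Word n
idʷ = tabulate (Sign.+ ,_)

IsInvolution : Word n → Set
IsInvolution π = IsSignedPermutation π × π ∘ʷ π ≡ idʷ

-- The word π₀π₁⋯πₙ with π₀ = 0.
extended : Word n → Vec ℤ (suc n)
extended π = 0ℤ Vec.∷ Vec.map value π

desᴮ : Word n → ℕ
desᴮ {n} π =
  count (λ i → lookup (extended π) (Fin.suc i) ℤ.<? lookup (extended π) (inject₁ i))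
        (allFin n)

fixᴮ : Word n → ℕ
fixᴮ {n} π = count (λ i → ∣ π ∣at i Fin.≟ i) (allFin n)

-- A two-cycle is counted once, as the pair (i , k) with i < k.
cyc₂ : Word n → ℕ
cyc₂ {n} π =
  count (λ (i , k) → i Fin.<? k ×-dec ∣ π ∣at i Fin.≟ k ×-dec ∣ π ∣at k Fin.≟ i)
        (cartesianProduct (allFin n) (allFin n))

vectors : {A : Set} → List A → (m : ℕ) → List (Vec A m)
vectors as zero    = Vec.[] ∷ []
vectors as (suc m) = cartesianProductWith Vec._∷_ as (vectors as m)

allWords : (n : ℕ) → List (Word n)
allWords n = vectors (cartesianProduct (Sign.- ∷ Sign.+ ∷ []) (allFin n)) n

isInvolution? : Decidable (IsInvolution {n})
isInvolution? π =
  Fin.all? (λ i → Fin.all? λ k → (∣ π ∣at i Fin.≟ ∣ π ∣at k) →-dec (i Fin.≟ k))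
  ×-dec Vec.≡-dec (Product.≡-dec Sign._≟_ Fin._≟_) (π ∘ʷ π) idʷ

F : ℕ → ℕ → Poly
F j f = foldr (λ π p → monomial (desᴮ π) +ₚ p) []
  (filter (λ π → isInvolution? π ×-dec cyc₂ π ℕ.≟ j ×-dec fixᴮ π ℕ.≟ f)
          (allWords (2 ℕ.* j ℕ.+ f)))

J : ℕ → Poly
J j = F j 0

-- p(t) = (1+t)ⁿ Φ(t/(1+t)²).  Both sides are rational functions of t whose
-- denominators are powers of 1+t, so the identity is stated in ℤ[[t]].
IsGammaPolynomial : ℕ → Poly → Poly → Set
IsGammaPolynomial n p Φ =
  coeff p ≈ (1# + t) ^ n * eval ℤ[[t]] Φ (t * (1/1+_X ℤ.+-*-rawRing 1ℤ) ^ 2)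
  where
  ℤ[[t]] : RawRing 0ℓ 0ℓ
  ℤ[[t]] = Series ℤ.+-*-rawRing
  open RawRing ℤ[[t]]
  open RawSemiringDefs rawSemiring using (_^_)
  t : Carrier
  t = X ℤ.+-*-rawRing

-- D j s stands for D_{2j,s}; values with s > j play no role.
P : (ℕ → ℕ → ℤ) → ℕ → Poly
P D j = applyUpTo (D j) (suc j)

ℤ[x][[W]] : RawRing 0ℓ 0ℓ
ℤ[x][[W]] = Series ℤ[x]

module _ where
  open RawRing ℤ[x][[W]]
  open RawSemiringDefs rawSemiring using (_^_; sum) renaming (_×_ to _·_)

  private
    x W : Carrier
    x = const ℤ[x] (monomial 1)
    W = X ℤ[x]

  1+4xW 1/[1+4xW] 1+2W+4xW² : Carrier
  1+4xW     = 1# + 4 · (x * W)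
  1/[1+4xW] = 1/1+_X ℤ[x] (+ 0 ∷ + 4 ∷ [])
  1+2W+4xW² = 1# + 2 · W + 4 · (x * W ^ 2)

  -- A p j r is A_{j,r} when p = P_j.
  A : Poly → ℕ → ℕ → Poly
  A p j = 1+4xW ^ (2 ℕ.* j) * eval ℤ[x][[W]] p (x * 1+2W+4xW² * 1/[1+4xW] ^ 2)

  expansion : (ℕ → ℤ) → ℕ → ℕ → Poly
  expansion d j = sum {suc j} λ i → let s = toℕ i in
    fromℤ ℤ[x][[W]] (d s) * x ^ s * 1+4xW ^ (2 ℕ.* j ∸ 2 ℕ.* s) * 1+2W+4xW² ^ s

binomialSum : (ℕ → Poly) → ℕ → Poly
binomialSum a f = sum {suc f} λ i → (f C toℕ i) · a (toℕ i)
  where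
  open import Data.Nat.Combinatorics using (_C_)
  open RawRing ℤ[x]
  open RawSemiringDefs rawSemiring using (sum) renaming (_×_ to _·_)

{-# OPTIONS --safe #-}
module Submission where

-- Inserting fixed points into a signed permutation σ of size 2j without them changes the descents in a
-- way that depends on des σ only: with α = u(1-t), Y = t(1+α), Z = 1-α and v = 1-u(1+t), the insertions
-- into σ have generating function Y^d Z^{2j-d} / v^{2j+1}, where d = des σ and u marks the inserted points.
-- A block of fixed points inserted between positions k and k+1 only sees whether the entries there are
-- above, between or below ±(k+1); the resulting factors are (1±α)/v up to corrections that telescope
-- along the word.  Summing over σ and inserting the γ-expansion of J gives
--   v^{2j+1} Σ_f F_{j,f} u^f = Σ_s D_{2j,s} (YZ)^s (Y+Z)^{2j-2s}.
-- On the other side, the transform β(a)_f = (1+t)^f Σ_r C(f,r) a_r satisfies v β(Wa) = (1+t) u β(a) by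
-- Pascal's rule.  Hence at x = t/(1+t)² multiplication by 1+4xW under β is multiplication by (Y+Z)/((1+t)v),
-- and multiplication by x(1+2W+4xW²) is multiplication by YZ/((1+t)v)², so β of the expansion gives the
-- same series.  Finally p ↦ p(t/(1+t)²) is injective on polynomials.
open import Algebra.Bundles using (CommutativeMonoid; CommutativeRing)
open import Algebra.Bundles.Raw using (RawRing)
import Algebra.Definitions.RawMonoid
import Algebra.Definitions.RawSemiring as RawSemiringDefs
import Algebra.Morphism.RingMonomorphism as RingMonomorphism
open import Algebra.Morphism.Structures using (IsRingHomomorphism; IsRingMonomorphism)
import Algebra.Properties.CommutativeMonoid.Mult as CommutativeMonoidMult
import Algebra.Properties.CommutativeMonoid.Sum as CommutativeMonoidSum
import Algebra.Properties.CommutativeSemigroup as CommutativeSemigroupProperties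
import Algebra.Properties.CommutativeSemiring.Exp as CExp
import Algebra.Properties.Group as GroupProperties
import Algebra.Properties.Monoid.Sum as MonoidSum
import Algebra.Properties.Ring as RingProperties
import Algebra.Properties.Semiring.Exp as Exp
import Algebra.Properties.Semiring.Mult as Mult
import Algebra.Properties.Semiring.Sum as SemiringSum
import Algebra.Solver.Ring as RingSolver
open import Algebra.Solver.Ring.AlmostCommutativeRing using (fromCommutativeRing; _-Raw-AlmostCommutative⟶_)
open import Data.Bool.Base using (Bool; true; false; not; if_then_else_)
open import Data.Empty using (⊥-elim)
open import Data.Fin.Base as Fin using (Fin; toℕ; punchIn; punchOut; inject₁; fromℕ<)
import Data.Fin.Properties as Fin
open import Data.Integer.Base as ℤ using (ℤ; +_; -[1+_]; 0ℤ; 1ℤ; _◃_)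
import Data.Integer.Properties as ℤ
open import Data.List.Base as List using (List; []; _∷_; _++_; length; filter; foldr; applyUpTo; allFin; cartesianProduct; cartesianProductWith)
import Data.List.Properties as List
open import Data.Maybe.Base using (Maybe; just; nothing)
open import Data.Nat.Base as ℕ using (ℕ; zero; suc; _∸_)
open import Data.Nat.Combinatorics using (_C_; nCk+nC[k+1]≡[n+1]C[k+1]; k>n⇒nCk≡0)
import Data.Nat.Properties as ℕ
open import Data.Product.Base using (_×_; _,_; proj₁; proj₂; map₂)
open import Data.Sign.Base as Sign using (Sign)
open import Data.Sum.Base using (_⊎_; inj₁; inj₂)
open import Data.Vec.Base as Vec using (Vec; lookup; insertAt)
import Data.Vec.Properties as Vec
open import Function.Base using (id; _∘_)
open import Level using (Level; 0ℓ; _⊔_)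
import Relation.Binary.PropositionalEquality as ≡
open import Relation.Binary.PropositionalEquality using (_≡_; _≢_)
import Relation.Binary.Reasoning.Setoid as SetoidReasoning
open import Relation.Nullary.Decidable using (Dec; yes; no; does; dec-true; dec-false; _×-dec_; _→-dec_; ¬?)
open import Relation.Nullary.Negation using (¬_)
open import Relation.Unary using (Pred; Decidable)

open import Defs

-- Commutative rings, power series and polynomials

-- Along a block of inserted fixed points the absolute values increase, so a further letter creates
-- a descent exactly when it is negative; it contributes u(1+t), whence v. The blocks are
-- nevertheless never summed as geometric series: a block is empty or has a last letter, and
-- deleting that letter gives a linear recursion without division. The obstacle is that words with
-- fixed points in later slots must be treated at the same time. Hence the quantity that is tracked
-- interpolates: steps before slot k carry Y or Z, steps after it carry t or 1, and the sum runs
-- over words without fixed points at the first k positions. In passing from k to k+1, the words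
-- with a fixed point at position k+1 appear once as members of the sum and once as results of an
-- insertion; the two contributions cancel and a factor v remains. There are 2j+1 slots, the last
-- one being closed by a padding letter that exceeds all others. On the other side β is not
-- multiplicative, so the factors of each term leave it one at a time, the 2j factors of degree one
-- costing (1+t)v each; the remaining factor v comes from β(1) = 1/v.

module IntegerScalars {c ℓ : Level} (R : CommutativeRing c ℓ) where
  open CommutativeRing R
  open RawSemiringDefs (RawRing.rawSemiring rawRing) using () renaming (_×_ to _·_)
  open Mult semiring using (×-homo-+; ×1-homo-*)
  open RingProperties ring
    using (-‿distribˡ-*; -‿distribʳ-*; -‿involutive; -0#≈0#; -‿+-comm)
  open SetoidReasoning setoid

  private
    ι : ℤ → Carrier
    ι = fromℤ rawRing

  cancel-suc : ∀ x y → (1# + x) - (1# + y) ≈ x - y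
  cancel-suc x y = begin
    (1# + x) + - (1# + y)     ≈⟨ +-cong (+-comm 1# x) (sym (-‿+-comm 1# y)) ⟩
    (x + 1#) + (- 1# + - y)   ≈⟨ +-assoc x 1# _ ⟩
    x + (1# + (- 1# + - y))   ≈⟨ +-congˡ (+-assoc 1# (- 1#) (- y)) ⟨
    x + ((1# + - 1#) + - y)   ≈⟨ +-congˡ (+-congʳ (-‿inverseʳ 1#)) ⟩
    x + (0# + - y)            ≈⟨ +-congˡ (+-identityˡ (- y)) ⟩
    x - y                     ∎

  fromℤ-⊖ : ∀ m n → ι (m ℤ.⊖ n) ≈ m · 1# - n · 1#
  fromℤ-⊖ zero    zero    = sym (trans (+-congˡ -0#≈0#) (+-identityʳ 0#))
  fromℤ-⊖ zero    (suc n) = sym (+-identityˡ _)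
  fromℤ-⊖ (suc m) zero    = sym (trans (+-congˡ -0#≈0#) (+-identityʳ _))
  fromℤ-⊖ (suc m) (suc n) = begin
    ι (suc m ℤ.⊖ suc n)       ≡⟨ ≡.cong ι (ℤ.[1+m]⊖[1+n]≡m⊖n m n) ⟩
    ι (m ℤ.⊖ n)               ≈⟨ fromℤ-⊖ m n ⟩
    m · 1# - n · 1#           ≈⟨ cancel-suc (m · 1#) (n · 1#) ⟨
    suc m · 1# - suc n · 1#   ∎

  fromℤ-+ : ∀ i j → ι (i ℤ.+ j) ≈ ι i + ι j
  fromℤ-+ (+ m)    (+ n)    = ×-homo-+ 1# m n
  fromℤ-+ (+ m)    -[1+ n ] = fromℤ-⊖ m (suc n)
  fromℤ-+ -[1+ m ] (+ n)    = trans (fromℤ-⊖ n (suc m)) (+-comm _ _)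
  fromℤ-+ -[1+ m ] -[1+ n ] = begin
    - (suc (suc (m ℕ.+ n)) · 1#)       ≡⟨ ≡.cong (λ k → - (suc k · 1#)) (≡.sym (ℕ.+-suc m n)) ⟩
    - ((suc m ℕ.+ suc n) · 1#)         ≈⟨ -‿cong (×-homo-+ 1# (suc m) (suc n)) ⟩
    - (suc m · 1# + suc n · 1#)        ≈⟨ -‿+-comm _ _ ⟨
    - (suc m · 1#) + - (suc n · 1#)    ∎

  fromℤ-neg : ∀ i → ι (ℤ.- i) ≈ - ι i
  fromℤ-neg (+ zero)  = sym -0#≈0#
  fromℤ-neg (+ suc n) = refl
  fromℤ-neg -[1+ n ]  = sym (-‿involutive _)

  fromℤ-+* : ∀ m j → ι (+ m ℤ.* j) ≈ ι (+ m) * ι j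
  fromℤ-+* m (+ n) = begin
    ι (+ m ℤ.* + n)      ≡⟨ ≡.cong ι (ℤ.pos-* m n) ⟨
    (m ℕ.* n) · 1#       ≈⟨ ×1-homo-* m n ⟩
    ι (+ m) * ι (+ n)    ∎
  fromℤ-+* m -[1+ n ] = begin
    ι (+ m ℤ.* -[1+ n ])           ≡⟨ ≡.cong ι (ℤ.neg-distribʳ-* (+ m) (+ suc n)) ⟨
    ι (ℤ.- (+ m ℤ.* + suc n))      ≈⟨ fromℤ-neg (+ m ℤ.* + suc n) ⟩
    - ι (+ m ℤ.* + suc n)          ≈⟨ -‿cong (fromℤ-+* m (+ suc n)) ⟩
    - (ι (+ m) * ι (+ suc n))      ≈⟨ -‿distribʳ-* _ _ ⟩
    ι (+ m) * ι -[1+ n ]           ∎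

  fromℤ-* : ∀ i j → ι (i ℤ.* j) ≈ ι i * ι j
  fromℤ-* (+ m)    j = fromℤ-+* m j
  fromℤ-* -[1+ m ] j = begin
    ι (-[1+ m ] ℤ.* j)             ≡⟨ ≡.cong ι (ℤ.neg-distribˡ-* (+ suc m) j) ⟨
    ι (ℤ.- (+ suc m ℤ.* j))        ≈⟨ fromℤ-neg (+ suc m ℤ.* j) ⟩
    - ι (+ suc m ℤ.* j)            ≈⟨ -‿cong (fromℤ-+* (suc m) j) ⟩
    - (ι (+ suc m) * ι j)          ≈⟨ -‿distribˡ-* _ _ ⟩
    ι -[1+ m ] * ι j               ∎

  fromℤ-1 : ι 1ℤ ≈ 1#
  fromℤ-1 = +-identityʳ 1#

  fromℤ-morphism : ℤ.+-*-rawRing -Raw-AlmostCommutative⟶ fromCommutativeRing R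
  fromℤ-morphism = record
    { ⟦_⟧    = ι
    ; +-homo = fromℤ-+
    ; *-homo = fromℤ-*
    ; -‿homo = fromℤ-neg
    ; 0-homo = refl
    ; 1-homo = fromℤ-1
    }

  private
    equal? : ∀ i j → Maybe (ι i ≈ ι j)
    equal? i j with i ℤ.≟ j
    ... | yes i≡j = just (reflexive (≡.cong ι i≡j))
    ... | no  _   = nothing

  module Solver where
    open RingSolver ℤ.+-*-rawRing (fromCommutativeRing R) fromℤ-morphism equal? public

    -- The constant con 1ℤ denotes 1# + 0#, whereas this one denotes 1# on the nose.
    :1 : ∀ {n} → Polynomial n
    :1 = con 1ℤ :^ 0

module SeriesRing {c ℓ : Level} (R : CommutativeRing c ℓ) where
  open CommutativeRing R
  open IntegerScalars R using (module Solver)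
  open Solver using (solve; _:+_; _:*_; con; _:=_)
  open SetoidReasoning setoid
  private module S = RawRing (Series rawRing)

  *-cong′ : ∀ {f f′ g g′} → f S.≈ f′ → g S.≈ g′ → f S.* g S.≈ f′ S.* g′
  *-cong′ f≈f′ g≈g′ zero    = +-congʳ (*-cong (f≈f′ 0) (g≈g′ 0))
  *-cong′ f≈f′ g≈g′ (suc k) =
    +-cong (*-cong (f≈f′ 0) (g≈g′ (suc k))) (*-cong′ (λ i → f≈f′ (suc i)) g≈g′ k)

  -- The product is defined by recursion on the head of the left factor. This is the mirror
  -- recursion on the head of the right factor, from which commutativity follows by induction.
  *-suc : ∀ f g k → (f S.* g) (suc k) ≈ f (suc k) * g 0 + (f S.* (λ i → g (suc i))) k
  *-suc f g zero    =
    solve 4 (λ a b a′ b′ → a :* b′ :+ (a′ :* b :+ con 0ℤ) := a′ :* b :+ (a :* b′ :+ con 0ℤ))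
      refl (f 0) (g 0) (f 1) (g 1)
  *-suc f g (suc k) = begin
    f 0 * g (suc (suc k)) + (f′ S.* g) (suc k)
      ≈⟨ +-congˡ (*-suc f′ g k) ⟩
    f 0 * g (suc (suc k)) + (f (suc (suc k)) * g 0 + (f′ S.* (λ i → g (suc i))) k)
      ≈⟨ solve 3 (λ x y z → x :+ (y :+ z) := y :+ (x :+ z)) refl _ _ _ ⟩
    f (suc (suc k)) * g 0 + (f 0 * g (suc (suc k)) + (f′ S.* (λ i → g (suc i))) k) ∎
    where f′ = λ i → f (suc i)

  *-comm′ : ∀ f g → f S.* g S.≈ g S.* f
  *-comm′ f g zero    = +-congʳ (*-comm (f 0) (g 0))
  *-comm′ f g (suc k) = begin
    f 0 * g (suc k) + ((λ i → f (suc i)) S.* g) k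
      ≈⟨ +-cong (*-comm _ _) (*-comm′ (λ i → f (suc i)) g k) ⟩
    g (suc k) * f 0 + (g S.* (λ i → f (suc i))) k
      ≈⟨ *-suc g f k ⟨
    (g S.* f) (suc k) ∎

  zeroˡ′ : ∀ g → S.0# S.* g S.≈ S.0#
  zeroˡ′ g zero    = trans (+-identityʳ _) (zeroˡ _)
  zeroˡ′ g (suc k) = trans (+-cong (zeroˡ _) (zeroˡ′ g k)) (+-identityˡ 0#)

  identityˡ′ : ∀ g → S.1# S.* g S.≈ g
  identityˡ′ g zero    = trans (+-identityʳ _) (*-identityˡ _)
  identityˡ′ g (suc k) = trans (+-cong (*-identityˡ _) (zeroˡ′ g k)) (+-identityʳ _)

  distribʳ′ : ∀ h f g → (f S.+ g) S.* h S.≈ f S.* h S.+ g S.* h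
  distribʳ′ h f g zero    =
    solve 3 (λ h f g → (f :+ g) :* h :+ con 0ℤ := (f :* h :+ con 0ℤ) :+ (g :* h :+ con 0ℤ))
      refl (h 0) (f 0) (g 0)
  distribʳ′ h f g (suc k) = trans (+-congˡ (distribʳ′ h (λ i → f (suc i)) (λ i → g (suc i)) k))
    (solve 5 (λ h f g x y → (f :+ g) :* h :+ (x :+ y) := (f :* h :+ x) :+ (g :* h :+ y))
      refl (h (suc k)) (f 0) (g 0) _ _)

  scale-*ˡ : ∀ a f g k → ((λ i → a * f i) S.* g) k ≈ a * (f S.* g) k
  scale-*ˡ a f g zero    =
    solve 3 (λ a f g → a :* f :* g :+ con 0ℤ := a :* (f :* g :+ con 0ℤ)) refl a (f 0) (g 0)
  scale-*ˡ a f g (suc k) = trans (+-congˡ (scale-*ˡ a (λ i → f (suc i)) g k))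
    (solve 4 (λ a f g x → a :* f :* g :+ a :* x := a :* (f :* g :+ x)) refl a (f 0) (g (suc k)) _)

  *-assoc′ : ∀ f g h → (f S.* g) S.* h S.≈ f S.* (g S.* h)
  *-assoc′ f g h zero    =
    solve 3 (λ f g h → (f :* g :+ con 0ℤ) :* h :+ con 0ℤ := f :* (g :* h :+ con 0ℤ) :+ con 0ℤ)
      refl (f 0) (g 0) (h 0)
  *-assoc′ f g h (suc k) = begin
    -- By definition the tail of f * g is f 0 · g′ + f′ * g.
    (f S.* g) 0 * h (suc k) + (((λ i → f 0 * g (suc i)) S.+ (f′ S.* g)) S.* h) k
      ≈⟨ +-congˡ (distribʳ′ h (λ i → f 0 * g (suc i)) (f′ S.* g) k) ⟩
    (f S.* g) 0 * h (suc k) + (((λ i → f 0 * g (suc i)) S.* h) k + ((f′ S.* g) S.* h) k)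
      ≈⟨ +-congˡ (+-cong (scale-*ˡ (f 0) g′ h k) (*-assoc′ f′ g h k)) ⟩
    (f 0 * g 0 + 0#) * h (suc k) + (f 0 * (g′ S.* h) k + (f′ S.* (g S.* h)) k)
      ≈⟨ solve 5 (λ f g h x y → (f :* g :+ con 0ℤ) :* h :+ (f :* x :+ y) := f :* (g :* h :+ x) :+ y)
           refl (f 0) (g 0) (h (suc k)) _ _ ⟩
    f 0 * (g 0 * h (suc k) + (g′ S.* h) k) + (f′ S.* (g S.* h)) k ∎
    where
    f′ = λ i → f (suc i)
    g′ = λ i → g (suc i)

  commutativeRing : CommutativeRing c ℓ
  commutativeRing = record
    { Carrier = S.Carrier
    ; _≈_ = S._≈_
    ; _+_ = S._+_
    ; _*_ = S._*_
    ; -_  = S.-_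
    ; 0#  = S.0#
    ; 1#  = S.1#
    ; isCommutativeRing = record
      { isRing = record
        { +-isAbelianGroup = record
          { isGroup = record
            { isMonoid = record
              { isSemigroup = record
                { isMagma = record
                  { isEquivalence = record
                    { refl  = λ k → refl
                    ; sym   = λ p k → sym (p k)
                    ; trans = λ p q k → trans (p k) (q k)
                    }
                  ; ∙-cong = λ p q k → +-cong (p k) (q k)
                  }
                ; assoc = λ f g h k → +-assoc _ _ _
                }
              ; identity = (λ f k → +-identityˡ _) , (λ f k → +-identityʳ _)
              }
            ; inverse = (λ f k → -‿inverseˡ _) , (λ f k → -‿inverseʳ _)
            ; ⁻¹-cong = λ p k → -‿cong (p k)
            }
          ; comm = λ f g k → +-comm _ _
          }
        ; *-cong = *-cong′
        ; *-assoc = *-assoc′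
        ; *-identity = identityˡ′ , λ f k → trans (*-comm′ f S.1# k) (identityˡ′ f k)
        ; distrib = (λ f g h k → trans (*-comm′ f (g S.+ h) k)
                      (trans (distribʳ′ f g h k) (+-cong (*-comm′ g f k) (*-comm′ h f k))))
                  , distribʳ′
        }
      ; *-comm = *-comm′
      }
    }
    where open import Data.Product.Base using (_,_)

  shift : S.Carrier → S.Carrier
  shift f zero    = 0#
  shift f (suc k) = f k

  X-* : ∀ f → X rawRing S.* f S.≈ shift f
  X-* f zero    = trans (+-identityʳ _) (zeroˡ _)
  X-* f (suc k) = begin
    0# * f (suc k) + (X′ S.* f) k   ≈⟨ +-cong (zeroˡ _) (*-cong′ {g = f} X′≈1 (λ _ → refl) k) ⟩
    0# + (S.1# S.* f) k             ≈⟨ +-identityˡ _ ⟩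
    (S.1# S.* f) k                  ≈⟨ identityˡ′ f k ⟩
    f k                             ∎
    where
    X′ = λ i → X rawRing (suc i)
    X′≈1 : X′ S.≈ S.1#
    X′≈1 zero    = refl
    X′≈1 (suc k) = refl

  const-* : ∀ a f k → (const rawRing a S.* f) k ≈ a * f k
  const-* a f zero    = +-identityʳ _
  const-* a f (suc k) = trans (+-congˡ (zeroˡ′ f k)) (+-identityʳ _)

  const-isRingHomomorphism : IsRingHomomorphism rawRing (Series rawRing) (const rawRing)
  const-isRingHomomorphism = record
    { isSemiringHomomorphism = record
      { isNearSemiringHomomorphism = record
        { +-isMonoidHomomorphism = record
          { isMagmaHomomorphism = record
            { isRelHomomorphism = record { cong = λ { p zero → p ; p (suc k) → refl } }
            ; homo = λ { a b zero → refl ; a b (suc k) → sym (+-identityˡ _) }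
            }
          ; ε-homo = λ { zero → refl ; (suc k) → refl }
          }
        ; *-homo = λ { a b zero → sym (const-* a (const rawRing b) 0)
                     ; a b (suc k) → sym (trans (const-* a (const rawRing b) (suc k)) (zeroʳ a)) }
        }
      ; 1#-homo = λ { zero → refl ; (suc k) → refl }
      }
    ; -‿homo = λ { a zero → refl ; a (suc k) → sym -0#≈0# }
    }
    where open RingProperties ring using (-0#≈0#)

module Homomorphism {a b ℓ₁ ℓ₂ : Level} (A : CommutativeRing a ℓ₁) (B : CommutativeRing b ℓ₂)
  (h : CommutativeRing.Carrier A → CommutativeRing.Carrier B)
  (h-hom : IsRingHomomorphism (CommutativeRing.rawRing A) (CommutativeRing.rawRing B) h) where
  private
    module A = CommutativeRing A
    module B = CommutativeRing B
    module Aᵈ = RawSemiringDefs (RawRing.rawSemiring A.rawRing)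
    module Bᵈ = RawSemiringDefs (RawRing.rawSemiring B.rawRing)
  open B using (_≈_)
  open IsRingHomomorphism h-hom

  ^-homo : ∀ x n → h (x Aᵈ.^ n) ≈ h x Bᵈ.^ n
  ^-homo x zero    = 1#-homo
  ^-homo x (suc n) = B.trans (*-homo x _) (B.*-congˡ (^-homo x n))

  ×-homo : ∀ n x → h (n Aᵈ.× x) ≈ n Bᵈ.× h x
  ×-homo zero    x = 0#-homo
  ×-homo (suc n) x = B.trans (+-homo x _) (B.+-congˡ (×-homo n x))

  sum-homo : ∀ {n} (f : Fin n → A.Carrier) → h (Aᵈ.sum f) ≈ Bᵈ.sum (λ i → h (f i))
  sum-homo {zero}  f = 0#-homo
  sum-homo {suc n} f = B.trans (+-homo _ _) (B.+-congˡ (sum-homo (λ i → f (Fin.suc i))))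

  fromℤ-homo : ∀ i → h (fromℤ A.rawRing i) ≈ fromℤ B.rawRing i
  fromℤ-homo (+ n)    = B.trans (×-homo n A.1#) (Mult.×-congʳ B.semiring n 1#-homo)
  fromℤ-homo -[1+ n ] = B.trans (-‿homo _) (B.-‿cong (fromℤ-homo (+ suc n)))

ℤ-series : CommutativeRing 0ℓ 0ℓ
ℤ-series = SeriesRing.commutativeRing ℤ.+-*-commutativeRing

module Polynomials where
  private module S = CommutativeRing ℤ-series

  coeff-+ : ∀ p q k → coeff (p +ₚ q) k ≡ coeff p k ℤ.+ coeff q k
  coeff-+ []      q       k       = ≡.sym (ℤ.+-identityˡ _)
  coeff-+ (a ∷ p) []      k       = ≡.sym (ℤ.+-identityʳ _)
  coeff-+ (a ∷ p) (b ∷ q) zero    = ≡.refl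
  coeff-+ (a ∷ p) (b ∷ q) (suc k) = coeff-+ p q k

  coeff-map : (g : ℤ → ℤ) → g 0ℤ ≡ 0ℤ → ∀ p k → coeff (List.map g p) k ≡ g (coeff p k)
  coeff-map g g0 []      k       = ≡.sym g0
  coeff-map g g0 (a ∷ p) zero    = ≡.refl
  coeff-map g g0 (a ∷ p) (suc k) = coeff-map g g0 p k

  coeff-* : ∀ p q k → coeff (p *ₚ q) k ≡ (coeff p S.* coeff q) k
  coeff-* []      q k       = ≡.sym (S.zeroˡ (coeff q) k)
  coeff-* (a ∷ p) q zero    =
    ≡.trans (coeff-+ (List.map (a ℤ.*_) q) (0ℤ ∷ p *ₚ q) 0)
            (≡.cong (ℤ._+ 0ℤ) (coeff-map (a ℤ.*_) (ℤ.*-zeroʳ a) q 0))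
  coeff-* (a ∷ p) q (suc k) =
    ≡.trans (coeff-+ (List.map (a ℤ.*_) q) (0ℤ ∷ p *ₚ q) (suc k))
            (≡.cong₂ ℤ._+_ (coeff-map (a ℤ.*_) (ℤ.*-zeroʳ a) q (suc k)) (coeff-* p q k))

  coeff-1 : coeff (1ℤ ∷ []) S.≈ S.1#
  coeff-1 zero    = ≡.refl
  coeff-1 (suc k) = ≡.refl

  coeff-isRingMonomorphism : IsRingMonomorphism ℤ[x] S.rawRing coeff
  coeff-isRingMonomorphism = record
    { isRingHomomorphism = record
      { isSemiringHomomorphism = record
        { isNearSemiringHomomorphism = record
          { +-isMonoidHomomorphism = record
            { isMagmaHomomorphism = record
              { isRelHomomorphism = record { cong = id }
              ; homo = coeff-+
              }
            ; ε-homo = λ _ → ≡.refl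
            }
          ; *-homo = coeff-*
          }
        ; 1#-homo = coeff-1
        }
      ; -‿homo = coeff-map (λ a → ℤ.- a) ≡.refl
      }
    ; injective = id
    }

  commutativeRing : CommutativeRing 0ℓ 0ℓ
  commutativeRing = record
    { isCommutativeRing =
        RingMonomorphism.isCommutativeRing coeff-isRingMonomorphism S.isCommutativeRing }

  coeff-isRingHomomorphism : IsRingHomomorphism ℤ[x] S.rawRing coeff
  coeff-isRingHomomorphism = IsRingMonomorphism.isRingHomomorphism coeff-isRingMonomorphism

module Evaluation {c ℓ : Level} (R : CommutativeRing c ℓ) (y : CommutativeRing.Carrier R) where
  open CommutativeRing R
  open RawSemiringDefs (RawRing.rawSemiring rawRing) using (_^_; sum)
  open IntegerScalars R
  open Solver using (solve; _:+_; _:*_; :-_; con; _:=_)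
  open RingProperties ring using (-0#≈0#)
  open SetoidReasoning setoid
  open RawRing ℤ[x] using () renaming (_≈_ to _≈ₓ_; -_ to -ₚ_)

  ev : Poly → Carrier
  ev p = eval rawRing p y

  -- Equal polynomials may be lists of different lengths; this disposes of the excess zeros in
  -- `ev-cong`.
  ev-zero : ∀ p → (∀ k → coeff p k ≡ 0ℤ) → ev p ≈ 0#
  ev-zero []      p≈0 = refl
  ev-zero (a ∷ p) p≈0 = begin
    fromℤ rawRing a + y * ev p   ≈⟨ +-cong (reflexive (≡.cong (fromℤ rawRing) (p≈0 0)))
                                           (*-congˡ (ev-zero p (λ k → p≈0 (suc k)))) ⟩
    0# + y * 0#                  ≈⟨ +-identityˡ _ ⟩
    y * 0#                       ≈⟨ zeroʳ y ⟩
    0#                           ∎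

  ev-cong : ∀ {p q} → p ≈ₓ q → ev p ≈ ev q
  ev-cong {[]}    {q}     p≈q = sym (ev-zero q (λ k → ≡.sym (p≈q k)))
  ev-cong {a ∷ p} {[]}    p≈q = ev-zero (a ∷ p) p≈q
  ev-cong {a ∷ p} {b ∷ q} p≈q = +-cong (reflexive (≡.cong (fromℤ rawRing) (p≈q 0)))
                                       (*-congˡ (ev-cong {p} {q} (λ k → p≈q (suc k))))

  ev-+ : ∀ p q → ev (p +ₚ q) ≈ ev p + ev q
  ev-+ []      q       = sym (+-identityˡ _)
  ev-+ (a ∷ p) []      = sym (+-identityʳ _)
  ev-+ (a ∷ p) (b ∷ q) = trans (+-cong (fromℤ-+ a b) (*-congˡ (ev-+ p q)))
    (solve 5 (λ a b y p q → (a :+ b) :+ y :* (p :+ q) := (a :+ y :* p) :+ (b :+ y :* q))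
      refl _ _ y _ _)

  ev-scale : ∀ a q → ev (List.map (a ℤ.*_) q) ≈ fromℤ rawRing a * ev q
  ev-scale a []      = sym (zeroʳ _)
  ev-scale a (b ∷ q) = trans (+-cong (fromℤ-* a b) (*-congˡ (ev-scale a q)))
    (solve 4 (λ a b y q → a :* b :+ y :* (a :* q) := a :* (b :+ y :* q)) refl _ _ y _)

  ev-* : ∀ p q → ev (p *ₚ q) ≈ ev p * ev q
  ev-* []      q = sym (zeroˡ _)
  ev-* (a ∷ p) q = begin
    ev (List.map (a ℤ.*_) q +ₚ (0ℤ ∷ p *ₚ q))
      ≈⟨ ev-+ (List.map (a ℤ.*_) q) (0ℤ ∷ p *ₚ q) ⟩
    ev (List.map (a ℤ.*_) q) + (0# + y * ev (p *ₚ q))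
      ≈⟨ +-cong (ev-scale a q) (+-congˡ (*-congˡ (ev-* p q))) ⟩
    fromℤ rawRing a * ev q + (0# + y * (ev p * ev q))
      ≈⟨ solve 4 (λ a y p q → a :* q :+ (con 0ℤ :+ y :* (p :* q)) := (a :+ y :* p) :* q) refl _ y _ _ ⟩
    (fromℤ rawRing a + y * ev p) * ev q ∎

  ev-neg : ∀ p → ev (-ₚ p) ≈ - ev p
  ev-neg []      = sym -0#≈0#
  ev-neg (a ∷ p) = trans (+-cong (fromℤ-neg a) (*-congˡ (ev-neg p)))
    (solve 3 (λ a y p → :- a :+ y :* :- p := :- (a :+ y :* p)) refl _ y _)

  ev-1 : ev (1ℤ ∷ []) ≈ 1#
  ev-1 = trans (+-cong fromℤ-1 (zeroʳ y)) (+-identityʳ 1#)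

  ev-monomial : ∀ d → ev (monomial d) ≈ y ^ d
  ev-monomial zero    = ev-1
  ev-monomial (suc d) = trans (+-identityˡ _) (*-congˡ (ev-monomial d))

  ev-isRingHomomorphism : IsRingHomomorphism ℤ[x] rawRing ev
  ev-isRingHomomorphism = record
    { isSemiringHomomorphism = record
      { isNearSemiringHomomorphism = record
        { +-isMonoidHomomorphism = record
          { isMagmaHomomorphism = record
            { isRelHomomorphism = record { cong = λ {p} {q} → ev-cong {p} {q} }
            ; homo = ev-+
            }
          ; ε-homo = refl
          }
        ; *-homo = ev-*
        }
      ; 1#-homo = ev-1
      }
    ; -‿homo = ev-neg
    }

  ev-applyUpTo : ∀ (d : ℕ → ℤ) n →
    ev (applyUpTo d n) ≈ sum {n} (λ i → fromℤ rawRing (d (toℕ i)) * y ^ toℕ i)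
  ev-applyUpTo d zero    = refl
  ev-applyUpTo d (suc n) = begin
    fromℤ rawRing (d 0) + y * ev (applyUpTo (λ i → d (suc i)) n)
      ≈⟨ +-cong (sym (*-identityʳ _)) (*-congˡ (ev-applyUpTo (λ i → d (suc i)) n)) ⟩
    fromℤ rawRing (d 0) * 1# + y * sum {n} term
      ≈⟨ +-congˡ (*-distribˡ-sum {n} y term) ⟩
    fromℤ rawRing (d 0) * 1# + sum {n} (λ i → y * term i)
      ≈⟨ +-congˡ (sum-cong-≋ {n} (λ i →
           solve 3 (λ a b c → a :* (b :* c) := b :* (a :* c)) refl y (fromℤ rawRing (d (suc (toℕ i)))) (y ^ toℕ i))) ⟩
    fromℤ rawRing (d 0) * 1# + sum {n} (λ i → fromℤ rawRing (d (suc (toℕ i))) * (y * y ^ toℕ i)) ∎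
    where
    open SemiringSum semiring using (*-distribˡ-sum)
    open MonoidSum +-monoid using (sum-cong-≋)
    term : Fin n → Carrier
    term i = fromℤ rawRing (d (suc (toℕ i))) * y ^ toℕ i

module Units {c ℓ : Level} (R : CommutativeRing c ℓ) where
  open CommutativeRing R
  open RawSemiringDefs (RawRing.rawSemiring rawRing) using (_^_)
  open SetoidReasoning setoid

  cancel-unit : ∀ {u u⁻¹} → u * u⁻¹ ≈ 1# → ∀ {x y} → u * x ≈ u * y → x ≈ y
  cancel-unit {u} {u⁻¹} uu⁻¹ {x} {y} ux≈uy = begin
    x               ≈⟨ back x ⟨
    u⁻¹ * (u * x)   ≈⟨ *-congˡ ux≈uy ⟩
    u⁻¹ * (u * y)   ≈⟨ back y ⟩
    y               ∎
    where
    back : ∀ z → u⁻¹ * (u * z) ≈ z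
    back z = trans (sym (*-assoc _ _ _)) (trans (*-congʳ (trans (*-comm _ _) uu⁻¹)) (*-identityˡ z))

  1^ : ∀ n → 1# ^ n ≈ 1#
  1^ zero    = refl
  1^ (suc n) = trans (*-identityˡ _) (1^ n)

  ^-unit : ∀ {u u⁻¹} → u * u⁻¹ ≈ 1# → ∀ n → u ^ n * u⁻¹ ^ n ≈ 1#
  ^-unit {u} {u⁻¹} uu⁻¹ n = begin
    u ^ n * u⁻¹ ^ n    ≈⟨ ^-distrib-* u u⁻¹ n ⟨
    (u * u⁻¹) ^ n      ≈⟨ ^-congˡ n uu⁻¹ ⟩
    1# ^ n             ≈⟨ 1^ n ⟩
    1#                 ∎
    where
    open CExp commutativeSemiring using (^-distrib-*)
    open Exp semiring using (^-congˡ)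

module GeometricSeries {c ℓ : Level} (R : CommutativeRing c ℓ) (a : CommutativeRing.Carrier R) where
  open CommutativeRing R
  private module S = CommutativeRing (SeriesRing.commutativeRing R)
  open RingProperties ring using (-‿distribˡ-*)

  1+aX-inverse : (S.1# S.+ const rawRing a S.* X rawRing) S.* (1/1+_X rawRing a) S.≈ S.1#
  1+aX-inverse = S.trans {j = S.1# S.* g S.+ aX S.* g} (S.distribʳ g S.1# aX)
    (S.trans {j = g S.+ cₐ S.* (X rawRing S.* g)}
      (S.+-cong {S.1# S.* g} {g} {aX S.* g} {cₐ S.* (X rawRing S.* g)}
        (S.*-identityˡ g) (S.*-assoc cₐ (X rawRing) g)) pointwise)
    where
    g  = 1/1+_X rawRing a
    cₐ = const rawRing a
    aX = cₐ S.* X rawRing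
    coefficient : ∀ k → (cₐ S.* (X rawRing S.* g)) k ≈ a * SeriesRing.shift R g k
    coefficient k = trans (SeriesRing.const-* R a (X rawRing S.* g) k) (*-congˡ (SeriesRing.X-* R g k))
    pointwise : g S.+ cₐ S.* (X rawRing S.* g) S.≈ S.1#
    pointwise zero    = trans (+-congˡ (trans (coefficient 0) (zeroʳ a))) (+-identityʳ 1#)
    pointwise (suc k) = trans (+-cong (sym (-‿distribˡ-* a (g k))) (coefficient (suc k))) (-‿inverseˡ _)

-- γ-expansions as binary forms

module GammaForm {c ℓ : Level} (R : CommutativeRing c ℓ) (d : ℕ → ℤ) (j : ℕ) where
  open CommutativeRing R
  open RawSemiringDefs (RawRing.rawSemiring rawRing) using (_^_; sum)
  open SemiringSum semiring using (*-distribˡ-sum)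
  open MonoidSum +-monoid using (sum-cong-≋)
  open Exp semiring using (^-congˡ; ^-congʳ; ^-homo-*; ^-assocʳ)
  open CExp commutativeSemiring using (^-distrib-*)
  open IntegerScalars R
  open Solver using (solve; _:*_; _:=_)
  open SetoidReasoning setoid

  -- The binary form Σ d_s wˢ L^{2j-2s}, which is p(w/L²) L^{2j} when d lists the coefficients of p.
  term : Carrier → Carrier → ℕ → Carrier
  term w L s = fromℤ rawRing (d s) * (w ^ s * L ^ (2 ℕ.* j ∸ 2 ℕ.* s))

  form : Carrier → Carrier → Carrier
  form w L = sum {suc j} λ i → term w L (toℕ i)

  form-cong : ∀ {w w′ L L′} → w ≈ w′ → L ≈ L′ → form w L ≈ form w′ L′
  form-cong w≈ L≈ = sum-cong-≋ {suc j} λ i → *-congˡ {fromℤ rawRing (d (toℕ i))} (*-cong (^-congˡ (toℕ i) w≈) (^-congˡ (2 ℕ.* j ∸ 2 ℕ.* toℕ i) L≈))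

  -- With w of weight 2 and L of weight 1 every term is homogeneous of degree 2j. The bound s ≤ j
  -- makes 2s + (2j ∸ 2s) equal to 2j despite the truncated subtraction.
  scale-term : ∀ a w L s → s ℕ.≤ j → a ^ (2 ℕ.* j) * term w L s ≈ term (a ^ 2 * w) (a * L) s
  scale-term a w L s s≤j = begin
    a ^ (2 ℕ.* j) * (δ * (w ^ s * L ^ m))
      ≈⟨ *-congʳ (begin
           a ^ (2 ℕ.* j)            ≈⟨ ^-congʳ a (≡.sym (ℕ.m+[n∸m]≡n (ℕ.*-monoʳ-≤ 2 s≤j))) ⟩
           a ^ (2 ℕ.* s ℕ.+ m)      ≈⟨ ^-homo-* a (2 ℕ.* s) m ⟩
           a ^ (2 ℕ.* s) * a ^ m    ≈⟨ *-congʳ (sym (^-assocʳ a 2 s)) ⟩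
           (a ^ 2) ^ s * a ^ m      ∎) ⟩
    (a ^ 2) ^ s * a ^ m * (δ * (w ^ s * L ^ m))
      ≈⟨ solve 5 (λ p q d w l → p :* q :* (d :* (w :* l)) := d :* ((p :* w) :* (q :* l)))
           refl ((a ^ 2) ^ s) (a ^ m) δ (w ^ s) (L ^ m) ⟩
    δ * (((a ^ 2) ^ s * w ^ s) * (a ^ m * L ^ m))
      ≈⟨ *-congˡ (*-cong (^-distrib-* (a ^ 2) w s) (^-distrib-* a L m)) ⟨
    δ * ((a ^ 2 * w) ^ s * (a * L) ^ m) ∎
    where
    m = 2 ℕ.* j ∸ 2 ℕ.* s
    δ = fromℤ rawRing (d s)

  scale-form : ∀ a w L → a ^ (2 ℕ.* j) * form w L ≈ form (a ^ 2 * w) (a * L)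
  scale-form a w L = trans (*-distribˡ-sum {suc j} (a ^ (2 ℕ.* j)) (λ i → term w L (toℕ i)))
    (sum-cong-≋ {suc j} λ i → scale-term a w L (toℕ i) (ℕ.s≤s⁻¹ (Fin.toℕ<n i)))

  eval-form : ∀ z → eval rawRing (applyUpTo d (suc j)) z ≈ form z 1#
  eval-form z = trans (Evaluation.ev-applyUpTo R z d (suc j))
    (sum-cong-≋ {suc j} λ i → *-congˡ {fromℤ rawRing (d (toℕ i))} (sym (trans (*-congˡ {z ^ toℕ i} (1^ (2 ℕ.* j ∸ 2 ℕ.* toℕ i))) (*-identityʳ _))))
    where open Units R using (1^)

  -- Multiplying by L to the power 2j clears the denominators of p(w/L²). Both defining formulas
  -- have this shape: the γ-expansion with L = 1+t and w = t, and `A` with L = 1+4xW and w =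
  -- x(1+2W+4xW²).
  dehomogenise : ∀ {L z w} → L ^ 2 * z ≈ w →
                 L ^ (2 ℕ.* j) * eval rawRing (applyUpTo d (suc j)) z ≈ form w L
  dehomogenise {L} {z} {w} L²z≈w = begin
    L ^ (2 ℕ.* j) * eval rawRing (applyUpTo d (suc j)) z   ≈⟨ *-congˡ (eval-form z) ⟩
    L ^ (2 ℕ.* j) * form z 1#                              ≈⟨ scale-form L z 1# ⟩
    form (L ^ 2 * z) (L * 1#)                              ≈⟨ form-cong L²z≈w (*-identityʳ L) ⟩
    form w L                                               ∎

  square-quotient : ∀ {L L⁻¹} w → L * L⁻¹ ≈ 1# → L ^ 2 * (w * L⁻¹ ^ 2) ≈ w
  square-quotient {L} {L⁻¹} w LL⁻¹≈1 = begin
    L ^ 2 * (w * L⁻¹ ^ 2)   ≈⟨ solve 3 (λ x y z → x :* (y :* z) := y :* (x :* z)) refl (L ^ 2) w (L⁻¹ ^ 2) ⟩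
    w * (L ^ 2 * L⁻¹ ^ 2)   ≈⟨ *-congˡ (Units.^-unit R LL⁻¹≈1 2) ⟩
    w * 1#                  ≈⟨ *-identityʳ w ⟩
    w                       ∎

  split-form : ∀ x q L →
    form (x * q) L ≈ sum {suc j} (λ i → fromℤ rawRing (d (toℕ i)) * x ^ toℕ i * L ^ (2 ℕ.* j ∸ 2 ℕ.* toℕ i) * q ^ toℕ i)
  split-form x q L = sum-cong-≋ {suc j} λ i → let s = toℕ i ; m = 2 ℕ.* j ∸ 2 ℕ.* s in
    trans (*-congˡ (*-congʳ (^-distrib-* x q s)))
      (solve 4 (λ d x q l → d :* (x :* q :* l) := d :* x :* l :* q) refl
        (fromℤ rawRing (d s)) (x ^ s) (q ^ s) (L ^ m))

module FormHomomorphism {a b ℓ₁ ℓ₂ : Level} (A : CommutativeRing a ℓ₁) (B : CommutativeRing b ℓ₂)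
  (h : CommutativeRing.Carrier A → CommutativeRing.Carrier B)
  (h-hom : IsRingHomomorphism (CommutativeRing.rawRing A) (CommutativeRing.rawRing B) h)
  (d : ℕ → ℤ) (j : ℕ) where
  private
    module A = GammaForm A d j
    module B = GammaForm B d j
  open CommutativeRing B
  open Homomorphism A B h h-hom
  open IsRingHomomorphism h-hom
  open MonoidSum +-monoid using (sum-cong-≋)

  form-homo : ∀ w L → h (A.form w L) ≈ B.form (h w) (h L)
  form-homo w L = trans (sum-homo {suc j} (λ i → A.term w L (toℕ i)))
    (sum-cong-≋ {suc j} λ i → trans (*-homo _ _) (*-cong (fromℤ-homo (d (toℕ i)))
      (trans (*-homo _ _) (*-cong (^-homo w (toℕ i)) (^-homo L (2 ℕ.* j ∸ 2 ℕ.* toℕ i))))))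

ℤ[x]-series : CommutativeRing 0ℓ 0ℓ
ℤ[x]-series = SeriesRing.commutativeRing Polynomials.commutativeRing

module Expansion where
  open CommutativeRing ℤ[x]-series
  open RawSemiringDefs (RawRing.rawSemiring rawRing) using (_^_) renaming (_×_ to _·_)
  private
    x W : Carrier
    x = const ℤ[x] (monomial 1)
    W = X ℤ[x]

  4x≈const : 4 · (x * W) ≈ const ℤ[x] (+ 0 ∷ + 4 ∷ []) * W
  4x≈const = trans {i = 4 · (x * W)} {j = (4 · x) * W} {k = const ℤ[x] (+ 0 ∷ + 4 ∷ []) * W} (sym {(4 · x) * W} {4 · (x * W)} (Mult.×-assoc-* semiring 4 x W))
    (*-congʳ {W} {4 · x} {const ℤ[x] (+ 0 ∷ + 4 ∷ [])}
      λ { zero → λ { zero → ≡.refl ; (suc zero) → ≡.refl ; (suc (suc k)) → ≡.refl }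
        ; (suc n) k → ≡.refl })

  1+4xW-inverse : 1+4xW * 1/[1+4xW] ≈ 1#
  1+4xW-inverse = trans {i = 1+4xW * 1/[1+4xW]} {j = (1# + const ℤ[x] (+ 0 ∷ + 4 ∷ []) * W) * 1/[1+4xW]} {k = 1#}
    (*-congʳ {1/[1+4xW]} {1+4xW} {1# + const ℤ[x] (+ 0 ∷ + 4 ∷ []) * W}
      (+-congˡ {1#} {4 · (x * W)} {const ℤ[x] (+ 0 ∷ + 4 ∷ []) * W} 4x≈const))
    (GeometricSeries.1+aX-inverse Polynomials.commutativeRing (+ 0 ∷ + 4 ∷ []))

  module _ (d : ℕ → ℤ) (j : ℕ) where
    open GammaForm ℤ[x]-series d j

    A≈form : A (applyUpTo d (suc j)) j ≈ form (x * 1+2W+4xW²) 1+4xW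
    A≈form = dehomogenise {1+4xW} {x * 1+2W+4xW² * 1/[1+4xW] ^ 2} {x * 1+2W+4xW²}
      (square-quotient {1+4xW} {1/[1+4xW]} (x * 1+2W+4xW²) 1+4xW-inverse)

    A≈expansion : A (applyUpTo d (suc j)) j ≈ expansion d j
    A≈expansion = trans {i = A (applyUpTo d (suc j)) j} {j = form (x * 1+2W+4xW²) 1+4xW} {k = expansion d j}
      A≈form (split-form x 1+2W+4xW² 1+4xW)

-- Natural coefficients

record IsSubsemiring {c ℓ p : Level} (R : RawRing c ℓ) (N : Pred (RawRing.Carrier R) p) : Set (c ⊔ p) where
  open RawRing R
  open RawSemiringDefs rawSemiring using (_^_; sum) renaming (_×_ to _·_)
  field
    0-closed : N 0#
    1-closed : N 1#
    +-closed : ∀ {x y} → N x → N y → N (x + y)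
    *-closed : ∀ {x y} → N x → N y → N (x * y)

  sum-closed : ∀ {n} {f : Fin n → Carrier} → (∀ i → N (f i)) → N (sum f)
  sum-closed {zero}  Nf = 0-closed
  sum-closed {suc n} Nf = +-closed (Nf Fin.zero) (sum-closed (λ i → Nf (Fin.suc i)))

  ·-closed : ∀ n {x} → N x → N (n · x)
  ·-closed zero    Nx = 0-closed
  ·-closed (suc n) Nx = +-closed Nx (·-closed n Nx)

  ^-closed : ∀ {x} n → N x → N (x ^ n)
  ^-closed zero    Nx = 1-closed
  ^-closed (suc n) Nx = *-closed Nx (^-closed n Nx)

  fromℤ-closed : ∀ {i} → IsNatural i → N (fromℤ R i)
  fromℤ-closed (m , ≡.refl) = ·-closed m 1-closed

  expansion-term-closed : ∀ {i} x W s m → IsNatural i → N x → N W →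
    N (fromℤ R i * x ^ s * (1# + 4 · (x * W)) ^ m * (1# + 2 · W + 4 · (x * W ^ 2)) ^ s)
  expansion-term-closed x W s m i∈ℕ Nx NW = *-closed (*-closed (*-closed
    (fromℤ-closed i∈ℕ) (^-closed s Nx)) (^-closed m (+-closed 1-closed (·-closed 4 (*-closed Nx NW)))))
    (^-closed s (+-closed (+-closed 1-closed (·-closed 2 NW)) (·-closed 4 (*-closed Nx (^-closed 2 NW)))))

-- Coefficients of a product are finite sums of products, so a subsemiring passes to the series over
-- it. Going from ℕ inside ℤ to ℕ[x] and then to series in W makes the positivity of the expansion a
-- matter of its syntax.
Series-isSubsemiring : {c ℓ p : Level} {R : RawRing c ℓ} {N : Pred (RawRing.Carrier R) p} →
  IsSubsemiring R N → IsSubsemiring (Series R) (λ f → ∀ k → N (f k))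
Series-isSubsemiring {R = R} isN = record
  { 0-closed = λ k → 0-closed
  ; 1-closed = λ { zero → 1-closed ; (suc k) → 0-closed }
  ; +-closed = λ Nf Ng k → +-closed (Nf k) (Ng k)
  ; *-closed = λ Nf Ng k → sum-closed {suc k} (λ i → *-closed (Nf (toℕ i)) (Ng (k ∸ toℕ i)))
  }
  where open IsSubsemiring isN

ℕ-isSubsemiring : IsSubsemiring ℤ.+-*-rawRing IsNatural
ℕ-isSubsemiring = record
  { 0-closed = 0 , ≡.refl
  ; 1-closed = 1 , ≡.refl
  ; +-closed = λ { (m , ≡.refl) (n , ≡.refl) → m ℕ.+ n , ≡.refl }
  ; *-closed = λ { (m , ≡.refl) (n , ≡.refl) → m ℕ.* n , ≡.sym (ℤ.pos-* m n) }
  }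

ℕ[x]-isSubsemiring : IsSubsemiring ℤ[x] _∈ℕ[x]
ℕ[x]-isSubsemiring = record
  { 0-closed = λ k → 0 , ≡.refl
  ; 1-closed = λ { zero → 1 , ≡.refl ; (suc k) → 0 , ≡.refl }
  ; +-closed = λ {p} {q} Np Nq k →
      ≡.subst IsNatural (≡.sym (Polynomials.coeff-+ p q k)) (+-closed Np Nq k)
  ; *-closed = λ {p} {q} Np Nq k →
      ≡.subst IsNatural (≡.sym (Polynomials.coeff-* p q k)) (*-closed Np Nq k)
  }
  where open IsSubsemiring (Series-isSubsemiring ℕ-isSubsemiring)

expansion-natural : ∀ (d : ℕ → ℤ) j → (∀ s → s ℕ.≤ j → IsNatural (d s)) → ∀ r → expansion d j r ∈ℕ[x]
expansion-natural d j d∈ℕ = sum-closed {suc j} {λ i → summand (toℕ i)} λ i →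
  expansion-term-closed (const ℤ[x] (monomial 1)) (X ℤ[x]) (toℕ i) (2 ℕ.* j ∸ 2 ℕ.* toℕ i)
    (d∈ℕ (toℕ i) (ℕ.s≤s⁻¹ (Fin.toℕ<n i))) x∈ W∈
  where
  open IsSubsemiring (Series-isSubsemiring ℕ[x]-isSubsemiring)
  open RawRing ℤ[x][[W]]
  open RawSemiringDefs rawSemiring using (_^_)
  summand : ℕ → Carrier
  summand s = fromℤ ℤ[x][[W]] (d s) * const ℤ[x] (monomial 1) ^ s
    * 1+4xW ^ (2 ℕ.* j ∸ 2 ℕ.* s) * 1+2W+4xW² ^ s
  module C = IsSubsemiring ℕ[x]-isSubsemiring
  x∈ : ∀ r → const ℤ[x] (monomial 1) r ∈ℕ[x]
  x∈ zero    = λ { zero → 0 , ≡.refl ; (suc zero) → 1 , ≡.refl ; (suc (suc k)) → 0 , ≡.refl }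
  x∈ (suc r) = C.0-closed
  W∈ : ∀ r → X ℤ[x] r ∈ℕ[x]
  W∈ zero          = C.0-closed
  W∈ (suc zero)    = C.1-closed
  W∈ (suc (suc r)) = C.0-closed

-- The binomial transform

module BinomialTransform {c ℓ c′ ℓ′ : Level} (A : CommutativeRing c ℓ) (K : CommutativeRing c′ ℓ′)
  (e : CommutativeRing.Carrier A → CommutativeRing.Carrier K)
  (e-hom : IsRingHomomorphism (CommutativeRing.rawRing A) (CommutativeRing.rawRing K) e)
  (T : CommutativeRing.Carrier K) where
  open CommutativeRing K
  open RawSemiringDefs (RawRing.rawSemiring rawRing) using (_^_; sum) renaming (_×_ to _·_)
  open IsRingHomomorphism e-hom
  open CommutativeMonoidSum +-commutativeMonoid using (∑-distrib-+)
  open MonoidSum +-monoid using (sum-cong-≋; sum-replicate-zero)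
  open SemiringSum semiring using (*-distribˡ-sum)
  open Mult semiring using (×-congʳ; ×-homo-+; ×-comm-*; ×-congˡ)
  open CommutativeMonoidMult +-commutativeMonoid using (×-distrib-+)
  open IntegerScalars K
  open Solver using (solve; _:+_; _:*_; :-_; con; :1; _:=_)
  open RingProperties ring using (-‿involutive)
  open SetoidReasoning setoid
  private
    module Aˢ = CommutativeRing (SeriesRing.commutativeRing A)
    module S  = CommutativeRing (SeriesRing.commutativeRing K)
    module A = CommutativeRing A

  shift : S.Carrier → S.Carrier
  shift = SeriesRing.shift K

  sum-last : ∀ (g : ℕ → Carrier) n → sum {suc n} (λ i → g (toℕ i)) ≈ sum {n} (λ i → g (toℕ i)) + g n
  sum-last g zero    = +-comm _ _
  sum-last g (suc n) = trans (+-congˡ (sum-last (λ i → g (suc i)) n)) (sym (+-assoc _ _ _))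

  transform : S.Carrier → S.Carrier
  transform a f = sum {suc f} λ i → (f C toℕ i) · a (toℕ i)

  transform-cong : ∀ {a b} → a S.≈ b → transform a S.≈ transform b
  transform-cong a≈b f = sum-cong-≋ {suc f} λ i → ×-congʳ (f C toℕ i) (a≈b (toℕ i))

  transform-+ : ∀ a b → transform (a S.+ b) S.≈ transform a S.+ transform b
  transform-+ a b f = trans (sum-cong-≋ {suc f} (λ i → ×-distrib-+ (a (toℕ i)) (b (toℕ i)) (f C toℕ i)))
    (∑-distrib-+ {suc f} (λ i → (f C toℕ i) · a (toℕ i)) (λ i → (f C toℕ i) · b (toℕ i)))

  transform-scale : ∀ k a f → transform (λ r → k * a r) f ≈ k * transform a f
  transform-scale k a f = trans (sum-cong-≋ {suc f} (λ i → sym (×-comm-* (f C toℕ i) k (a (toℕ i)))))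
    (sym (*-distribˡ-sum {suc f} k (λ i → (f C toℕ i) · a (toℕ i))))

  transform-1 : ∀ f → transform S.1# f ≈ 1#
  transform-1 f = begin
    1 · 1# + sum {f} (λ i → (f C suc (toℕ i)) · 0#)   ≈⟨ +-cong (+-identityʳ 1#) (sum-cong-≋ {f} (λ i → n·0 (f C suc (toℕ i)))) ⟩
    1# + sum {f} (λ i → 0#)                           ≈⟨ +-congˡ (sum-replicate-zero f) ⟩
    1# + 0#                                           ≈⟨ +-identityʳ 1# ⟩
    1#                                                ∎
    where
    n·0 : ∀ n → n · 0# ≈ 0#
    n·0 zero    = refl
    n·0 (suc n) = trans (+-identityˡ _) (n·0 n)

  transform-shift : ∀ a f → transform (shift a) (suc f) ≈ transform (shift a) f + transform a f
  transform-shift a f = begin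
    1 · 0# + sum {suc f} (λ i → (suc f C suc (toℕ i)) · a (toℕ i))
      ≈⟨ trans (+-cong (+-identityˡ 0#) (sum-cong-≋ {suc f} pascal)) (+-identityˡ _) ⟩
    sum {suc f} (λ i → next (toℕ i) + (f C toℕ i) · a (toℕ i))
      ≈⟨ ∑-distrib-+ {suc f} (λ i → next (toℕ i)) (λ i → (f C toℕ i) · a (toℕ i)) ⟩
    sum {suc f} (λ i → next (toℕ i)) + transform a f
      -- The last summand carries `f C suc f`, which is 0; without it the range is that of
      -- `transform (shift a) f`.
      ≈⟨ +-congʳ (trans (sum-last next f) (trans (+-congˡ (×-congˡ {a f} (k>n⇒nCk≡0 (ℕ.n<1+n f)))) (+-identityʳ _))) ⟩
    sum {f} (λ i → next (toℕ i)) + transform a f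
      ≈⟨ +-congʳ (trans (+-congʳ (+-identityˡ 0#)) (+-identityˡ _)) ⟨
    1 · 0# + sum {f} (λ i → next (toℕ i)) + transform a f ∎
    where
    next : ℕ → Carrier
    next i = (f C suc i) · a i
    pascal : (i : Fin (suc f)) → (suc f C suc (toℕ i)) · a (toℕ i) ≈ next (toℕ i) + (f C toℕ i) · a (toℕ i)
    pascal i = begin
      (suc f C suc k) · a k                   ≡⟨ ≡.cong (_· a k) (nCk+nC[k+1]≡[n+1]C[k+1] f k) ⟨
      ((f C k) ℕ.+ (f C suc k)) · a k         ≈⟨ ×-homo-+ (a k) (f C k) (f C suc k) ⟩
      (f C k) · a k + next k                  ≈⟨ +-comm _ _ ⟩
      next k + (f C k) · a k                  ∎
      where k = toℕ i

  β : Aˢ.Carrier → S.Carrier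
  β a f = T ^ f * transform (λ r → e (a r)) f

  β-cong : ∀ {a b} → a Aˢ.≈ b → β a S.≈ β b
  β-cong a≈b f = *-congˡ (transform-cong (λ r → ⟦⟧-cong (a≈b r)) f)

  β-+ : ∀ a b → β (a Aˢ.+ b) S.≈ β a S.+ β b
  β-+ a b f = trans (*-congˡ (trans (transform-cong (λ r → +-homo (a r) (b r)) f)
    (transform-+ (λ r → e (a r)) (λ r → e (b r)) f))) (distribˡ (T ^ f) _ _)

  β-const : ∀ k a → β (const A.rawRing k Aˢ.* a) S.≈ const rawRing (e k) S.* β a
  β-const k a f = begin
    T ^ f * transform (λ r → e ((const A.rawRing k Aˢ.* a) r)) f
      ≈⟨ *-congˡ (transform-cong (λ r → trans (⟦⟧-cong (SeriesRing.const-* A k a r)) (*-homo k (a r))) f) ⟩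
    T ^ f * transform (λ r → e k * e (a r)) f
      ≈⟨ *-congˡ (transform-scale (e k) (λ r → e (a r)) f) ⟩
    T ^ f * (e k * transform (λ r → e (a r)) f)
      ≈⟨ solve 3 (λ x y z → x :* (y :* z) := y :* (x :* z)) refl (T ^ f) (e k) _ ⟩
    e k * β a f
      ≈⟨ SeriesRing.const-* K (e k) (β a) f ⟨
    (const rawRing (e k) S.* β a) f ∎

  v : S.Carrier
  v = S.1# S.+ const rawRing (- T) S.* X rawRing

  v⁻¹ : S.Carrier
  v⁻¹ = 1/1+_X rawRing (- T)

  v-inverse : v S.* v⁻¹ S.≈ S.1#
  v-inverse = GeometricSeries.1+aX-inverse K (- T)

  β-1 : β Aˢ.1# S.≈ v⁻¹
  β-1 f = begin
    T ^ f * transform (λ r → e (Aˢ.1# r)) f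
      ≈⟨ *-congˡ (trans (transform-cong {λ r → e (Aˢ.1# r)} {S.1#} (λ { zero → 1#-homo ; (suc r) → 0#-homo }) f) (transform-1 f)) ⟩
    T ^ f * 1#    ≈⟨ *-identityʳ _ ⟩
    -- `v⁻¹` is the geometric series of 1 + aX with a = - T, so its coefficients are powers of - a.
    T ^ f         ≈⟨ Exp.^-congˡ semiring f (-‿involutive T) ⟨
    (- - T) ^ f   ∎

  v-* : ∀ b → v S.* b S.≈ b S.+ const rawRing (- T) S.* (X rawRing S.* b)
  v-* b = S.trans {i = v S.* b} {j = S.1# S.* b S.+ const rawRing (- T) S.* X rawRing S.* b}
      {k = b S.+ const rawRing (- T) S.* (X rawRing S.* b)}
    (S.distribʳ b S.1# (const rawRing (- T) S.* X rawRing))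
    (S.+-cong {S.1# S.* b} {b} {const rawRing (- T) S.* X rawRing S.* b} {const rawRing (- T) S.* (X rawRing S.* b)}
      (S.*-identityˡ b) (S.*-assoc (const rawRing (- T)) (X rawRing) b))

  const-X-* : ∀ k b f → (const rawRing k S.* (X rawRing S.* b)) f ≈ k * shift b f
  const-X-* k b f = trans (SeriesRing.const-* K k (X rawRing S.* b) f) (*-congˡ (SeriesRing.X-* K b f))

  v-β-X : ∀ a → v S.* β (X A.rawRing Aˢ.* a) S.≈ const rawRing T S.* (X rawRing S.* β a)
  v-β-X a f = begin
    (v S.* β (X A.rawRing Aˢ.* a)) f
      ≈⟨ v-* (β (X A.rawRing Aˢ.* a)) f ⟩
    β (X A.rawRing Aˢ.* a) f + (const rawRing (- T) S.* (X rawRing S.* β (X A.rawRing Aˢ.* a))) f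
      ≈⟨ +-congˡ (const-X-* (- T) (β (X A.rawRing Aˢ.* a)) f) ⟩
    β (X A.rawRing Aˢ.* a) f + - T * shift (β (X A.rawRing Aˢ.* a)) f
      ≈⟨ +-cong (shifted f) (*-congˡ (shift-cong f)) ⟩
    T ^ f * transform (shift b) f + - T * shift (λ i → T ^ i * transform (shift b) i) f
      ≈⟨ step f ⟩
    T * shift (β a) f
      ≈⟨ const-X-* T (β a) f ⟨
    (const rawRing T S.* (X rawRing S.* β a)) f ∎
    where
    b : S.Carrier
    b r = e (a r)
    shifted : ∀ i → β (X A.rawRing Aˢ.* a) i ≈ T ^ i * transform (shift b) i
    shifted i = *-congˡ (transform-cong
      (λ r → trans (⟦⟧-cong (SeriesRing.X-* A a r)) (e-shift r)) i)
      where
      e-shift : ∀ r → e (SeriesRing.shift A a r) ≈ shift b r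
      e-shift zero    = 0#-homo
      e-shift (suc r) = refl
    shift-cong : ∀ f → shift (β (X A.rawRing Aˢ.* a)) f ≈ shift (λ i → T ^ i * transform (shift b) i) f
    shift-cong zero    = refl
    shift-cong (suc f) = shifted f
    step : ∀ f → T ^ f * transform (shift b) f + - T * shift (λ i → T ^ i * transform (shift b) i) f ≈ T * shift (β a) f
    step zero    = solve 1 (λ t → :1 :* ((con 0ℤ :+ con 0ℤ) :+ con 0ℤ) :+ (:- t) :* con 0ℤ := t :* con 0ℤ) refl T
    step (suc f) = trans (+-congʳ (*-congˡ (transform-shift b f)))
      (solve 4 (λ t p x y → t :* p :* (x :+ y) :+ (:- t) :* (p :* x) := t :* (p :* y)) refl T (T ^ f)
        (transform (shift b) f) (transform b f))

  β-fromℤ : ∀ i a → β (fromℤ Aˢ.rawRing i Aˢ.* a) S.≈ fromℤ S.rawRing i S.* β a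
  β-fromℤ i a f = trans (β-cong {fromℤ Aˢ.rawRing i Aˢ.* a} {const A.rawRing (fromℤ A.rawRing i) Aˢ.* a}
      (Aˢ.*-congʳ {a} {fromℤ Aˢ.rawRing i} {const A.rawRing (fromℤ A.rawRing i)}
        (Aˢ.sym {const A.rawRing (fromℤ A.rawRing i)} {fromℤ Aˢ.rawRing i}
          (Homomorphism.fromℤ-homo A (SeriesRing.commutativeRing A) (const A.rawRing)
          (SeriesRing.const-isRingHomomorphism A) i))) f)
    (trans (β-const (fromℤ A.rawRing i) a f)
    (S.*-congʳ {β a} {const rawRing (e (fromℤ A.rawRing i))} {fromℤ S.rawRing i}
      (S.trans {i = const rawRing (e (fromℤ A.rawRing i))} {j = const rawRing (fromℤ rawRing i)} {k = fromℤ S.rawRing i}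
        (λ { zero → Homomorphism.fromℤ-homo A K e e-hom i ; (suc k) → refl })
        (Homomorphism.fromℤ-homo K (SeriesRing.commutativeRing K) (const rawRing) (SeriesRing.const-isRingHomomorphism K) i)) f))

-- The binomial transform of the binary form

module FixedPointSeries {r s ℓ₁ ℓ₂ : Level} (A : CommutativeRing r ℓ₁) (R : CommutativeRing s ℓ₂)
  (d : ℕ → ℤ) (j : ℕ)
  (β : CommutativeRing.Carrier A → CommutativeRing.Carrier R) where
  private
    module A = CommutativeRing A
    module Aᵈ = RawSemiringDefs (RawRing.rawSemiring A.rawRing)
    module A[] = IntegerScalars.Solver A
    module Aᶠ = GammaForm A d j
    module Rᶠ = GammaForm R d j
  open CommutativeRing R
  open RawSemiringDefs (RawRing.rawSemiring rawRing) using (_^_; sum)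
  open IntegerScalars.Solver R using (solve; _:+_; _:*_; :-_; _:^_; con; :1; _:=_)
  open SemiringSum semiring using (*-distribˡ-sum)
  open MonoidSum +-monoid using (sum-cong-≋)
  open Exp semiring using (^-congʳ; ^-homo-*; ^-assocʳ)
  open SetoidReasoning setoid

  module _
    (β-cong : ∀ {p q} → p A.≈ q → β p ≈ β q)
    (β-+ : ∀ p q → β (p A.+ q) ≈ β p + β q)
    (β-fromℤ : ∀ i p → β (fromℤ A.rawRing i A.* p) ≈ fromℤ rawRing i * β p)
    (x W : A.Carrier) (y t u v : Carrier)
    (β-x : ∀ p → β (x A.* p) ≈ y * β p)
    (v-β-W : ∀ p → v * β (W A.* p) ≈ (1# + t) * (u * β p))
    (v-β-1 : v * β A.1# ≈ 1#)
    (v≈ : v ≈ 1# + - ((1# + t) * u))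
    (y≈ : (1# + t) ^ 2 * y ≈ t)
    (Y Z : Carrier) (L q : A.Carrier)
    (Y≈ : Y ≈ t * (1# + u * (1# + - t)))
    (Z≈ : Z ≈ 1# + - (u * (1# + - t)))
    (L≈ : L A.≈ A.1# A.+ 4 Aᵈ.× (x A.* W))
    (q≈ : q A.≈ A.1# A.+ 2 Aᵈ.× W A.+ 4 Aᵈ.× (x A.* W Aᵈ.^ 2))
    where

    M : Carrier
    M = (1# + t) * v

    β-0 : β A.0# ≈ 0#
    β-0 = trans (β-cong (A.sym (A.zeroˡ A.1#))) (trans (β-fromℤ 0ℤ A.1#) (zeroˡ _))

    absorb-L : ∀ p → M * β (L A.* p) ≈ (Y + Z) * β p
    absorb-L p = begin
      M * β (L A.* p)
        ≈⟨ *-congˡ (trans (β-cong (A.trans (A.*-congʳ L≈) (A[].solve 3 (λ x w p →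
               let z = x A[].:* w in
               (A[].:1 A[].:+ (z A[].:+ (z A[].:+ (z A[].:+ (z A[].:+ A[].con 0ℤ))))) A[].:* p
               A[].:= p A[].:+ A[].con (+ 4) A[].:* (x A[].:* (w A[].:* p))) A.refl x W p)))
             (trans (β-+ _ _) (+-congˡ (trans (β-fromℤ (+ 4) _) (*-congˡ (β-x (W A.* p))))))) ⟩
      M * (b + four * (y * w))
        ≈⟨ solve 5 (λ t v b y w → ((:1 :+ t) :* v) :* (b :+ con (+ 4) :* (y :* w))
             := (:1 :+ t) :* (v :* b) :+ con (+ 4) :* (((:1 :+ t) :* y) :* (v :* w))) refl t v b y w ⟩
      (1# + t) * (v * b) + four * (((1# + t) * y) * (v * w))
        ≈⟨ +-congˡ (*-congˡ (*-congˡ (v-β-W p))) ⟩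
      (1# + t) * (v * b) + four * (((1# + t) * y) * ((1# + t) * (u * b)))
        ≈⟨ solve 5 (λ t v b y u → (:1 :+ t) :* (v :* b) :+ con (+ 4) :* (((:1 :+ t) :* y) :* ((:1 :+ t) :* (u :* b)))
             := (:1 :+ t) :* (v :* b) :+ con (+ 4) :* (((:1 :+ t) :^ 2 :* y) :* (u :* b))) refl t v b y u ⟩
      (1# + t) * (v * b) + four * (((1# + t) ^ 2 * y) * (u * b))
        ≈⟨ +-cong (*-congˡ (*-congʳ v≈)) (*-congˡ (*-congʳ y≈)) ⟩
      (1# + t) * ((1# + - ((1# + t) * u)) * b) + four * (t * (u * b))
        -- The coefficient of u is 4t - (1+t)² = -(1-t)²; this square is what makes α = u(1-t)
        -- appear.
        ≈⟨ solve 3 (λ t u b → (:1 :+ t) :* ((:1 :+ :- ((:1 :+ t) :* u)) :* b) :+ con (+ 4) :* (t :* (u :* b))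
             := (t :* (:1 :+ u :* (:1 :+ :- t)) :+ (:1 :+ :- (u :* (:1 :+ :- t)))) :* b) refl t u b ⟩
      (t * (1# + u * (1# + - t)) + (1# + - (u * (1# + - t)))) * b
        ≈⟨ *-congʳ (+-cong Y≈ Z≈) ⟨
      (Y + Z) * b ∎
      where
      b w four : Carrier
      b = β p
      w = β (W A.* p)
      four = fromℤ rawRing (+ 4)

    -- The square of M supplies exactly what is missing: its factor (1+t)² turns y into t, and its
    -- factor v² serves the two occurrences of W in the term 4xW², each of which needs one v.
    absorb-xq : ∀ p → M ^ 2 * β (x A.* q A.* p) ≈ (Y * Z) * β p
    absorb-xq p = begin
      M ^ 2 * β (x A.* q A.* p)
        ≈⟨ *-congˡ (trans (β-cong (A.trans (A.*-congʳ (A.*-congˡ q≈)) (A[].solve 3 (λ x w p →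
               let z = x A[].:* w A[].:^ 2 in
               x A[].:* (A[].:1 A[].:+ (w A[].:+ (w A[].:+ A[].con 0ℤ))
                 A[].:+ (z A[].:+ (z A[].:+ (z A[].:+ (z A[].:+ A[].con 0ℤ))))) A[].:* p
               A[].:= x A[].:* (p A[].:+ (A[].con (+ 2) A[].:* (w A[].:* p)
                 A[].:+ A[].con (+ 4) A[].:* (x A[].:* (w A[].:* (w A[].:* p)))))) A.refl x W p)))
             (trans (β-x _) (*-congˡ (trans (β-+ _ _) (+-congˡ (trans (β-+ _ _)
               (+-cong (β-fromℤ (+ 2) _) (trans (β-fromℤ (+ 4) _) (*-congˡ (β-x _)))))))))) ⟩
      M ^ 2 * (y * (b + (two * w + four * (y * w₂))))
        ≈⟨ solve 6 (λ t v b y w w₂ → ((:1 :+ t) :* v) :^ 2 :* (y :* (b :+ (con (+ 2) :* w :+ con (+ 4) :* (y :* w₂))))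
             := ((:1 :+ t) :^ 2 :* y) :* (v :* v :* b :+ (con (+ 2) :* (v :* (v :* w)) :+ con (+ 4) :* (y :* (v :* (v :* w₂))))))
             refl t v b y w w₂ ⟩
      (T² * y) * (v * v * b + (two * (v * (v * w)) + four * (y * (v * (v * w₂)))))
        ≈⟨ *-cong y≈ (+-congˡ (+-cong (*-congˡ (*-congˡ (v-β-W p)))
             (*-congˡ (*-congˡ (*-congˡ (v-β-W (W A.* p))))))) ⟩
      t * (v * v * b + (two * (v * (T * (u * b))) + four * (y * (v * (T * (u * w))))))
        ≈⟨ solve 6 (λ t v b y u w →
             t :* (v :* v :* b :+ (con (+ 2) :* (v :* ((:1 :+ t) :* (u :* b))) :+ con (+ 4) :* (y :* (v :* ((:1 :+ t) :* (u :* w))))))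
             := t :* (v :* v :* b :+ (con (+ 2) :* (v :* ((:1 :+ t) :* (u :* b))) :+ con (+ 4) :* (y :* ((:1 :+ t) :* (u :* (v :* w)))))))
             refl t v b y u w ⟩
      t * (v * v * b + (two * (v * (T * (u * b))) + four * (y * (T * (u * (v * w))))))
        ≈⟨ *-congˡ (+-congˡ (+-congˡ (*-congˡ (*-congˡ (*-congˡ (*-congˡ (v-β-W p))))))) ⟩
      t * (v * v * b + (two * (v * (T * (u * b))) + four * (y * (T * (u * (T * (u * b)))))))
        ≈⟨ solve 5 (λ t v b y u →
             t :* (v :* v :* b :+ (con (+ 2) :* (v :* ((:1 :+ t) :* (u :* b))) :+ con (+ 4) :* (y :* ((:1 :+ t) :* (u :* ((:1 :+ t) :* (u :* b)))))))
             := t :* (v :* v :* b :+ (con (+ 2) :* (v :* ((:1 :+ t) :* (u :* b))) :+ con (+ 4) :* (((:1 :+ t) :^ 2 :* y) :* (u :* (u :* b))))))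
             refl t v b y u ⟩
      t * (v * v * b + (two * (v * (T * (u * b))) + four * ((T² * y) * (u * (u * b)))))
        ≈⟨ *-congˡ (+-cong (*-congʳ (*-cong v≈ v≈)) (+-cong (*-congˡ (*-congʳ v≈)) (*-congˡ (*-congʳ y≈)))) ⟩
      t * (v′ * v′ * b + (two * (v′ * (T * (u * b))) + four * (t * (u * (u * b)))))
        -- Since v′ + T u = 1, completing the square turns v′² + 2v′Tu + 4tu² into 1 - (T² - 4t)u²,
        -- which is 1 - (u(1-t))² and so splits into the factors of Y and Z.
        ≈⟨ solve 3 (λ t u b → let T = :1 :+ t ; v′ = :1 :+ :- (T :* u) in
             t :* (v′ :* v′ :* b :+ (con (+ 2) :* (v′ :* (T :* (u :* b))) :+ con (+ 4) :* (t :* (u :* (u :* b)))))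
             := t :* (:1 :+ u :* (:1 :+ :- t)) :* (:1 :+ :- (u :* (:1 :+ :- t))) :* b) refl t u b ⟩
      t * (1# + u * (1# + - t)) * (1# + - (u * (1# + - t))) * b
        ≈⟨ *-congʳ (*-cong Y≈ Z≈) ⟨
      Y * Z * b ∎
      where
      b w w₂ two four T T² v′ : Carrier
      b = β p
      w = β (W A.* p)
      w₂ = β (W A.* (W A.* p))
      two = fromℤ rawRing (+ 2)
      four = fromℤ rawRing (+ 4)
      T = 1# + t
      T² = T ^ 2
      v′ = 1# + - (T * u)

    -- The map β only intertwines multiplication by p, after scaling by k, with multiplication by z.
    -- A power therefore leaves β one factor at a time, and the cofactor `a` has to be arbitrary for
    -- the induction.
    absorb-^ : ∀ {k p} z → (∀ a → k * β (p A.* a) ≈ z * β a) →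
               ∀ n a → k ^ n * β ((p Aᵈ.^ n) A.* a) ≈ z ^ n * β a
    absorb-^ {k} {p} z absorb zero    a = *-congˡ (β-cong (A.*-identityˡ a))
    absorb-^ {k} {p} z absorb (suc n) a = begin
      k * k ^ n * β (p A.* p Aᵈ.^ n A.* a)
        ≈⟨ *-congˡ (β-cong (A.*-assoc p (p Aᵈ.^ n) a)) ⟩
      k * k ^ n * β (p A.* (p Aᵈ.^ n A.* a))
        ≈⟨ solve 3 (λ x y z → x :* y :* z := y :* (x :* z)) refl k (k ^ n) _ ⟩
      k ^ n * (k * β (p A.* (p Aᵈ.^ n A.* a)))
        ≈⟨ *-congˡ (absorb (p Aᵈ.^ n A.* a)) ⟩
      k ^ n * (z * β (p Aᵈ.^ n A.* a))
        ≈⟨ solve 3 (λ x y z → x :* (y :* z) := y :* (x :* z)) refl (k ^ n) z _ ⟩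
      z * (k ^ n * β (p Aᵈ.^ n A.* a))
        ≈⟨ *-congˡ (absorb-^ z absorb n a) ⟩
      z * (z ^ n * β a)
        ≈⟨ *-assoc z (z ^ n) (β a) ⟨
      z * z ^ n * β a ∎

    -- The 2j copies of M are distributed over the factors of the term: two for each of the s
    -- factors x q, one for each of the 2j - 2s factors L. What is left under β is 1.
    β-term : ∀ s → s ℕ.≤ j → M ^ (2 ℕ.* j) * β (Aᶠ.term (x A.* q) L s) ≈ Rᶠ.term (Y * Z) (Y + Z) s * β A.1#
    β-term s s≤j = begin
      M ^ (2 ℕ.* j) * β (Aᶠ.term (x A.* q) L s)
        ≈⟨ *-cong (begin
             M ^ (2 ℕ.* j)            ≈⟨ ^-congʳ M (≡.sym (ℕ.m+[n∸m]≡n (ℕ.*-monoʳ-≤ 2 s≤j))) ⟩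
             M ^ (2 ℕ.* s ℕ.+ m)      ≈⟨ ^-homo-* M (2 ℕ.* s) m ⟩
             M ^ (2 ℕ.* s) * M ^ m    ≈⟨ *-congʳ (sym (^-assocʳ M 2 s)) ⟩
             (M ^ 2) ^ s * M ^ m      ∎)
             (trans (β-fromℤ (d s) _) (*-congˡ (β-cong (A.*-congˡ (A.sym (A.*-identityʳ (L Aᵈ.^ m))))))) ⟩
      (M ^ 2) ^ s * M ^ m * (fromℤ rawRing (d s) * β ((x A.* q) Aᵈ.^ s A.* (L Aᵈ.^ m A.* A.1#)))
        ≈⟨ solve 4 (λ x y z w → x :* y :* (z :* w) := z :* (y :* (x :* w))) refl _ _ _ _ ⟩
      fromℤ rawRing (d s) * (M ^ m * ((M ^ 2) ^ s * β ((x A.* q) Aᵈ.^ s A.* (L Aᵈ.^ m A.* A.1#))))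
        ≈⟨ *-congˡ (*-congˡ (absorb-^ (Y * Z) absorb-xq s _)) ⟩
      fromℤ rawRing (d s) * (M ^ m * ((Y * Z) ^ s * β (L Aᵈ.^ m A.* A.1#)))
        ≈⟨ solve 4 (λ x y z w → x :* (y :* (z :* w)) := x :* (z :* (y :* w))) refl _ _ _ _ ⟩
      fromℤ rawRing (d s) * ((Y * Z) ^ s * (M ^ m * β (L Aᵈ.^ m A.* A.1#)))
        ≈⟨ *-congˡ (*-congˡ (absorb-^ (Y + Z) absorb-L m A.1#)) ⟩
      fromℤ rawRing (d s) * ((Y * Z) ^ s * ((Y + Z) ^ m * β A.1#))
        ≈⟨ solve 4 (λ x y z w → x :* (y :* (z :* w)) := x :* (y :* z) :* w) refl _ _ _ _ ⟩
      Rᶠ.term (Y * Z) (Y + Z) s * β A.1# ∎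
      where m = 2 ℕ.* j ∸ 2 ℕ.* s

    β-sum : ∀ {n} (f : Fin n → A.Carrier) → β (Aᵈ.sum f) ≈ sum (λ i → β (f i))
    β-sum {zero}  f = β-0
    β-sum {suc n} f = trans (β-+ _ _) (+-congˡ (β-sum (λ i → f (Fin.suc i))))

    -- Every term leaves the same remainder `β A.1#`, which the additional factor v cancels.
    β-form : M ^ (2 ℕ.* j) * (v * β (Aᶠ.form (x A.* q) L)) ≈ Rᶠ.form (Y * Z) (Y + Z)
    β-form = begin
      M ^ (2 ℕ.* j) * (v * β (Aᶠ.form (x A.* q) L))
        ≈⟨ *-congˡ (*-congˡ (β-sum {suc j} (λ i → Aᶠ.term (x A.* q) L (toℕ i)))) ⟩
      M ^ (2 ℕ.* j) * (v * sum {suc j} (λ i → βterm i))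
        ≈⟨ solve 3 (λ x y z → x :* (y :* z) := y :* (x :* z)) refl (M ^ (2 ℕ.* j)) v _ ⟩
      v * (M ^ (2 ℕ.* j) * sum {suc j} (λ i → βterm i))
        ≈⟨ *-congˡ (*-distribˡ-sum {suc j} (M ^ (2 ℕ.* j)) βterm) ⟩
      v * sum {suc j} (λ i → M ^ (2 ℕ.* j) * βterm i)
        ≈⟨ *-congˡ (sum-cong-≋ {suc j} λ i → trans (β-term (toℕ i) (ℕ.s≤s⁻¹ (Fin.toℕ<n i))) (*-comm _ _)) ⟩
      v * sum {suc j} (λ i → β A.1# * Rᶠ.term (Y * Z) (Y + Z) (toℕ i))
        ≈⟨ *-congˡ (*-distribˡ-sum {suc j} (β A.1#) (λ i → Rᶠ.term (Y * Z) (Y + Z) (toℕ i))) ⟨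
      v * (β A.1# * Rᶠ.form (Y * Z) (Y + Z))
        ≈⟨ *-assoc v (β A.1#) _ ⟨
      v * β A.1# * Rᶠ.form (Y * Z) (Y + Z)
        ≈⟨ *-congʳ v-β-1 ⟩
      1# * Rᶠ.form (Y * Z) (Y + Z)
        ≈⟨ *-identityˡ _ ⟩
      Rᶠ.form (Y * Z) (Y + Z) ∎
      where
      βterm : Fin (suc j) → Carrier
      βterm i = β (Aᶠ.term (x A.* q) L (toℕ i))

    -- The factor Z^{2j} turns form (Y/Z) (1 + Y/Z) into form (YZ) (Y + Z), which β-form computes.
    series-from-form : ∀ {Z⁻¹ 𝔽} → Z * Z⁻¹ ≈ 1# →
      v ^ suc (2 ℕ.* j) * 𝔽 ≈ Z ^ (2 ℕ.* j) * GammaForm.form R d j (Y * Z⁻¹) (1# + Y * Z⁻¹) →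
      𝔽 ≈ (1# + t) ^ (2 ℕ.* j) * β (GammaForm.form A d j (x A.* q) L)
    series-from-form {Z⁻¹} {𝔽} ZZ⁻¹≈1 v𝔽≈ = Units.cancel-unit R (Units.^-unit R v-β-1 (suc (2 ℕ.* j))) (begin
      v ^ suc (2 ℕ.* j) * 𝔽
        ≈⟨ v𝔽≈ ⟩
      Z ^ (2 ℕ.* j) * Rᶠ.form (Y * Z⁻¹) (1# + Y * Z⁻¹)
        ≈⟨ Rᶠ.scale-form Z (Y * Z⁻¹) (1# + Y * Z⁻¹) ⟩
      Rᶠ.form (Z ^ 2 * (Y * Z⁻¹)) (Z * (1# + Y * Z⁻¹))
        ≈⟨ Rᶠ.form-cong
             (trans (solve 3 (λ y z i → z :^ 2 :* (y :* i) := y :* z :* (z :* i)) refl Y Z Z⁻¹)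
               (trans (*-congˡ ZZ⁻¹≈1) (*-identityʳ _)))
             (trans (solve 3 (λ y z i → z :* (:1 :+ y :* i) := y :* (z :* i) :+ z) refl Y Z Z⁻¹)
               (+-congʳ (trans (*-congˡ ZZ⁻¹≈1) (*-identityʳ _)))) ⟩
      Rᶠ.form (Y * Z) (Y + Z)
        ≈⟨ β-form ⟨
      M ^ (2 ℕ.* j) * (v * B)
        ≈⟨ *-congʳ (CExp.^-distrib-* commutativeSemiring (1# + t) v (2 ℕ.* j)) ⟩
      (1# + t) ^ (2 ℕ.* j) * v ^ (2 ℕ.* j) * (v * B)
        ≈⟨ solve 4 (λ x y z w → x :* y :* (z :* w) := z :* y :* (x :* w)) refl
             ((1# + t) ^ (2 ℕ.* j)) (v ^ (2 ℕ.* j)) v B ⟩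
      v ^ suc (2 ℕ.* j) * ((1# + t) ^ (2 ℕ.* j) * B) ∎)
      where
      B : Carrier
      B = β (Aᶠ.form (x A.* q) L)

-- The substitution x = t/(1+t)² and the uniqueness of γ-polynomials

module Substitution where

  open CommutativeRing ℤ-series
  open RawSemiringDefs (RawRing.rawSemiring rawRing) using (_^_)
  open RawRing ℤ[x] using () renaming (_≈_ to _≈ₓ_)

  t T T⁻¹ y : Carrier
  t   = X ℤ.+-*-rawRing
  T   = 1# + t
  T⁻¹ = 1/1+_X ℤ.+-*-rawRing 1ℤ
  y   = t * T⁻¹ ^ 2

  T-inverse : T * T⁻¹ ≈ 1#
  T-inverse = trans {T * T⁻¹} {(1# + const ℤ.+-*-rawRing 1ℤ * t) * T⁻¹} {1#}
    (*-congʳ {T⁻¹} {T} {1# + const ℤ.+-*-rawRing 1ℤ * t} (+-congˡ {1#} {t} {const ℤ.+-*-rawRing 1ℤ * t}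
      λ k → ≡.sym (≡.trans (SeriesRing.const-* ℤ.+-*-commutativeRing 1ℤ t k) (ℤ.*-identityˡ (t k)))))
    (GeometricSeries.1+aX-inverse ℤ.+-*-commutativeRing 1ℤ)

  fromℤ≈const : ∀ i → fromℤ rawRing i ≈ const ℤ.+-*-rawRing i
  fromℤ≈const i = trans {fromℤ rawRing i} {const ℤ.+-*-rawRing (fromℤ ℤ.+-*-rawRing i)} {const ℤ.+-*-rawRing i}
    (sym {const ℤ.+-*-rawRing (fromℤ ℤ.+-*-rawRing i)} {fromℤ rawRing i}
      (Homomorphism.fromℤ-homo ℤ.+-*-commutativeRing ℤ-series (const ℤ.+-*-rawRing)
        (SeriesRing.const-isRingHomomorphism ℤ.+-*-commutativeRing) i))
    λ { zero → fromℤ-id i ; (suc k) → ≡.refl }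
    where
    ×1 : ∀ n → Algebra.Definitions.RawMonoid._×_ ℤ.+-0-rawMonoid n 1ℤ ≡ + n
    ×1 zero    = ≡.refl
    ×1 (suc n) = ≡.cong (ℤ._+_ 1ℤ) (×1 n)
    fromℤ-id : ∀ i → fromℤ ℤ.+-*-rawRing i ≡ i
    fromℤ-id (+ n)    = ×1 n
    fromℤ-id -[1+ n ] = ≡.cong (λ z → ℤ.- z) (×1 (suc n))

  ev : Poly → Carrier
  ev = Evaluation.ev ℤ-series y

  drop-constant : Poly → Poly
  drop-constant []      = []
  drop-constant (a ∷ p) = p

  y* : ∀ f → y * f ≈ t * (T⁻¹ ^ 2 * f)
  y* f = *-assoc t (T⁻¹ ^ 2) f

  ev-0 : ∀ p → ev p 0 ≡ coeff p 0
  ev-0 []      = ≡.refl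
  ev-0 (a ∷ p) = ≡.trans (≡.cong₂ ℤ._+_ (fromℤ≈const a 0)
    (≡.trans (y* (ev p) 0) (SeriesRing.X-* ℤ.+-*-commutativeRing (T⁻¹ ^ 2 * ev p) 0))) (ℤ.+-identityʳ a)

  ev-suc : ∀ p k → ev p (suc k) ≡ (T⁻¹ ^ 2 * ev (drop-constant p)) k
  ev-suc []      k = ≡.sym (zeroʳ (T⁻¹ ^ 2) k)
  ev-suc (a ∷ p) k = ≡.trans (≡.cong₂ ℤ._+_ (fromℤ≈const a (suc k))
    (≡.trans (y* (ev p) (suc k)) (SeriesRing.X-* ℤ.+-*-commutativeRing (T⁻¹ ^ 2 * ev p) (suc k)))) (ℤ.+-identityˡ _)

  coeff-drop : ∀ p k → coeff p (suc k) ≡ coeff (drop-constant p) k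
  coeff-drop []      k = ≡.refl
  coeff-drop (a ∷ p) k = ≡.refl

  -- The series y is t times a unit. Hence p(y) has the constant coefficient of p, and after
  -- removing it and dividing by t and by the unit the same argument applies to the remaining
  -- coefficients of p.
  ev-injective : ∀ p q → ev p ≈ ev q → p ≈ₓ q
  ev-injective p q p≈q zero    = ≡.trans (≡.sym (ev-0 p)) (≡.trans (p≈q 0) (ev-0 q))
  ev-injective p q p≈q (suc k) = ≡.trans (coeff-drop p k) (≡.trans
    (ev-injective (drop-constant p) (drop-constant q)
      (Units.cancel-unit ℤ-series {T⁻¹ ^ 2} {T ^ 2} (λ i → ≡.trans (*-comm (T⁻¹ ^ 2) (T ^ 2) i)
          (Units.^-unit ℤ-series {T} {T⁻¹} T-inverse 2 i))
        {ev (drop-constant p)} {ev (drop-constant q)}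
        λ i → ≡.trans (≡.sym (ev-suc p i)) (≡.trans (p≈q (suc i)) (ev-suc q i))) k)
    (≡.sym (coeff-drop q k)))

  gamma-unique : ∀ n p {Φ Ψ} → IsGammaPolynomial n p Φ → IsGammaPolynomial n p Ψ → Φ ≈ₓ Ψ
  gamma-unique n p {Φ} {Ψ} γΦ γΨ = ev-injective Φ Ψ
    (Units.cancel-unit ℤ-series {T ^ n} {T⁻¹ ^ n} (Units.^-unit ℤ-series {T} {T⁻¹} T-inverse n) {ev Φ} {ev Ψ}
      λ k → ≡.trans (≡.sym (γΦ k)) (γΨ k))

  -- The hypothesis lives in ℤ[[t]], but J has to be evaluated at Y/Z, a series in both t and u.
  -- Clearing denominators makes both sides polynomials, and an identity of polynomials may be
  -- evaluated in any commutative ring.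
  gamma⇒form : ∀ d j p → IsGammaPolynomial (2 ℕ.* j) p (applyUpTo d (suc j)) →
    p ≈ₓ GammaForm.form Polynomials.commutativeRing d j (monomial 1) ((1ℤ ∷ []) +ₚ monomial 1)
  gamma⇒form d j p γ = trans {coeff p} {K.form t T} {coeff (P.form (monomial 1) ((1ℤ ∷ []) +ₚ monomial 1))}
    (trans {coeff p} {T ^ (2 ℕ.* j) * eval rawRing (applyUpTo d (suc j)) y} {K.form t T}
      γ (K.dehomogenise {T} {y} {t} (K.square-quotient {T} {T⁻¹} t T-inverse)))
    (sym {coeff (P.form (monomial 1) ((1ℤ ∷ []) +ₚ monomial 1))} {K.form t T}
    (trans {coeff (P.form (monomial 1) ((1ℤ ∷ []) +ₚ monomial 1))}
           {K.form (coeff (monomial 1)) (coeff ((1ℤ ∷ []) +ₚ monomial 1))} {K.form t T}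
      (FormHomomorphism.form-homo Polynomials.commutativeRing ℤ-series coeff
        Polynomials.coeff-isRingHomomorphism d j (monomial 1) ((1ℤ ∷ []) +ₚ monomial 1))
      (K.form-cong {coeff (monomial 1)} {t} {coeff ((1ℤ ∷ []) +ₚ monomial 1)} {T}
        (λ { zero → ≡.refl ; (suc zero) → ≡.refl ; (suc (suc k)) → ≡.refl })
        (λ { zero → ≡.refl ; (suc zero) → ≡.refl ; (suc (suc k)) → ≡.refl }))))
    where
    module K = GammaForm ℤ-series d j
    module P = GammaForm Polynomials.commutativeRing d j

-- Series in u over ℤ[[t]]

ℤ-series² : CommutativeRing 0ℓ 0ℓ
ℤ-series² = SeriesRing.commutativeRing ℤ-series

module LinearFactor {c ℓ : Level} (R : CommutativeRing c ℓ) where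
  open CommutativeRing R
  open IntegerScalars.Solver R using (solve; _:*_; :-_; _:=_)

  neg-linear : ∀ {a n b u} → n ≈ - a → a ≈ b → 1# + n * u ≈ 1# + - (b * u)
  neg-linear {u = u} n≈-a a≈b = +-congˡ (trans (*-congʳ (trans n≈-a (-‿cong a≈b)))
    (solve 2 (λ b u → :- b :* u := :- (b :* u)) refl _ u))

module Bivariate where
  private
    module K = CommutativeRing ℤ-series
    module Kᵈ = RawSemiringDefs (RawRing.rawSemiring K.rawRing)
    module ℤ[x]ˢ = CommutativeRing ℤ[x]-series
    module ℤ[x]ᵈ = RawSemiringDefs (RawRing.rawSemiring ℤ[x])
    module S = Substitution
  open CommutativeRing ℤ-series²
  open RawSemiringDefs (RawRing.rawSemiring rawRing) using (_^_)

  open BinomialTransform Polynomials.commutativeRing ℤ-series S.ev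
    (Evaluation.ev-isRingHomomorphism ℤ-series S.y) S.T public using (β; v; transform)
  private
    module B = BinomialTransform Polynomials.commutativeRing ℤ-series S.ev
      (Evaluation.ev-isRingHomomorphism ℤ-series S.y) S.T
    module const = IsRingHomomorphism (SeriesRing.const-isRingHomomorphism ℤ-series)
    open Homomorphism ℤ-series ℤ-series² (const K.rawRing) (SeriesRing.const-isRingHomomorphism ℤ-series)
      using () renaming (^-homo to const^)

  t u y Y Z Z⁻¹ : Carrier
  t   = const K.rawRing S.t
  u   = X K.rawRing
  y   = const K.rawRing S.y
  Y   = t * (1# + u * (1# + - t))
  Z   = 1# + - (u * (1# + - t))
  Z⁻¹ = 1/1+_X K.rawRing (K.- (K.1# K.+ K.- S.t))

  const-T : const K.rawRing S.T ≈ 1# + t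
  const-T = trans {const K.rawRing S.T} {const K.rawRing K.1# + t} {1# + t}
    (const.+-homo K.1# S.t) (+-congʳ {t} {const K.rawRing K.1#} {1#} const.1#-homo)

  v≈ : v ≈ 1# + - ((1# + t) * u)
  v≈ = LinearFactor.neg-linear ℤ-series² {const K.rawRing S.T} {const K.rawRing (K.- S.T)} {1# + t} {u}
    (const.-‿homo S.T) const-T

  Z-inverse : Z * Z⁻¹ ≈ 1#
  Z-inverse = trans {Z * Z⁻¹} {(1# + const K.rawRing (K.- a) * u) * Z⁻¹} {1#}
    (*-congʳ {Z⁻¹} {Z} {1# + const K.rawRing (K.- a) * u}
      (sym {1# + const K.rawRing (K.- a) * u} {Z}
        (trans {1# + const K.rawRing (K.- a) * u} {1# + - ((1# + - t) * u)} {Z}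
          (LinearFactor.neg-linear ℤ-series² {const K.rawRing a} {const K.rawRing (K.- a)} {1# + - t} {u}
            (const.-‿homo a)
            (trans {const K.rawRing a} {const K.rawRing K.1# + const K.rawRing (K.- S.t)} {1# + - t}
              (const.+-homo K.1# (K.- S.t))
              (+-cong {const K.rawRing K.1#} {1#} {const K.rawRing (K.- S.t)} {(- t)} const.1#-homo (const.-‿homo S.t))))
          (+-congˡ {1#} {(- ((1# + - t) * u))} {(- (u * (1# + - t)))}
            (-‿cong {(1# + - t) * u} {u * (1# + - t)} (*-comm (1# + - t) u))))))
    (GeometricSeries.1+aX-inverse ℤ-series (K.- a))
    where
    a : K.Carrier
    a = K.1# K.+ K.- S.t

  y≈ : (1# + t) ^ 2 * y ≈ t
  y≈ = trans {(1# + t) ^ 2 * y} {const K.rawRing S.T ^ 2 * y} {t}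
    (*-congʳ {y} {(1# + t) ^ 2} {const K.rawRing S.T ^ 2}
      (Exp.^-congˡ semiring 2 {1# + t} {const K.rawRing S.T} (sym {const K.rawRing S.T} {1# + t} const-T)))
    (trans {const K.rawRing S.T ^ 2 * y} {const K.rawRing (S.T Kᵈ.^ 2 K.* S.y)} {t}
      (sym {const K.rawRing (S.T Kᵈ.^ 2 K.* S.y)} {const K.rawRing S.T ^ 2 * y}
        (trans {const K.rawRing (S.T Kᵈ.^ 2 K.* S.y)} {const K.rawRing (S.T Kᵈ.^ 2) * y} {const K.rawRing S.T ^ 2 * y}
          (const.*-homo (S.T Kᵈ.^ 2) S.y)
          (*-congʳ {y} {const K.rawRing (S.T Kᵈ.^ 2)} {const K.rawRing S.T ^ 2} (const^ S.T 2))))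
      (const.⟦⟧-cong {S.T Kᵈ.^ 2 K.* S.y} {S.t}
        (GammaForm.square-quotient ℤ-series (λ _ → 0ℤ) 0 {S.T} {S.T⁻¹} S.t S.T-inverse)))

  v-β-W : ∀ p → v * β (X ℤ[x] ℤ[x]ˢ.* p) ≈ (1# + t) * (u * β p)
  v-β-W p = trans {v * β (X ℤ[x] ℤ[x]ˢ.* p)} {const K.rawRing S.T * (u * β p)} {(1# + t) * (u * β p)}
    (B.v-β-X p) (*-congʳ {u * β p} {const K.rawRing S.T} {1# + t} const-T)

  v-β-1 : v * β ℤ[x]ˢ.1# ≈ 1#
  v-β-1 = trans {v * β ℤ[x]ˢ.1#} {v * B.v⁻¹} {1#} (*-congˡ {v} {β ℤ[x]ˢ.1#} {B.v⁻¹} B.β-1) B.v-inverse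

  β-x : ∀ p → β (const ℤ[x] (monomial 1) ℤ[x]ˢ.* p) ≈ y * β p
  β-x p = trans {β (const ℤ[x] (monomial 1) ℤ[x]ˢ.* p)} {const K.rawRing (S.ev (monomial 1)) * β p} {y * β p}
    (B.β-const (monomial 1) p)
    (*-congʳ {β p} {const K.rawRing (S.ev (monomial 1))} {y}
      (const.⟦⟧-cong {S.ev (monomial 1)} {S.y}
        (K.trans {S.ev (monomial 1)} {S.y Kᵈ.^ 1} {S.y}
          (Evaluation.ev-monomial ℤ-series S.y 1) (K.*-identityʳ S.y))))

  module _ (d : ℕ → ℤ) (j : ℕ) (γ : IsGammaPolynomial (2 ℕ.* j) (J j) (P (λ _ → d) j))
    (deletion : v ^ suc (2 ℕ.* j) * (λ f → coeff (F j f)) ≈ Z ^ (2 ℕ.* j) * eval rawRing (J j) (Y * Z⁻¹))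
    where
    private
      module R = GammaForm ℤ-series² d j
      module E = Evaluation ℤ-series² (Y * Z⁻¹)
      module Fx = FixedPointSeries ℤ[x]-series ℤ-series² d j β
      a : ℕ → Poly
      a = A (P (λ _ → d) j) j

    eval-J : eval rawRing (J j) (Y * Z⁻¹) ≈ GammaForm.form ℤ-series² d j (Y * Z⁻¹) (1# + Y * Z⁻¹)
    eval-J = trans {E.ev (J j)} {E.ev J-form} {GammaForm.form ℤ-series² d j (Y * Z⁻¹) (1# + Y * Z⁻¹)}
      (E.ev-cong {J j} {J-form} (S.gamma⇒form d j (J j) γ))
      (trans {E.ev J-form} {R.form (E.ev (monomial 1)) (E.ev ((1ℤ ∷ []) +ₚ monomial 1))} {GammaForm.form ℤ-series² d j (Y * Z⁻¹) (1# + Y * Z⁻¹)}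
        (FormHomomorphism.form-homo Polynomials.commutativeRing ℤ-series² E.ev E.ev-isRingHomomorphism d j
          (monomial 1) ((1ℤ ∷ []) +ₚ monomial 1))
        (R.form-cong {E.ev (monomial 1)} {Y * Z⁻¹} {E.ev ((1ℤ ∷ []) +ₚ monomial 1)} {1# + Y * Z⁻¹}
          ev-t
          (trans {E.ev ((1ℤ ∷ []) +ₚ monomial 1)} {E.ev (1ℤ ∷ []) + E.ev (monomial 1)} {1# + Y * Z⁻¹}
            (E.ev-+ (1ℤ ∷ []) (monomial 1))
            (+-cong {E.ev (1ℤ ∷ [])} {1#} {E.ev (monomial 1)} {Y * Z⁻¹} E.ev-1 ev-t))))
      where
      J-form : Poly
      J-form = GammaForm.form Polynomials.commutativeRing d j (monomial 1) ((1ℤ ∷ []) +ₚ monomial 1)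
      ev-t : E.ev (monomial 1) ≈ Y * Z⁻¹
      ev-t = trans {E.ev (monomial 1)} {(Y * Z⁻¹) ^ 1} {Y * Z⁻¹} (E.ev-monomial 1) (*-identityʳ (Y * Z⁻¹))

    deletion-form : v ^ suc (2 ℕ.* j) * (λ f → coeff (F j f)) ≈ Z ^ (2 ℕ.* j) * GammaForm.form ℤ-series² d j (Y * Z⁻¹) (1# + Y * Z⁻¹)
    deletion-form = trans {v ^ suc (2 ℕ.* j) * (λ f → coeff (F j f))} {Z ^ (2 ℕ.* j) * eval rawRing (J j) (Y * Z⁻¹)}
          {Z ^ (2 ℕ.* j) * GammaForm.form ℤ-series² d j (Y * Z⁻¹) (1# + Y * Z⁻¹)}
          deletion (*-congˡ {Z ^ (2 ℕ.* j)} {eval rawRing (J j) (Y * Z⁻¹)} {GammaForm.form ℤ-series² d j (Y * Z⁻¹) (1# + Y * Z⁻¹)} eval-J)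

    F≈β : (λ f → coeff (F j f)) ≈ (1# + t) ^ (2 ℕ.* j) * β a
    F≈β = trans {λ f → coeff (F j f)} {(1# + t) ^ (2 ℕ.* j) * β A-form} {(1# + t) ^ (2 ℕ.* j) * β a}
      (Fx.series-from-form (λ {p} {q} → B.β-cong {p} {q}) B.β-+ B.β-fromℤ (const ℤ[x] (monomial 1)) (X ℤ[x]) y t u v
        β-x v-β-W v-β-1 v≈ y≈ Y Z 1+4xW 1+2W+4xW² (refl {Y}) (refl {Z}) (ℤ[x]ˢ.refl {1+4xW}) (ℤ[x]ˢ.refl {1+2W+4xW²})
        {Z⁻¹} {λ f → coeff (F j f)} Z-inverse deletion-form)
      (*-congˡ {(1# + t) ^ (2 ℕ.* j)} {β A-form} {β a}
        (B.β-cong {A-form} {a} (ℤ[x]ˢ.sym {a} {A-form} (Expansion.A≈form d j))))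
      where
      A-form : ℕ → Poly
      A-form = GammaForm.form ℤ[x]-series d j (const ℤ[x] (monomial 1) ℤ[x]ˢ.* 1+2W+4xW²) 1+4xW

    -- The coefficient of u to the power f in `F≈β`: the factor (1+t) to the power f built into β
    -- joins the prefactor of exponent 2j, which gives the normalisation of a γ-expansion with
    -- center (2j+f)/2.
    F-coefficient : ∀ f → coeff (F j f) K.≈ S.T Kᵈ.^ (2 ℕ.* j ℕ.+ f) K.* S.ev (binomialSum a f)
    F-coefficient f = K.trans {coeff (F j f)} {S.T Kᵈ.^ (2 ℕ.* j) K.* β a f} {rhs}
      (K.trans {coeff (F j f)} {((1# + t) ^ (2 ℕ.* j) * β a) f} {S.T Kᵈ.^ (2 ℕ.* j) K.* β a f}
        (F≈β f)
        (K.trans {((1# + t) ^ (2 ℕ.* j) * β a) f} {(const K.rawRing (S.T Kᵈ.^ (2 ℕ.* j)) * β a) f}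
          {S.T Kᵈ.^ (2 ℕ.* j) K.* β a f}
          (*-congʳ {β a} {(1# + t) ^ (2 ℕ.* j)} {const K.rawRing (S.T Kᵈ.^ (2 ℕ.* j))} T^ f)
          (SeriesRing.const-* ℤ-series (S.T Kᵈ.^ (2 ℕ.* j)) (β a) f)))
      (K.trans {S.T Kᵈ.^ (2 ℕ.* j) K.* β a f} {S.T Kᵈ.^ (2 ℕ.* j) K.* S.T Kᵈ.^ f K.* transform (λ r → S.ev (a r)) f} {rhs}
        (K.sym {S.T Kᵈ.^ (2 ℕ.* j) K.* S.T Kᵈ.^ f K.* transform (λ r → S.ev (a r)) f} {S.T Kᵈ.^ (2 ℕ.* j) K.* β a f}
          (K.*-assoc (S.T Kᵈ.^ (2 ℕ.* j)) (S.T Kᵈ.^ f) (transform (λ r → S.ev (a r)) f)))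
        (K.*-cong {S.T Kᵈ.^ (2 ℕ.* j) K.* S.T Kᵈ.^ f} {S.T Kᵈ.^ (2 ℕ.* j ℕ.+ f)}
          {transform (λ r → S.ev (a r)) f} {S.ev (binomialSum a f)}
          (K.sym {S.T Kᵈ.^ (2 ℕ.* j ℕ.+ f)} {S.T Kᵈ.^ (2 ℕ.* j) K.* S.T Kᵈ.^ f}
            (Exp.^-homo-* K.semiring S.T (2 ℕ.* j) f))
          (K.sym {S.ev (binomialSum a f)} {transform (λ r → S.ev (a r)) f} ev-binomialSum)))
      where
      module H = Homomorphism Polynomials.commutativeRing ℤ-series S.ev (Evaluation.ev-isRingHomomorphism ℤ-series S.y)
      rhs : K.Carrier
      rhs = S.T Kᵈ.^ (2 ℕ.* j ℕ.+ f) K.* S.ev (binomialSum a f)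
      T^ : (1# + t) ^ (2 ℕ.* j) ≈ const K.rawRing (S.T Kᵈ.^ (2 ℕ.* j))
      T^ = trans {(1# + t) ^ (2 ℕ.* j)} {const K.rawRing S.T ^ (2 ℕ.* j)} {const K.rawRing (S.T Kᵈ.^ (2 ℕ.* j))}
        (Exp.^-congˡ semiring (2 ℕ.* j) {1# + t} {const K.rawRing S.T} (sym {const K.rawRing S.T} {1# + t} const-T))
        (sym {const K.rawRing (S.T Kᵈ.^ (2 ℕ.* j))} {const K.rawRing S.T ^ (2 ℕ.* j)} (const^ S.T (2 ℕ.* j)))
      ev-binomialSum : S.ev (binomialSum a f) K.≈ transform (λ r → S.ev (a r)) f
      ev-binomialSum = K.trans {S.ev (binomialSum a f)} {Kᵈ.sum {suc f} (λ i → S.ev (summand i))} {transform (λ r → S.ev (a r)) f}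
        (H.sum-homo {suc f} summand)
        (MonoidSum.sum-cong-≋ K.+-monoid {suc f} {λ i → S.ev (summand i)} {λ i → (f C toℕ i) Kᵈ.× S.ev (a (toℕ i))}
          λ i → H.×-homo (f C toℕ i) (a (toℕ i)))
        where
        summand : Fin (suc f) → Poly
        summand i = (f C toℕ i) ℤ[x]ᵈ.× a (toℕ i)

    binomialSum-isGamma : ∀ f → IsGammaPolynomial (2 ℕ.* j ℕ.+ f) (F j f) (binomialSum a f)
    binomialSum-isGamma = F-coefficient

-- Descents and inserted fixed points

-- On ℕ, the map toℕ ∘ punchIn k of stdlib.
skip : ℕ → ℕ → ℕ
skip zero    m       = suc m
skip (suc k) zero    = zero
skip (suc k) (suc m) = suc (skip k m)

toℕ-punchIn : ∀ {n} (k : Fin (suc n)) i → toℕ (punchIn k i) ≡ skip (toℕ k) (toℕ i)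
toℕ-punchIn Fin.zero    i           = ≡.refl
toℕ-punchIn (Fin.suc k) Fin.zero    = ≡.refl
toℕ-punchIn (Fin.suc k) (Fin.suc i) = ≡.cong suc (toℕ-punchIn k i)

skip-≥ : ∀ {k m} → k ℕ.≤ m → skip k m ≡ suc m
skip-≥ ℕ.z≤n       = ≡.refl
skip-≥ (ℕ.s≤s k≤m) = ≡.cong suc (skip-≥ k≤m)

skip-< : ∀ {k m} → m ℕ.< k → skip k m ≡ m
skip-< {suc k} {zero}  _           = ≡.refl
skip-< {suc k} {suc m} (ℕ.s≤s m<k) = ≡.cong suc (skip-< m<k)

skip-mono-< : ∀ k {m n} → m ℕ.< n → skip k m ℕ.< skip k n
skip-mono-< zero    m<n                           = ℕ.s≤s m<n
skip-mono-< (suc k) {zero}  {suc n} m<n           = ℕ.s≤s ℕ.z≤n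
skip-mono-< (suc k) {suc m} {suc n} (ℕ.s≤s m<n)   = ℕ.s≤s (skip-mono-< k m<n)

-- The relabelling of the values of a word that frees ±(k+1).
relabel : ℕ → ℤ → ℤ
relabel k (+ zero)  = + zero
relabel k (+ suc m) = + suc (skip k m)
relabel k -[1+ m ]  = -[1+ skip k m ]

relabel-◃ : ∀ k s m → relabel k (s ◃ suc m) ≡ s ◃ suc (skip k m)
relabel-◃ k Sign.- m = ≡.refl
relabel-◃ k Sign.+ m = ≡.refl

relabel-mono-< : ∀ k {i j} → i ℤ.< j → relabel k i ℤ.< relabel k j
relabel-mono-< k {+ zero}  {+ zero}  (ℤ.+<+ ())
relabel-mono-< k {+ zero}  {+ suc n} _                     = ℤ.+<+ (ℕ.s≤s ℕ.z≤n)
relabel-mono-< k {+ suc m} {+ suc n} (ℤ.+<+ (ℕ.s≤s m<n))   = ℤ.+<+ (ℕ.s≤s (skip-mono-< k m<n))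
relabel-mono-< k { -[1+ m ]} {+ zero}  _                   = ℤ.-<+
relabel-mono-< k { -[1+ m ]} {+ suc n} _                   = ℤ.-<+
relabel-mono-< k { -[1+ m ]} { -[1+ n ]} (ℤ.-<- n<m)       = ℤ.-<- (skip-mono-< k n<m)

relabel-mono-≤ : ∀ k {i j} → i ℤ.≤ j → relabel k i ℤ.≤ relabel k j
relabel-mono-≤ k {i} {j} i≤j with i ℤ.≟ j
... | yes ≡.refl = ℤ.≤-refl
... | no  i≢j    = ℤ.<⇒≤ (relabel-mono-< k (ℤ.≤∧≢⇒< i≤j i≢j))

relabel-high : ∀ k {a} → + suc k ℤ.≤ a → + suc k ℤ.< relabel k a
relabel-high k {+ suc m} (ℤ.+≤+ (ℕ.s≤s k≤m)) rewrite skip-≥ k≤m = ℤ.+<+ (ℕ.s≤s (ℕ.s≤s k≤m))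

relabel-not-high : ∀ k {a} → a ℤ.< + suc k → relabel k a ℤ.< + suc k
relabel-not-high k {+ zero}    a<h                                      = a<h
relabel-not-high k {+ suc m}   (ℤ.+<+ (ℕ.s≤s m<k)) rewrite skip-< m<k   = ℤ.+<+ (ℕ.s≤s m<k)
relabel-not-high k { -[1+ m ]} a<h                                      = ℤ.-<+

relabel-low : ∀ k {a} → a ℤ.≤ -[1+ k ] → relabel k a ℤ.< -[1+ k ]
relabel-low k { -[1+ m ]} (ℤ.-≤- k≤m) rewrite skip-≥ k≤m = ℤ.-<- (ℕ.s≤s k≤m)

relabel-not-low : ∀ k {a} → -[1+ k ] ℤ.< a → -[1+ k ] ℤ.< relabel k a
relabel-not-low k {+ zero}    h<a                                   = ℤ.-<+
relabel-not-low k {+ suc m}   h<a                                   = ℤ.-<+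
relabel-not-low k { -[1+ m ]} (ℤ.-<- m<k) rewrite skip-< m<k        = ℤ.-<- m<k

descends : ℤ → ℤ → Bool
descends a b = does (b ℤ.<? a)

descends-true : ∀ {a b} → b ℤ.< a → descends a b ≡ true
descends-true {a} {b} = dec-true (b ℤ.<? a)

descends-false : ∀ {a b} → a ℤ.≤ b → descends a b ≡ false
descends-false {a} {b} a≤b = dec-false (b ℤ.<? a) (λ b<a → ℤ.<⇒≱ b<a a≤b)

descends-relabel : ∀ k a b → descends (relabel k a) (relabel k b) ≡ descends a b
descends-relabel k a b with b ℤ.<? a
... | yes b<a = descends-true (relabel-mono-< k b<a)
... | no  b≮a = descends-false (relabel-mono-≤ k (ℤ.≮⇒≥ b≮a))

-- Position relative to the pair ±(k+1) about to be inserted. The values ±(k+1) themselves belong to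
-- the outer sides, because `relabel k` moves them to ±(k+2).
data Side : Set where
  high mid low : Side

side : ℕ → ℤ → Side
side k a with + suc k ℤ.≤? a | a ℤ.≤? -[1+ k ]
... | yes _ | _     = high
... | no  _ | yes _ = low
... | no  _ | no  _ = mid

data Located (k : ℕ) (a : ℤ) : Side → Set where
  isHigh : + suc k ℤ.≤ a → Located k a high
  isMid  : -[1+ k ] ℤ.< a → a ℤ.< + suc k → Located k a mid
  isLow  : a ℤ.≤ -[1+ k ] → Located k a low

locate : ∀ k a → Located k a (side k a)
locate k a with + suc k ℤ.≤? a | a ℤ.≤? -[1+ k ]
... | yes h≤a | _        = isHigh h≤a
... | no  _   | yes a≤-h = isLow a≤-h
... | no  h≰a | no  a≰-h = isMid (ℤ.≰⇒> a≰-h) (ℤ.≰⇒> h≰a)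

located-unique : ∀ {k a s s′} → Located k a s → Located k a s′ → s ≡ s′
located-unique (isHigh p)  (isHigh q)  = ≡.refl
located-unique (isHigh p)  (isMid _ q) = ⊥-elim (ℤ.<⇒≱ q p)
located-unique (isHigh p)  (isLow q)   with ℤ.≤-trans p q
... | ()
located-unique (isMid _ p) (isHigh q)  = ⊥-elim (ℤ.<⇒≱ p q)
located-unique (isMid _ _) (isMid _ _) = ≡.refl
located-unique (isMid p _) (isLow q)   = ⊥-elim (ℤ.<⇒≱ p q)
located-unique (isLow p)   (isHigh q)  with ℤ.≤-trans q p
... | ()
located-unique (isLow p)   (isMid q _) = ⊥-elim (ℤ.<⇒≱ q p)
located-unique (isLow _)   (isLow _)   = ≡.refl

-- Only ±(k+1) change sides when the threshold is raised from k+1 to k+2. A letter at position k+1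
-- that is not a fixed point is neither of them.
side-suc : ∀ k a → a ≢ + suc k → a ≢ -[1+ k ] → side (suc k) a ≡ side k a
side-suc k a a≢h a≢-h with side k a | locate k a
... | _ | isHigh p  = located-unique (locate (suc k) a) (isHigh (sucℤ (ℤ.≤∧≢⇒< p (a≢h ∘ ≡.sym))))
  where
  sucℤ : ∀ {a} → + suc k ℤ.< a → + suc (suc k) ℤ.≤ a
  sucℤ (ℤ.+<+ p) = ℤ.+≤+ p
... | _ | isMid p q = located-unique (locate (suc k) a)
  (isMid (ℤ.<-trans (ℤ.-<- (ℕ.n<1+n k)) p) (ℤ.<-trans q (ℤ.+<+ (ℕ.n<1+n (suc k)))))
... | _ | isLow p   = located-unique (locate (suc k) a) (isLow (predℤ (ℤ.≤∧≢⇒< p a≢-h)))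
  where
  predℤ : ∀ {a} → a ℤ.< -[1+ k ] → a ℤ.≤ -[1+ suc k ]
  predℤ (ℤ.-<- p) = ℤ.-≤- p

above below : Side → Bool
above high = true
above _    = false
below low  = true
below _    = false

descends-to-+ : ∀ k a → descends (relabel k a) (+ suc k) ≡ above (side k a)
descends-to-+ k a with side k a | locate k a
... | _ | isHigh p  = descends-true (relabel-high k p)
... | _ | isMid _ p = descends-false (ℤ.<⇒≤ (relabel-not-high k p))
... | _ | isLow p   = descends-false (ℤ.<⇒≤ (relabel-not-high k (ℤ.≤-<-trans p ℤ.-<+)))

descends-to-- : ∀ k a → descends (relabel k a) -[1+ k ] ≡ not (below (side k a))
descends-to-- k a with side k a | locate k a
... | _ | isHigh p  = descends-true (relabel-not-low k (ℤ.<-≤-trans ℤ.-<+ p))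
... | _ | isMid p _ = descends-true (relabel-not-low k p)
... | _ | isLow p   = descends-false (ℤ.<⇒≤ (relabel-low k p))

descends-from-+ : ∀ k b → descends (+ suc k) (relabel k b) ≡ not (above (side k b))
descends-from-+ k b with side k b | locate k b
... | _ | isHigh p  = descends-false (ℤ.<⇒≤ (relabel-high k p))
... | _ | isMid _ p = descends-true (relabel-not-high k p)
... | _ | isLow p   = descends-true (relabel-not-high k (ℤ.≤-<-trans p ℤ.-<+))

descends-from-- : ∀ k b → descends -[1+ k ] (relabel k b) ≡ below (side k b)
descends-from-- k b with side k b | locate k b
... | _ | isHigh p  = descends-false (ℤ.<⇒≤ (relabel-not-low k (ℤ.<-≤-trans ℤ.-<+ p)))
... | _ | isMid p _ = descends-false (ℤ.<⇒≤ (relabel-not-low k p))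
... | _ | isLow p   = descends-true (relabel-low k p)

-- Entries on different sides are compared by their sides alone, while on a common side both
-- outcomes are possible. The resulting twelve cases are those of `local′`.
data Consistent : Side → Side → Bool → Set where
  same      : ∀ s d → Consistent s s d
  high-mid  : Consistent high mid true
  high-low  : Consistent high low true
  mid-low   : Consistent mid low true
  mid-high  : Consistent mid high false
  low-mid   : Consistent low mid false
  low-high  : Consistent low high false

consistent : ∀ k a b → Consistent (side k a) (side k b) (descends a b)
consistent k a b with side k a | side k b | locate k a | locate k b
... | _ | _ | isHigh _  | isHigh _  = same high _
... | _ | _ | isMid _ _ | isMid _ _ = same mid _
... | _ | _ | isLow _   | isLow _   = same low _
... | _ | _ | isHigh p  | isMid _ q rewrite descends-true (ℤ.<-≤-trans q p) = high-mid
... | _ | _ | isHigh p  | isLow q   rewrite descends-true (ℤ.≤-<-trans q (ℤ.<-≤-trans (ℤ.-<+ {k} {suc k}) p)) = high-low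
... | _ | _ | isMid p _ | isLow q   rewrite descends-true (ℤ.≤-<-trans q p) = mid-low
... | _ | _ | isMid _ p | isHigh q  rewrite descends-false (ℤ.<⇒≤ (ℤ.<-≤-trans p q)) = mid-high
... | _ | _ | isLow p   | isMid q _ rewrite descends-false (ℤ.<⇒≤ (ℤ.≤-<-trans p q)) = low-mid
... | _ | _ | isLow p   | isHigh q  rewrite descends-false (ℤ.<⇒≤ (ℤ.≤-<-trans p (ℤ.<-≤-trans (ℤ.-<+ {k} {suc k}) q))) = low-high

-- Products over descents and the potential

module Descents {c ℓ : Level} (R : CommutativeRing c ℓ) where
  open CommutativeRing R

  step : Carrier → Carrier → Bool → Carrier
  step y z d = if d then y else z

  -- The products of y over the descents and z over the ascents of c at positions < k, and at the
  -- positions k, …, k+m-1.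
  before : Carrier → Carrier → (ℕ → ℤ) → ℕ → Carrier
  before y z c zero    = 1#
  before y z c (suc k) = before y z c k * step y z (descends (c k) (c (suc k)))

  after : Carrier → Carrier → (ℕ → ℤ) → ℕ → ℕ → Carrier
  after y z c k zero    = 1#
  after y z c k (suc m) = step y z (descends (c k) (c (suc k))) * after y z c (suc k) m

  before-relabel : ∀ y z κ {c c′} k → (∀ i → i ℕ.≤ k → c′ i ≡ relabel κ (c i)) → before y z c′ k ≡ before y z c k
  before-relabel y z κ zero    c′≡ = ≡.refl
  before-relabel y z κ {c} {c′} (suc k) c′≡ = ≡.cong₂ (λ p d → p * step y z d)
    (before-relabel y z κ k (λ i i≤k → c′≡ i (ℕ.m≤n⇒m≤1+n i≤k)))
    (≡.trans (≡.cong₂ descends (c′≡ k (ℕ.n≤1+n k)) (c′≡ (suc k) ℕ.≤-refl)) (descends-relabel κ (c k) (c (suc k))))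

  after-relabel : ∀ y z κ {c c′} k m → (∀ i → k ℕ.≤ i → c′ (suc i) ≡ relabel κ (c i)) →
                  after y z c′ (suc k) m ≡ after y z c k m
  after-relabel y z κ k zero    c′≡ = ≡.refl
  after-relabel y z κ {c} {c′} k (suc m) c′≡ = ≡.cong₂ (λ d p → step y z d * p)
    (≡.trans (≡.cong₂ descends (c′≡ k ℕ.≤-refl) (c′≡ (suc k) (ℕ.n≤1+n k))) (descends-relabel κ (c k) (c (suc k))))
    (after-relabel y z κ (suc k) m (λ i k<i → c′≡ i (ℕ.<⇒≤ k<i)))

  before-after : ∀ y z c k m → before y z c (k ℕ.+ m) ≈ before y z c k * after y z c k m
  before-after y z c k zero    rewrite ℕ.+-identityʳ k = sym (*-identityʳ _)
  before-after y z c k (suc m) rewrite ℕ.+-suc k m = trans (before-after y z c (suc k) m) (*-assoc _ _ _)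

  after-suc : ∀ y z c k m → after y z c (suc k) m ≡ after y z (c ∘ suc) k m
  after-suc y z c k zero    = ≡.refl
  after-suc y z c k (suc m) = ≡.cong (_ *_) (after-suc y z c (suc k) m)

module Potential {c ℓ : Level} (R : CommutativeRing c ℓ)
  (t u v Y Z : CommutativeRing.Carrier R) where
  open CommutativeRing R
  open Descents R
  open IntegerScalars.Solver R using (solve; _:+_; _:*_; :-_; :1; _:=_; Polynomial)
  open SetoidReasoning setoid

  α : Carrier
  α = u * (1# + - t)

  -- The ratios are forced by the block sums. For example, summing over all blocks between a `high`
  -- and a `mid` neighbour gives t(1+α)(1-α)/v, which is Y/v times `weight mid` over `weight high`.
  -- The common scale is chosen so that no denominators occur.
  weight : Side → Carrier
  weight high = 1# + α
  weight mid  = (1# + α) * (1# + - α)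
  weight low  = 1# + - α

  -- The entry at position k ≥ 1 is compared with ±k, not with ±(k+1): a fixed point that was just
  -- inserted at position k must count as `high` or `low` according to its sign. For k = 0 the entry
  -- is π₀ = 0, which lies between -1 and 1.
  boundary : ℕ → ℤ → Carrier
  boundary zero    a = weight mid
  boundary (suc k) a = weight (side k a)

  -- Divided by (1+α)(1-α)vᵏ, this is the generating function of the words obtained from one with
  -- entries c by inserting fixed points at the first k slots, u marking the inserted points.  A block
  -- of fixed points sees its neighbours only through their sides, and the weights of the sides telescope.
  potential : ℕ → ℕ → (ℕ → ℤ) → Carrier
  potential k m c = before Y Z c k * boundary k (c k) * after t 1# c k m

  module _ (v≈ : v ≈ 1# + - ((1# + t) * u)) (Y≈ : Y ≈ t * (1# + α)) (Z≈ : Z ≈ 1# + - α) where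

    private
      Yₚ Zₚ vₚ : Polynomial 2 → Polynomial 2 → Polynomial 2
      Yₚ t u = t :* (:1 :+ u :* (:1 :+ :- t))
      Zₚ t u = :1 :+ :- (u :* (:1 :+ :- t))
      vₚ t u = :1 :+ :- ((:1 :+ t) :* u)

      weightₚ : Side → Polynomial 2 → Polynomial 2 → Polynomial 2
      weightₚ high t u = :1 :+ u :* (:1 :+ :- t)
      weightₚ mid  t u = (:1 :+ u :* (:1 :+ :- t)) :* (:1 :+ :- (u :* (:1 :+ :- t)))
      weightₚ low  t u = :1 :+ :- (u :* (:1 :+ :- t))

      equation : Side → Side → Bool → Polynomial 2 → Polynomial 2 → Polynomial 2 × Polynomial 2
      equation sa sb d t u = stepₚ d :* wₚ sb :=
        vₚ t u :* (wₚ sa :* (if d then t else :1))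
          :+ u :* (stepₚ (not (below sa)) :* wₚ low :* (if below sb then t else :1)
               :+ stepₚ (above sa) :* wₚ high :* (if not (above sb) then t else :1))
        where
        stepₚ : Bool → Polynomial 2
        stepₚ d = if d then Yₚ t u else Zₚ t u
        wₚ : Side → Polynomial 2
        wₚ s = weightₚ s t u

      Y′ Z′ v′ : Carrier
      Y′ = t * (1# + α)
      Z′ = 1# + - α
      v′ = 1# + - ((1# + t) * u)

    -- The recursion of `potential-insert` at a single slot, with the common factors removed. The
    -- three summands stand for the empty block, a block whose last letter is negative (hence `low`)
    -- and one whose last letter is positive (hence `high`). After Y, Z and v are expanded these are
    -- polynomial identities in t and u.
    local′ : ∀ {sa sb d} → Consistent sa sb d → step Y′ Z′ d * weight sb ≈
      v′ * (weight sa * step t 1# d)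
        + u * (step Y′ Z′ (not (below sa)) * weight low * step t 1# (below sb)
             + step Y′ Z′ (above sa) * weight high * step t 1# (not (above sb)))
    local′ (same high true)  = solve 2 (equation high high true) refl t u
    local′ (same high false) = solve 2 (equation high high false) refl t u
    local′ (same mid true)   = solve 2 (equation mid mid true) refl t u
    local′ (same mid false)  = solve 2 (equation mid mid false) refl t u
    local′ (same low true)   = solve 2 (equation low low true) refl t u
    local′ (same low false)  = solve 2 (equation low low false) refl t u
    local′ high-mid          = solve 2 (equation high mid true) refl t u
    local′ high-low          = solve 2 (equation high low true) refl t u
    local′ mid-low           = solve 2 (equation mid low true) refl t u
    local′ mid-high          = solve 2 (equation mid high false) refl t u
    local′ low-mid           = solve 2 (equation low mid false) refl t u
    local′ low-high          = solve 2 (equation low high false) refl t u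

    step-cong : ∀ d → step Y Z d ≈ step Y′ Z′ d
    step-cong true  = Y≈
    step-cong false = Z≈

    local : ∀ {sa sb d} → Consistent sa sb d → step Y Z d * weight sb ≈
      v * (weight sa * step t 1# d)
        + u * (step Y Z (not (below sa)) * weight low * step t 1# (below sb)
             + step Y Z (above sa) * weight high * step t 1# (not (above sb)))
    local {sa} {sb} {d} c = trans (*-congʳ (step-cong d)) (trans (local′ c) (sym
      (+-cong (*-congʳ v≈) (*-congˡ (+-cong (*-congʳ (*-congʳ (step-cong (not (below sa)))))
        (*-congʳ (*-congʳ (step-cong (above sa)))))))))

    -- c⁻ and c⁺ are the entries after the fixed points -(k+1) and k+1 are inserted into c.
    module _ (k m : ℕ) (c c⁻ c⁺ : ℕ → ℤ)
      (bound : boundary k (c k) ≡ weight (side k (c k)))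
      (left⁻ : ∀ i → i ℕ.≤ k → c⁻ i ≡ relabel k (c i)) (left⁺ : ∀ i → i ℕ.≤ k → c⁺ i ≡ relabel k (c i))
      (new⁻ : c⁻ (suc k) ≡ -[1+ k ]) (new⁺ : c⁺ (suc k) ≡ + suc k)
      (right⁻ : ∀ i → suc k ℕ.≤ i → c⁻ (suc i) ≡ relabel k (c i))
      (right⁺ : ∀ i → suc k ℕ.≤ i → c⁺ (suc i) ≡ relabel k (c i))
      where

      private
        a b : ℤ
        a = c k
        b = c (suc k)
        B Q : Carrier
        B = before Y Z c k
        Q = after t 1# c (suc k) m

      side-+ : side k (+ suc k) ≡ high
      side-+ = located-unique (locate k (+ suc k)) (isHigh ℤ.≤-refl)

      side-- : side k -[1+ k ] ≡ low
      side-- = located-unique (locate k -[1+ k ]) (isLow ℤ.≤-refl)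

      potential⁻ : potential (suc k) (suc m) c⁻ ≡
        B * step Y Z (not (below (side k a))) * weight low * (step t 1# (below (side k b)) * Q)
      potential⁻ = ≡.cong₂ _*_
        (≡.cong₂ _*_
          (≡.cong₂ (λ p d → p * step Y Z d) (before-relabel Y Z k k left⁻)
            (≡.trans (≡.cong₂ descends (left⁻ k ℕ.≤-refl) new⁻) (descends-to-- k a)))
          (≡.cong weight (≡.trans (≡.cong (side k) new⁻) side--)))
        (≡.cong₂ (λ d q → step t 1# d * q)
          (≡.trans (≡.cong₂ descends new⁻ (right⁻ (suc k) ℕ.≤-refl)) (descends-from-- k b))
          (after-relabel t 1# k (suc k) m right⁻))

      potential⁺ : potential (suc k) (suc m) c⁺ ≡
        B * step Y Z (above (side k a)) * weight high * (step t 1# (not (above (side k b))) * Q)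
      potential⁺ = ≡.cong₂ _*_
        (≡.cong₂ _*_
          (≡.cong₂ (λ p d → p * step Y Z d) (before-relabel Y Z k k left⁺)
            (≡.trans (≡.cong₂ descends (left⁺ k ℕ.≤-refl) new⁺) (descends-to-+ k a)))
          (≡.cong weight (≡.trans (≡.cong (side k) new⁺) side-+)))
        (≡.cong₂ (λ d q → step t 1# d * q)
          (≡.trans (≡.cong₂ descends new⁺ (right⁺ (suc k) ℕ.≤-refl)) (descends-from-+ k b))
          (after-relabel t 1# k (suc k) m right⁺))

      -- The block in slot k is empty or has a last letter. In the second case let `c⁻` or `c⁺`
      -- contain that letter alone; the rest of the block then occupies slot k of this longer word,
      -- which is why `potential (suc k)` stands on both sides. The factor v in front of
      -- `potential k` comes from the normalisation by powers of v.
      potential-insert : potential (suc k) m c ≈ v * potential k (suc m) c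
        + u * (potential (suc k) (suc m) c⁻ + potential (suc k) (suc m) c⁺)
      potential-insert = begin
        B * s * w b * Q
          ≈⟨ solve 4 (λ B s w Q → B :* s :* w :* Q := B :* Q :* (s :* w)) refl B s (w b) Q ⟩
        B * Q * (s * w b)
          ≈⟨ *-congˡ (local (consistent k a b)) ⟩
        B * Q * (v * (w a * s₁) + u * (s⁻ * weight low * r⁻ + s⁺ * weight high * r⁺))
          ≈⟨ solve 12 (λ B Q v wa s₁ u s⁻ wl r⁻ s⁺ wh r⁺ →
               B :* Q :* (v :* (wa :* s₁) :+ u :* (s⁻ :* wl :* r⁻ :+ s⁺ :* wh :* r⁺))
               := v :* (B :* wa :* (s₁ :* Q)) :+ u :* (B :* s⁻ :* wl :* (r⁻ :* Q) :+ B :* s⁺ :* wh :* (r⁺ :* Q)))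
               refl B Q v (w a) s₁ u s⁻ (weight low) r⁻ s⁺ (weight high) r⁺ ⟩
        v * (B * w a * (s₁ * Q)) + u * (B * s⁻ * weight low * (r⁻ * Q) + B * s⁺ * weight high * (r⁺ * Q))
          ≡⟨ ≡.cong₂ (λ x y → v * (B * x * (s₁ * Q)) + u * y) (≡.sym bound) (≡.sym (≡.cong₂ _+_ potential⁻ potential⁺)) ⟩
        v * potential k (suc m) c + u * (potential (suc k) (suc m) c⁻ + potential (suc k) (suc m) c⁺) ∎
        where
        w : ℤ → Carrier
        w x = weight (side k x)
        s s₁ s⁻ r⁻ s⁺ r⁺ : Carrier
        s  = step Y Z (descends a b)
        s₁ = step t 1# (descends a b)
        s⁻ = step Y Z (not (below (side k a)))
        r⁻ = step t 1# (below (side k b))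
        s⁺ = step Y Z (above (side k a))
        r⁺ = step t 1# (not (above (side k b)))

-- Finite sums over letters and words

module Sums {c ℓ : Level} (M : CommutativeMonoid c ℓ) where
  open CommutativeMonoid M
    renaming (_∙_ to _+_; ε to 0#; ∙-cong to +-cong; ∙-congˡ to +-congˡ; ∙-congʳ to +-congʳ;
              assoc to +-assoc; comm to +-comm; identityˡ to +-identityˡ; identityʳ to +-identityʳ)
  open CommutativeSemigroupProperties commutativeSemigroup using (interchange; x∙yz≈y∙xz)
  open SetoidReasoning setoid

  ∑ : {A : Set} → List A → (A → Carrier) → Carrier
  ∑ xs g = foldr (λ x s → g x + s) 0# xs

  when : {P : Set} → Dec P → Carrier → Carrier
  when P? x = if does P? then x else 0#

  when-true : {P : Set} (P? : Dec P) → P → ∀ x → when P? x ≡ x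
  when-true P? p x rewrite dec-true P? p = ≡.refl

  when-false : {P : Set} (P? : Dec P) → ¬ P → ∀ x → when P? x ≡ 0#
  when-false P? ¬p x rewrite dec-false P? ¬p = ≡.refl

  when-⇔ : {P Q : Set} (P? : Dec P) (Q? : Dec Q) → (P → Q) → (Q → P) → ∀ x → when P? x ≡ when Q? x
  when-⇔ (yes p) Q? to from x = ≡.sym (when-true Q? (to p) x)
  when-⇔ (no ¬p) Q? to from x = ≡.sym (when-false Q? (¬p ∘ from) x)

  when-cong : {P : Set} (P? : Dec P) → ∀ {x y} → (P → x ≈ y) → when P? x ≈ when P? y
  when-cong (yes p) x≈y = x≈y p
  when-cong (no _)  x≈y = refl

  when-+ : {P : Set} (P? : Dec P) → ∀ x y → when P? (x + y) ≈ when P? x + when P? y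
  when-+ (yes _) x y = refl
  when-+ (no _)  x y = sym (+-identityˡ 0#)

  when-split : {P Q S : Set} (P? : Dec P) (Q? : Dec Q) (S? : Dec S) →
    (P → ¬ Q → S) → (Q → P) → (S → P) → (S → ¬ Q) → ∀ x → when P? x ≈ when S? x + when Q? x
  when-split P? (yes q) S? P⇒S Q⇒P S⇒P S⇒¬Q x =
    trans (reflexive (when-true P? (Q⇒P q) x))
      (sym (trans (+-congʳ (reflexive (when-false S? (λ s → S⇒¬Q s q) x))) (+-identityˡ x)))
  when-split P? (no ¬q) S? P⇒S Q⇒P S⇒P S⇒¬Q x =
    trans (reflexive (when-⇔ P? S? (λ p → P⇒S p ¬q) S⇒P x)) (sym (+-identityʳ _))

  module _ {A : Set} where
    ∑-cong : ∀ (xs : List A) {g h : A → Carrier} → (∀ x → g x ≈ h x) → ∑ xs g ≈ ∑ xs h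
    ∑-cong []       g≈h = refl
    ∑-cong (x ∷ xs) g≈h = +-cong (g≈h x) (∑-cong xs g≈h)

    ∑-zero : ∀ (xs : List A) {g : A → Carrier} → (∀ x → g x ≈ 0#) → ∑ xs g ≈ 0#
    ∑-zero []       g≈0 = refl
    ∑-zero (x ∷ xs) g≈0 = trans (+-cong (g≈0 x) (∑-zero xs g≈0)) (+-identityˡ 0#)

    ∑-+ : ∀ (xs : List A) (g h : A → Carrier) → ∑ xs (λ x → g x + h x) ≈ ∑ xs g + ∑ xs h
    ∑-+ []       g h = sym (+-identityˡ 0#)
    ∑-+ (x ∷ xs) g h = trans (+-congˡ (∑-+ xs g h)) (interchange _ _ _ _)

    ∑-++ : ∀ (xs ys : List A) (g : A → Carrier) → ∑ (xs ++ ys) g ≈ ∑ xs g + ∑ ys g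
    ∑-++ []       ys g = sym (+-identityˡ _)
    ∑-++ (x ∷ xs) ys g = trans (+-congˡ (∑-++ xs ys g)) (sym (+-assoc _ _ _))

    ∑-filter : {P : Pred A 0ℓ} (P? : Decidable P) (xs : List A) (g : A → Carrier) →
               ∑ (filter P? xs) g ≈ ∑ xs (λ x → when (P? x) (g x))
    ∑-filter P? []       g = refl
    ∑-filter P? (x ∷ xs) g with does (P? x)
    ... | true  = +-congˡ (∑-filter P? xs g)
    ... | false = trans (∑-filter P? xs g) (sym (+-identityˡ _))

  ∑-map : {A B : Set} (f : A → B) (xs : List A) (g : B → Carrier) → ∑ (List.map f xs) g ≡ ∑ xs (g ∘ f)
  ∑-map f []       g = ≡.refl
  ∑-map f (x ∷ xs) g = ≡.cong (λ s → g (f x) + s) (∑-map f xs g)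

  ∑-swap : {A B : Set} (xs : List A) (ys : List B) (g : A → B → Carrier) →
           ∑ xs (λ x → ∑ ys (g x)) ≈ ∑ ys (λ y → ∑ xs (λ x → g x y))
  ∑-swap []       ys g = sym (∑-zero ys (λ _ → refl))
  ∑-swap (x ∷ xs) ys g = trans (+-congˡ (∑-swap xs ys g)) (sym (∑-+ ys (g x) _))

  ∑-cartesianProductWith : {A B C : Set} (f : A → B → C) (xs : List A) (ys : List B) (g : C → Carrier) →
    ∑ (cartesianProductWith f xs ys) g ≈ ∑ xs (λ x → ∑ ys (λ y → g (f x y)))
  ∑-cartesianProductWith f []       ys g = refl
  ∑-cartesianProductWith f (x ∷ xs) ys g = trans (∑-++ (List.map (f x) ys) _ g)
    (+-cong (reflexive (∑-map (f x) ys g)) (∑-cartesianProductWith f xs ys g))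

  ∑-allFin-suc : ∀ n (g : Fin (suc n) → Carrier) → ∑ (allFin (suc n)) g ≡ g Fin.zero + ∑ (allFin n) (g ∘ Fin.suc)
  ∑-allFin-suc n g = ≡.cong (λ s → g Fin.zero + s) (≡.trans
    (≡.cong (λ xs → ∑ xs g) (≡.sym (List.map-tabulate id Fin.suc))) (∑-map Fin.suc (allFin n) g))

  ∑-punchIn : ∀ {n} (k : Fin (suc n)) (g : Fin (suc n) → Carrier) →
              ∑ (allFin (suc n)) g ≈ g k + ∑ (allFin n) (g ∘ punchIn k)
  ∑-punchIn {n}     Fin.zero    g = reflexive (∑-allFin-suc n g)
  ∑-punchIn {suc n} (Fin.suc k) g = begin
    ∑ (allFin (suc (suc n))) g
      ≡⟨ ∑-allFin-suc (suc n) g ⟩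
    g Fin.zero + ∑ (allFin (suc n)) (g ∘ Fin.suc)
      ≈⟨ +-congˡ (∑-punchIn k (g ∘ Fin.suc)) ⟩
    g Fin.zero + (g (Fin.suc k) + ∑ (allFin n) (g ∘ Fin.suc ∘ punchIn k))
      ≈⟨ x∙yz≈y∙xz _ _ _ ⟩
    g (Fin.suc k) + (g Fin.zero + ∑ (allFin n) (g ∘ Fin.suc ∘ punchIn k))
      ≡⟨ ≡.cong (λ s → g (Fin.suc k) + s) (∑-allFin-suc n (g ∘ punchIn (Fin.suc k))) ⟨
    g (Fin.suc k) + ∑ (allFin (suc n)) (g ∘ punchIn (Fin.suc k)) ∎

  -- The enumeration chooses the coordinates from the first one on, so singling out coordinate k
  -- means exchanging its sum with those of the earlier coordinates.
  ∑-vectors-insertAt : {A : Set} (as : List A) {m : ℕ} (k : Fin (suc m)) (g : Vec A (suc m) → Carrier) →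
    ∑ (vectors as (suc m)) g ≈ ∑ as (λ a → ∑ (vectors as m) (λ w → g (insertAt w k a)))
  ∑-vectors-insertAt as {m}     Fin.zero    g = ∑-cartesianProductWith Vec._∷_ as (vectors as m) g
  ∑-vectors-insertAt as {suc m} (Fin.suc k) g = begin
    ∑ (vectors as (suc (suc m))) g
      ≈⟨ ∑-cartesianProductWith Vec._∷_ as (vectors as (suc m)) g ⟩
    ∑ as (λ b → ∑ (vectors as (suc m)) (λ w → g (b Vec.∷ w)))
      ≈⟨ ∑-cong as (λ b → ∑-vectors-insertAt as k (λ w → g (b Vec.∷ w))) ⟩
    ∑ as (λ b → ∑ as (λ a → ∑ (vectors as m) (λ w → g (b Vec.∷ insertAt w k a))))
      ≈⟨ ∑-swap as as _ ⟩
    ∑ as (λ a → ∑ as (λ b → ∑ (vectors as m) (λ w → g (b Vec.∷ insertAt w k a))))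
      ≈⟨ ∑-cong as (λ a → ∑-cartesianProductWith Vec._∷_ as (vectors as m) (λ w → g (insertAt w (Fin.suc k) a))) ⟨
    ∑ as (λ a → ∑ (vectors as (suc m)) (λ w → g (insertAt w (Fin.suc k) a))) ∎

  signs : List Sign
  signs = Sign.- ∷ Sign.+ ∷ []

  ∑-letters-punchIn : ∀ {n} (k : Fin (suc n)) (g : Letter (suc n) → Carrier) → (∀ s → g (s , k) ≈ 0#) →
    ∑ (cartesianProduct signs (allFin (suc n))) g ≈ ∑ (cartesianProduct signs (allFin n)) (g ∘ map₂ (punchIn k))
  ∑-letters-punchIn {n} k g g≈0 = begin
    ∑ (cartesianProduct signs (allFin (suc n))) g
      ≈⟨ ∑-cartesianProductWith _,_ signs (allFin (suc n)) g ⟩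
    ∑ signs (λ s → ∑ (allFin (suc n)) (λ p → g (s , p)))
      ≈⟨ ∑-cong signs (λ s → trans (∑-punchIn k (λ p → g (s , p))) (trans (+-congʳ (g≈0 s)) (+-identityˡ _))) ⟩
    ∑ signs (λ s → ∑ (allFin n) (λ p → g (s , punchIn k p)))
      ≈⟨ ∑-cartesianProductWith _,_ signs (allFin n) (g ∘ map₂ (punchIn k)) ⟨
    ∑ (cartesianProduct signs (allFin n)) (g ∘ map₂ (punchIn k)) ∎

  ∑-vectors-punchIn : ∀ {n} (k : Fin (suc n)) m (g : Vec (Letter (suc n)) m → Carrier) →
    (∀ w i → proj₂ (lookup w i) ≡ k → g w ≈ 0#) →
    ∑ (vectors (cartesianProduct signs (allFin (suc n))) m) g
      ≈ ∑ (vectors (cartesianProduct signs (allFin n)) m) (g ∘ Vec.map (map₂ (punchIn k)))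
  ∑-vectors-punchIn         k zero    g g≈0 = refl
  ∑-vectors-punchIn {n = n} k (suc m) g g≈0 = begin
    ∑ (vectors as′ (suc m)) g
      ≈⟨ ∑-cartesianProductWith Vec._∷_ as′ (vectors as′ m) g ⟩
    ∑ as′ (λ a → ∑ (vectors as′ m) (λ w → g (a Vec.∷ w)))
      ≈⟨ ∑-letters-punchIn k _ (λ s → ∑-zero (vectors as′ m) (λ w → g≈0 ((s , k) Vec.∷ w) Fin.zero ≡.refl)) ⟩
    ∑ as (λ a → ∑ (vectors as′ m) (λ w → g (map₂ (punchIn k) a Vec.∷ w)))
      ≈⟨ ∑-cong as (λ a → ∑-vectors-punchIn k m (λ w → g (map₂ (punchIn k) a Vec.∷ w))
           (λ w i → g≈0 (map₂ (punchIn k) a Vec.∷ w) (Fin.suc i))) ⟩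
    ∑ as (λ a → ∑ (vectors as m) (λ w → g (Vec.map (map₂ (punchIn k)) (a Vec.∷ w))))
      ≈⟨ ∑-cartesianProductWith Vec._∷_ as (vectors as m) (g ∘ Vec.map (map₂ (punchIn k))) ⟨
    ∑ (vectors as (suc m)) (g ∘ Vec.map (map₂ (punchIn k))) ∎
    where
    as′ = cartesianProduct signs (allFin (suc n))
    as = cartesianProduct signs (allFin n)

module ℕ-Sums = Sums ℕ.+-0-commutativeMonoid

count-∑ : {A : Set} {P : Pred A 0ℓ} (P? : Decidable P) (xs : List A) →
          count P? xs ≡ ℕ-Sums.∑ xs (λ x → ℕ-Sums.when (P? x) 1)
count-∑ P? xs = ≡.trans (length-∑ (filter P? xs)) (ℕ-Sums.∑-filter P? xs (λ _ → 1))
  where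
  length-∑ : {A : Set} (ys : List A) → length ys ≡ ℕ-Sums.∑ ys (λ _ → 1)
  length-∑ []       = ≡.refl
  length-∑ (y ∷ ys) = ≡.cong suc (length-∑ ys)

count-suc : ∀ {n} {P : Pred (Fin (suc n)) 0ℓ} (P? : Decidable P) →
  count P? (allFin (suc n)) ≡ ℕ-Sums.when (P? Fin.zero) 1 ℕ.+ count (P? ∘ Fin.suc) (allFin n)
count-suc {n} P? = ≡.trans (count-∑ P? (allFin (suc n))) (≡.trans (ℕ-Sums.∑-allFin-suc n _)
  (≡.cong (ℕ-Sums.when (P? Fin.zero) 1 ℕ.+_) (≡.sym (count-∑ (P? ∘ Fin.suc) (allFin n)))))

-- Inserting one fixed point into a signed word

insertFixed : ∀ {n} → Fin (suc n) → Sign → Word n → Word (suc n)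
insertFixed k s π = insertAt (Vec.map (map₂ (punchIn k)) π) k (s , k)

data PunchView {n : ℕ} (k : Fin (suc n)) : Fin (suc n) → Set where
  isHole  : PunchView k k
  punched : ∀ i → PunchView k (punchIn k i)

punchView : ∀ {n} (k i : Fin (suc n)) → PunchView k i
punchView k i with k Fin.≟ i
... | yes ≡.refl = isHole
... | no  k≢i    = ≡.subst (PunchView k) (Fin.punchIn-punchOut k≢i) (punched (punchOut k≢i))

module InsertFixed {n : ℕ} (k : Fin (suc n)) (s : Sign) (π : Word n) where
  π⁺ : Word (suc n)
  π⁺ = insertFixed k s π

  lookup-hole : lookup π⁺ k ≡ (s , k)
  lookup-hole = Vec.insertAt-lookup _ k (s , k)

  lookup-punchIn : ∀ i → lookup π⁺ (punchIn k i) ≡ map₂ (punchIn k) (lookup π i)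
  lookup-punchIn i = ≡.trans (Vec.insertAt-punchIn _ k (s , k) i) (Vec.lookup-map i _ π)

  at-hole : ∣ π⁺ ∣at k ≡ k
  at-hole = ≡.cong proj₂ lookup-hole

  at-punchIn : ∀ i → ∣ π⁺ ∣at (punchIn k i) ≡ punchIn k (∣ π ∣at i)
  at-punchIn i = ≡.cong proj₂ (lookup-punchIn i)

  private
    punch-inj : ∀ {i l} → punchIn k i ≡ punchIn k l → i ≡ l
    punch-inj = Fin.punchIn-injective k _ _

  isSignedPermutation-insert : IsSignedPermutation π → IsSignedPermutation π⁺
  isSignedPermutation-insert inj i l eq with punchView k i | punchView k l
  ... | isHole    | isHole     = ≡.refl
  ... | isHole    | punched l′ = ⊥-elim (Fin.punchInᵢ≢i k _ (≡.sym (≡.trans (≡.sym at-hole) (≡.trans eq (at-punchIn l′)))))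
  ... | punched i′ | isHole    = ⊥-elim (Fin.punchInᵢ≢i k _ (≡.trans (≡.sym (at-punchIn i′)) (≡.trans eq at-hole)))
  ... | punched i′ | punched l′ = ≡.cong (punchIn k)
    (inj i′ l′ (punch-inj (≡.trans (≡.sym (at-punchIn i′)) (≡.trans eq (at-punchIn l′)))))

  isSignedPermutation-delete : IsSignedPermutation π⁺ → IsSignedPermutation π
  isSignedPermutation-delete inj i l eq = punch-inj (inj (punchIn k i) (punchIn k l)
    (≡.trans (at-punchIn i) (≡.trans (≡.cong (punchIn k) eq) (≡.sym (at-punchIn l)))))

apply-lookup : ∀ {n} (π : Word n) s i → apply π (s , i) ≡ (s Sign.* proj₁ (lookup π i) , proj₂ (lookup π i))
apply-lookup π s i with lookup π i
... | (s′ , k) = ≡.refl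

SelfInverse : ∀ {n} → Word n → Set
SelfInverse π = ∀ i → apply π (lookup π i) ≡ (Sign.+ , i)

selfInverse⇒ : ∀ {n} (π : Word n) → SelfInverse π → π ∘ʷ π ≡ idʷ
selfInverse⇒ π inv = ≡.trans (≡.sym (Vec.tabulate∘lookup (π ∘ʷ π)))
  (Vec.tabulate-cong (λ i → ≡.trans (Vec.lookup-map i (apply π) π) (inv i)))

selfInverse⇐ : ∀ {n} (π : Word n) → π ∘ʷ π ≡ idʷ → SelfInverse π
selfInverse⇐ π eq i = ≡.trans (≡.sym (Vec.lookup-map i (apply π) π))
  (≡.trans (≡.cong (λ σ → lookup σ i) eq) (Vec.lookup∘tabulate (Sign.+ ,_) i))

module InsertFixedInvolution {n : ℕ} (k : Fin (suc n)) (s : Sign) (π : Word n) where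
  open InsertFixed k s π

  apply-punchIn : ∀ l → apply π⁺ (map₂ (punchIn k) l) ≡ map₂ (punchIn k) (apply π l)
  apply-punchIn (s₁ , p) = ≡.trans (apply-lookup π⁺ s₁ (punchIn k p)) (≡.trans
    (≡.cong (λ l → s₁ Sign.* proj₁ l , proj₂ l) (lookup-punchIn p))
    (≡.cong (map₂ (punchIn k)) (≡.sym (apply-lookup π s₁ p))))

  apply²-punchIn : ∀ i → apply π⁺ (lookup π⁺ (punchIn k i)) ≡ map₂ (punchIn k) (apply π (lookup π i))
  apply²-punchIn i = ≡.trans (≡.cong (apply π⁺) (lookup-punchIn i)) (apply-punchIn (lookup π i))

  isInvolution-insert : IsInvolution π → IsInvolution π⁺
  isInvolution-insert (inj , inv) = isSignedPermutation-insert inj , selfInverse⇒ π⁺ inv⁺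
    where
    inv⁺ : SelfInverse π⁺
    inv⁺ i with punchView k i
    ... | isHole     = ≡.trans (≡.cong (apply π⁺) lookup-hole) (≡.trans (apply-lookup π⁺ s k)
                         (≡.trans (≡.cong (λ l → s Sign.* proj₁ l , proj₂ l) lookup-hole) (≡.cong (_, k) (square s))))
      where
      square : ∀ s → s Sign.* s ≡ Sign.+
      square Sign.- = ≡.refl
      square Sign.+ = ≡.refl
    ... | punched i′ = ≡.trans (apply²-punchIn i′) (≡.cong (map₂ (punchIn k)) (selfInverse⇐ π inv i′))

  isInvolution-delete : IsInvolution π⁺ → IsInvolution π
  isInvolution-delete (inj , inv) = isSignedPermutation-delete inj , selfInverse⇒ π λ i →
    punch-pair (≡.trans (≡.sym (apply²-punchIn i)) (selfInverse⇐ π⁺ inv (punchIn k i)))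
    where
    punch-pair : ∀ {l l′ : Letter n} → map₂ (punchIn k) l ≡ map₂ (punchIn k) l′ → l ≡ l′
    punch-pair {s₁ , p} {s₂ , q} eq = ≡.cong₂ _,_ (≡.cong proj₁ eq) (Fin.punchIn-injective k p q (≡.cong proj₂ eq))

module InsertFixedStatistics {n : ℕ} (k : Fin (suc n)) (s : Sign) (π : Word n) where
  open InsertFixed k s π
  open ℕ-Sums

  fixᴮ-insert : fixᴮ π⁺ ≡ suc (fixᴮ π)
  fixᴮ-insert = ≡.trans (count-∑ (λ i → ∣ π⁺ ∣at i Fin.≟ i) (allFin (suc n)))
    (≡.trans (∑-punchIn k _)
    (≡.trans (≡.cong₂ ℕ._+_ (when-true (∣ π⁺ ∣at k Fin.≟ k) at-hole 1)
      (∑-cong (allFin n) (λ i → when-⇔ (∣ π⁺ ∣at (punchIn k i) Fin.≟ punchIn k i) (∣ π ∣at i Fin.≟ i)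
        (λ eq → Fin.punchIn-injective k _ _ (≡.trans (≡.sym (at-punchIn i)) eq))
        (λ eq → ≡.trans (at-punchIn i) (≡.cong (punchIn k) eq)) 1)))
    (≡.cong suc (≡.sym (count-∑ (λ i → ∣ π ∣at i Fin.≟ i) (allFin n))))))

  -- A pair that involves the new position is no two-cycle because that position is fixed. The other
  -- pairs correspond under `punchIn`, which preserves and reflects the order used to count each
  -- two-cycle once.
  cyc₂-insert : cyc₂ π⁺ ≡ cyc₂ π
  cyc₂-insert = begin
    cyc₂ π⁺
      ≡⟨ count-∑ two-cycle⁺? (cartesianProduct (allFin (suc n)) (allFin (suc n))) ⟩
    ∑ (cartesianProduct (allFin (suc n)) (allFin (suc n))) term⁺
      ≡⟨ ∑-cartesianProductWith _,_ (allFin (suc n)) (allFin (suc n)) term⁺ ⟩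
    ∑ (allFin (suc n)) (λ i → ∑ (allFin (suc n)) (λ l → term⁺ (i , l)))
      ≡⟨ ∑-punchIn k _ ⟩
    ∑ (allFin (suc n)) (λ l → term⁺ (k , l)) ℕ.+ ∑ (allFin n) (λ i → ∑ (allFin (suc n)) (λ l → term⁺ (punchIn k i , l)))
      ≡⟨ ≡.cong₂ ℕ._+_ (∑-zero (allFin (suc n)) from-hole) (∑-cong (allFin n) (λ i → ∑-punchIn k (λ l → term⁺ (punchIn k i , l)))) ⟩
    ∑ (allFin n) (λ i → term⁺ (punchIn k i , k) ℕ.+ ∑ (allFin n) (λ l → term⁺ (punchIn k i , punchIn k l)))
      ≡⟨ ∑-cong (allFin n) (λ i → ≡.cong₂ ℕ._+_ (to-hole i) (∑-cong (allFin n) (elsewhere i))) ⟩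
    ∑ (allFin n) (λ i → ∑ (allFin n) (λ l → term (i , l)))
      ≡⟨ ∑-cartesianProductWith _,_ (allFin n) (allFin n) term ⟨
    ∑ (cartesianProduct (allFin n) (allFin n)) term
      ≡⟨ count-∑ two-cycle? (cartesianProduct (allFin n) (allFin n)) ⟨
    cyc₂ π ∎
    where
    open ≡.≡-Reasoning
    two-cycle⁺? : (p : Fin (suc n) × Fin (suc n)) → Dec _
    two-cycle⁺? = λ (i , l) → i Fin.<? l ×-dec ∣ π⁺ ∣at i Fin.≟ l ×-dec ∣ π⁺ ∣at l Fin.≟ i
    two-cycle? : (p : Fin n × Fin n) → Dec _
    two-cycle? = λ (i , l) → i Fin.<? l ×-dec ∣ π ∣at i Fin.≟ l ×-dec ∣ π ∣at l Fin.≟ i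
    term⁺ : Fin (suc n) × Fin (suc n) → ℕ
    term⁺ p = when (two-cycle⁺? p) 1
    term : Fin n × Fin n → ℕ
    term p = when (two-cycle? p) 1
    from-hole : ∀ l → term⁺ (k , l) ≡ 0
    from-hole l = when-false (two-cycle⁺? (k , l))
      (λ { (k<l , eq , _) → Fin.<⇒≢ k<l (≡.trans (≡.sym at-hole) eq) }) 1
    to-hole : ∀ i → term⁺ (punchIn k i , k) ≡ 0
    to-hole i = when-false (two-cycle⁺? (punchIn k i , k))
      (λ { (_ , eq , _) → Fin.punchInᵢ≢i k _ (≡.trans (≡.sym (at-punchIn i)) eq) }) 1
    elsewhere : ∀ i l → term⁺ (punchIn k i , punchIn k l) ≡ term (i , l)
    elsewhere i l = when-⇔ (two-cycle⁺? (punchIn k i , punchIn k l)) (two-cycle? (i , l))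
      (λ { (i<l , eq₁ , eq₂) →
          ℕ.≰⇒> (λ l≤i → ℕ.<⇒≱ i<l (Fin.punchIn-mono-≤ k l i l≤i))
        , Fin.punchIn-injective k _ _ (≡.trans (≡.sym (at-punchIn i)) eq₁)
        , Fin.punchIn-injective k _ _ (≡.trans (≡.sym (at-punchIn l)) eq₂) })
      (λ { (i<l , eq₁ , eq₂) →
          ℕ.≰⇒> (λ l≤i → ℕ.<⇒≱ i<l (Fin.punchIn-cancel-≤ k l i l≤i))
        , ≡.trans (at-punchIn i) (≡.cong (punchIn k) eq₁)
        , ≡.trans (at-punchIn l) (≡.cong (punchIn k) eq₂) }) 1

-- Positions are counted from 1, with π₀ = 0, and the word is continued by the letters n+1, n+2, ….
entry : ∀ {n} → Word n → ℕ → ℤ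
entry     π zero    = 0ℤ
entry {n} π (suc i) with i ℕ.<? n
... | yes i<n = value (lookup π (fromℕ< i<n))
... | no  _   = + suc i

entry-letter : ∀ {n} (π : Word n) i → entry π (suc (toℕ i)) ≡ value (lookup π i)
entry-letter {n} π i with toℕ i ℕ.<? n
... | yes i<n = ≡.cong (λ l → value (lookup π l)) (Fin.fromℕ<-toℕ i i<n)
... | no  i≮n = ⊥-elim (i≮n (Fin.toℕ<n i))

entry-padding : ∀ {n} (π : Word n) {i} → n ℕ.≤ i → entry π (suc i) ≡ + suc i
entry-padding {n} π {i} n≤i with i ℕ.<? n
... | yes i<n = ⊥-elim (ℕ.<⇒≱ i<n n≤i)
... | no  _   = ≡.refl

data Index (n : ℕ) : ℕ → Set where
  inside  : (i : Fin n) → Index n (toℕ i)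
  outside : ∀ {i} → n ℕ.≤ i → Index n i

index : ∀ n i → Index n i
index n i with i ℕ.<? n
... | yes i<n = ≡.subst (Index n) (Fin.toℕ-fromℕ< i<n) (inside (fromℕ< i<n))
... | no  i≮n = outside (ℕ.≮⇒≥ i≮n)

module InsertFixedEntries {n : ℕ} (κ : Fin (suc n)) (s : Sign) (π : Word n) where
  open InsertFixed κ s π
  private
    k : ℕ
    k = toℕ κ

    k≤n : k ℕ.≤ n
    k≤n = ℕ.s≤s⁻¹ (Fin.toℕ<n κ)

  entry-punchIn : ∀ i → entry π⁺ (suc (skip k (toℕ i))) ≡ relabel k (entry π (suc (toℕ i)))
  entry-punchIn i = begin
    entry π⁺ (suc (skip k (toℕ i)))         ≡⟨ ≡.cong (entry π⁺ ∘ suc) (toℕ-punchIn κ i) ⟨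
    entry π⁺ (suc (toℕ (punchIn κ i)))      ≡⟨ entry-letter π⁺ (punchIn κ i) ⟩
    value (lookup π⁺ (punchIn κ i))         ≡⟨ ≡.cong value (lookup-punchIn i) ⟩
    value (map₂ (punchIn κ) (lookup π i))   ≡⟨ value-punchIn (lookup π i) ⟩
    relabel k (value (lookup π i))          ≡⟨ ≡.cong (relabel k) (entry-letter π i) ⟨
    relabel k (entry π (suc (toℕ i)))       ∎
    where
    open ≡.≡-Reasoning
    value-punchIn : ∀ l → value (map₂ (punchIn κ) l) ≡ relabel k (value l)
    value-punchIn (s , p) = ≡.trans (≡.cong (λ q → s ◃ suc q) (toℕ-punchIn κ p)) (≡.sym (relabel-◃ k s (toℕ p)))

  entry-left : ∀ i → i ℕ.≤ k → entry π⁺ i ≡ relabel k (entry π i)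
  entry-left zero    _   = ≡.refl
  entry-left (suc i) i<k with index n i
  ... | inside i′    = ≡.trans (≡.cong (entry π⁺ ∘ suc) (≡.sym (skip-< i<k))) (entry-punchIn i′)
  ... | outside n≤i  = ⊥-elim (ℕ.<⇒≱ (ℕ.<-≤-trans i<k k≤n) n≤i)

  entry-hole : entry π⁺ (suc k) ≡ s ◃ suc k
  entry-hole = ≡.trans (entry-letter π⁺ κ) (≡.cong value lookup-hole)

  entry-right : ∀ i → suc k ℕ.≤ i → entry π⁺ (suc i) ≡ relabel k (entry π i)
  entry-right (suc i) (ℕ.s≤s k≤i) with index n i
  ... | inside i′   = ≡.trans (≡.cong (entry π⁺ ∘ suc) (≡.sym (skip-≥ k≤i))) (entry-punchIn i′)
  -- Relabelling raises a padding letter i+1 to i+2, since k ≤ i; this is the padding of the longer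
  -- word one position further on.
  ... | outside n≤i = ≡.trans (entry-padding π⁺ (ℕ.s≤s n≤i)) (≡.sym (≡.trans
    (≡.cong (relabel k) (entry-padding π n≤i)) (≡.cong (λ m → + suc m) (skip-≥ k≤i))))

module DescentProduct {c ℓ : Level} (R : CommutativeRing c ℓ) where
  open CommutativeRing R
  open RawSemiringDefs (RawRing.rawSemiring rawRing) using (_^_)
  open IntegerScalars.Solver R using (solve; _:*_; _:=_)
  open Descents R
  open SetoidReasoning setoid

  -- Writing y = z r separates a factor z for every step from a factor r for every descent. An
  -- arbitrary decision procedure that agrees with `descends` is allowed because the induction moves
  -- both the sequence and the predicate by one position.
  after-count : ∀ {y z r} → y ≈ z * r → ∀ n (c : ℕ → ℤ) {P : Pred (Fin n) 0ℓ} (P? : Decidable P) →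
    (∀ i → does (P? i) ≡ descends (c (toℕ i)) (c (suc (toℕ i)))) →
    after y z c 0 n ≈ z ^ n * r ^ count P? (allFin n)
  after-count {y} {z} {r} y≈zr zero    c P? P≡ = sym (*-identityˡ 1#)
  after-count {y} {z} {r} y≈zr (suc n) c P? P≡ = begin
    step y z (descends (c 0) (c 1)) * after y z c 1 n
      ≡⟨ ≡.cong₂ (λ d p → step y z d * p) (≡.sym (P≡ Fin.zero)) (after-suc y z c 0 n) ⟩
    step y z (does (P? Fin.zero)) * after y z (c ∘ suc) 0 n
      ≈⟨ *-congˡ (after-count y≈zr n (c ∘ suc) (P? ∘ Fin.suc) (P≡ ∘ Fin.suc)) ⟩
    step y z (does (P? Fin.zero)) * (z ^ n * r ^ count (P? ∘ Fin.suc) (allFin n))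
      ≈⟨ first (does (P? Fin.zero)) ⟩
    z ^ suc n * r ^ ((if does (P? Fin.zero) then 1 else 0) ℕ.+ count (P? ∘ Fin.suc) (allFin n))
      ≡⟨ ≡.cong (λ d → z ^ suc n * r ^ d) (≡.sym (count-suc P?)) ⟩
    z ^ suc n * r ^ count P? (allFin (suc n)) ∎
    where
    m : ℕ
    m = count (P? ∘ Fin.suc) (allFin n)
    first : ∀ d → step y z d * (z ^ n * r ^ m) ≈ z ^ suc n * r ^ ((if d then 1 else 0) ℕ.+ m)
    first true  = trans (*-congʳ y≈zr)
      (solve 4 (λ z r p q → z :* r :* (p :* q) := z :* p :* (r :* q)) refl z r (z ^ n) (r ^ m))
    first false = sym (*-assoc z (z ^ n) (r ^ m))

  after-desᴮ : ∀ {y z r} → y ≈ z * r → ∀ {n} (π : Word n) →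
    after y z (entry π) 0 n ≈ z ^ n * r ^ desᴮ π
  after-desᴮ y≈zr {n} π = after-count y≈zr n (entry π)
    (λ i → lookup (extended π) (Fin.suc i) ℤ.<? lookup (extended π) (inject₁ i))
    (λ i → ≡.cong₂ (λ b a → does (b ℤ.<? a)) (at (Fin.suc i))
      (≡.trans (at (inject₁ i)) (≡.cong (entry π) (Fin.toℕ-inject₁ i))))
    where
    at : ∀ i → lookup (extended π) i ≡ entry π (toℕ i)
    at Fin.zero    = ≡.refl
    at (Fin.suc i) = ≡.trans (Vec.lookup-map i value π) (≡.sym (entry-letter π i))

  last-ascent : ∀ {n} (π : Word n) → descends (entry π n) (entry π (suc n)) ≡ false
  last-ascent {n} π = ≡.trans (≡.cong (descends (entry π n)) (entry-padding π ℕ.≤-refl))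
    (descends-false (ℤ.<⇒≤ (bound n ℕ.≤-refl)))
    where
    value-bound : ∀ (l : Letter n) → value l ℤ.< + suc n
    value-bound (Sign.- , p) = ℤ.-<+
    value-bound (Sign.+ , p) = ℤ.+<+ (ℕ.s≤s (Fin.toℕ<n p))
    bound : ∀ i → i ℕ.≤ n → entry π i ℤ.< + suc n
    bound zero    _   = ℤ.+<+ (ℕ.s≤s ℕ.z≤n)
    bound (suc i) i<n with index n i
    ... | inside i′   = ≡.subst (ℤ._< + suc n) (≡.sym (entry-letter π i′)) (value-bound (lookup π i′))
    ... | outside n≤i = ⊥-elim (ℕ.<⇒≱ i<n n≤i)

  before-desᴮ : ∀ {y z r} → y ≈ z * r → ∀ {n} (π : Word n) →
    before y z (entry π) (suc n) ≈ z ^ n * r ^ desᴮ π * z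
  before-desᴮ {y} {z} y≈zr {n} π = *-cong
    (trans (trans (before-after y z (entry π) 0 n) (*-identityˡ _)) (after-desᴮ y≈zr π))
    (reflexive (≡.cong (step y z) (last-ascent π)))

-- Sums over involutions without fixed points at the first positions

Admissible : ℕ → ℕ → ℕ → ∀ {n} → Word n → Set
Admissible j f k π = (IsInvolution π × cyc₂ π ≡ j × fixᴮ π ≡ f) × (∀ i → toℕ i ℕ.< k → ∣ π ∣at i ≢ i)

admissible? : ∀ j f k {n} → Decidable (Admissible j f k {n})
admissible? j f k π = (isInvolution? π ×-dec cyc₂ π ℕ.≟ j ×-dec fixᴮ π ℕ.≟ f)
  ×-dec Fin.all? (λ i → (toℕ i ℕ.<? k) →-dec ¬? (∣ π ∣at i Fin.≟ i))

module _ {j f n : ℕ} (κ : Fin (suc n)) (s : Sign) (π : Word n) where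
  open InsertFixed κ s π
  open InsertFixedInvolution κ s π
  open InsertFixedStatistics κ s π

  admissible-insert : Admissible j f (toℕ κ) π → Admissible j (suc f) (toℕ κ) (insertFixed κ s π)
  admissible-insert ((inv , cyc , fix) , moved) =
    (isInvolution-insert inv , ≡.trans cyc₂-insert cyc , ≡.trans fixᴮ-insert (≡.cong suc fix)) , moved⁺
    where
    moved⁺ : ∀ i → toℕ i ℕ.< toℕ κ → ∣ π⁺ ∣at i ≢ i
    moved⁺ i i<k eq with punchView κ i
    ... | isHole     = ℕ.<-irrefl ≡.refl i<k
    ... | punched i′ = moved i′ (ℕ.≰⇒> λ k≤i′ → ℕ.<⇒≱ i<k
        (≡.subst (toℕ κ ℕ.≤_) (≡.sym (≡.trans (toℕ-punchIn κ i′) (skip-≥ k≤i′))) (ℕ.m≤n⇒m≤1+n k≤i′)))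
      (Fin.punchIn-injective κ _ _ (≡.trans (≡.sym (at-punchIn i′)) eq))

  admissible-delete : Admissible j (suc f) (toℕ κ) (insertFixed κ s π) → Admissible j f (toℕ κ) π
  admissible-delete ((inv , cyc , fix) , moved) =
    (isInvolution-delete inv , ≡.trans (≡.sym cyc₂-insert) cyc , ℕ.suc-injective (≡.trans (≡.sym fixᴮ-insert) fix)) ,
    λ i i<k eq → moved (punchIn κ i) (≡.subst (ℕ._< toℕ κ) (≡.sym (≡.trans (toℕ-punchIn κ i) (skip-< i<k))) i<k)
      (≡.trans (at-punchIn i) (≡.cong (punchIn κ) eq))

module WordSums {c ℓ : Level} (M : CommutativeMonoid c ℓ) where
  open CommutativeMonoid M
    renaming (_∙_ to _+_; ε to 0#; ∙-cong to +-cong; ∙-congˡ to +-congˡ; ∙-congʳ to +-congʳ;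
              assoc to +-assoc; comm to +-comm; identityˡ to +-identityˡ; identityʳ to +-identityʳ)
  open Sums M
  open SetoidReasoning setoid

  -- A word that contributes has one of the letters ±κ at position κ, and injectivity keeps both of
  -- them away from every other position. So the sum loses the coordinate κ up to a sign, and the
  -- alphabet of the remaining coordinates loses ±κ.
  ∑-allWords-fixed : ∀ {n} (κ : Fin (suc n)) (g : Word (suc n) → Carrier) →
    (∀ π → ∣ π ∣at κ ≢ κ → g π ≈ 0#) → (∀ π → ¬ IsSignedPermutation π → g π ≈ 0#) →
    ∑ (allWords (suc n)) g ≈ ∑ (allWords n) (λ π → g (insertFixed κ Sign.- π) + g (insertFixed κ Sign.+ π))
  ∑-allWords-fixed {n} κ g g-moved g-collision = begin
    ∑ (allWords (suc n)) g
      ≈⟨ ∑-vectors-insertAt as κ g ⟩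
    ∑ as h
      ≈⟨ ∑-cartesianProductWith _,_ signs (allFin (suc n)) h ⟩
    ∑ signs (λ s → ∑ (allFin (suc n)) (λ p → h (s , p)))
      ≈⟨ ∑-cong signs (λ s → trans (∑-punchIn κ (λ p → h (s , p)))
           (trans (+-congˡ (∑-zero (allFin n) (other s))) (+-identityʳ _))) ⟩
    ∑ signs (λ s → h (s , κ))
      ≈⟨ ∑-cong signs (λ s → ∑-vectors-punchIn κ n (λ w → g (insertAt w κ (s , κ))) (collision s)) ⟩
    ∑ signs (λ s → ∑ (allWords n) (g ∘ insertFixed κ s))
      ≈⟨ +-congˡ (+-identityʳ _) ⟩
    ∑ (allWords n) (g ∘ insertFixed κ Sign.-) + ∑ (allWords n) (g ∘ insertFixed κ Sign.+)
      ≈⟨ ∑-+ (allWords n) (g ∘ insertFixed κ Sign.-) (g ∘ insertFixed κ Sign.+) ⟨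
    ∑ (allWords n) (λ π → g (insertFixed κ Sign.- π) + g (insertFixed κ Sign.+ π)) ∎
    where
    as : List (Letter (suc n))
    as = cartesianProduct signs (allFin (suc n))
    h : Letter (suc n) → Carrier
    h a = ∑ (vectors as n) (λ w → g (insertAt w κ a))
    other : ∀ s p → h (s , punchIn κ p) ≈ 0#
    other s p = ∑-zero (vectors as n) λ w → g-moved _ λ eq →
      Fin.punchInᵢ≢i κ p (≡.trans (≡.sym (≡.cong proj₂ (Vec.insertAt-lookup w κ (s , punchIn κ p)))) eq)
    collision : ∀ s w i → proj₂ (lookup w i) ≡ κ → g (insertAt w κ (s , κ)) ≈ 0#
    collision s w i eq = g-collision _ λ inj → Fin.punchInᵢ≢i κ i (inj (punchIn κ i) κ
      (≡.trans (≡.cong proj₂ (Vec.insertAt-punchIn w κ (s , κ) i))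
        (≡.trans eq (≡.sym (≡.cong proj₂ (Vec.insertAt-lookup w κ (s , κ)))))))

  admissibleSum : ∀ n → ℕ → ℕ → ℕ → (Word n → Carrier) → Carrier
  admissibleSum n j f k w = ∑ (allWords n) λ π → when (admissible? j f k π) (w π)

  admissibleSum-cong : ∀ {n} j f k {w w′ : Word n → Carrier} →
    (∀ π → Admissible j f k π → w π ≈ w′ π) → admissibleSum n j f k w ≈ admissibleSum n j f k w′
  admissibleSum-cong {n} j f k w≈ = ∑-cong (allWords n) λ π → when-cong (admissible? j f k π) (w≈ π)

  admissibleSum-+ : ∀ {n} j f k (w w′ : Word n → Carrier) →
    admissibleSum n j f k (λ π → w π + w′ π) ≈ admissibleSum n j f k w + admissibleSum n j f k w′
  admissibleSum-+ {n} j f k w w′ = trans (∑-cong (allWords n) (λ π → when-+ (admissible? j f k π) (w π) (w′ π)))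
    (∑-+ (allWords n) _ _)

  admissibleSum-⇔ : ∀ {n} j f k k′ (w : Word n → Carrier) →
    (∀ π → Admissible j f k π → Admissible j f k′ π) → (∀ π → Admissible j f k′ π → Admissible j f k π) →
    admissibleSum n j f k w ≈ admissibleSum n j f k′ w
  admissibleSum-⇔ {n} j f k k′ w to from = ∑-cong (allWords n) λ π →
    reflexive (when-⇔ (admissible? j f k π) (admissible? j f k′ π) (to π) (from π) (w π))

  admissible-weaken : ∀ {j f k n} {π : Word n} → Admissible j f (suc k) π → Admissible j f k π
  admissible-weaken (adm , moved) = adm , λ i i<k → moved i (ℕ.m≤n⇒m≤1+n i<k)

  -- The second summand is the contribution of the words with a fixed point at κ.
  admissibleSum-suc : ∀ {n} j f (κ : Fin (suc n)) (w : Word (suc n) → Carrier) →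
    admissibleSum (suc n) j (suc f) (toℕ κ) w ≈ admissibleSum (suc n) j (suc f) (suc (toℕ κ)) w
      + admissibleSum n j f (toℕ κ) (λ π → w (insertFixed κ Sign.- π) + w (insertFixed κ Sign.+ π))
  admissibleSum-suc {n} j f κ w = begin
    ∑ (allWords (suc n)) (λ π → when (adm? π) (w π))
      ≈⟨ ∑-cong (allWords (suc n)) (λ π → when-split (adm? π) (fixed? π) (adm⁺? π)
           (λ adm ¬fixed → proj₁ adm , strengthen π adm ¬fixed) proj₁ admissible-weaken
           (λ adm (_ , eq) → proj₂ adm κ ℕ.≤-refl eq) (w π)) ⟩
    ∑ (allWords (suc n)) (λ π → when (adm⁺? π) (w π) + when (fixed? π) (w π))
      ≈⟨ ∑-+ (allWords (suc n)) _ _ ⟩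
    admissibleSum (suc n) j (suc f) (suc (toℕ κ)) w + ∑ (allWords (suc n)) (λ π → when (fixed? π) (w π))
      ≈⟨ +-congˡ (∑-allWords-fixed κ (λ π → when (fixed? π) (w π))
           (λ π moved → reflexive (when-false (fixed? π) (λ (_ , eq) → moved eq) (w π)))
           (λ π ¬perm → reflexive (when-false (fixed? π) (λ ((((perm , _) , _) , _) , _) → ¬perm perm) (w π)))) ⟩
    admissibleSum (suc n) j (suc f) (suc (toℕ κ)) w
      + ∑ (allWords n) (λ π → when (fixed? (insertFixed κ Sign.- π)) (w (insertFixed κ Sign.- π))
                            + when (fixed? (insertFixed κ Sign.+ π)) (w (insertFixed κ Sign.+ π)))
      ≈⟨ +-congˡ (∑-cong (allWords n) (λ π → trans (+-cong (inserted Sign.- π) (inserted Sign.+ π))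
           (sym (when-+ (admissible? j f (toℕ κ) π) _ _)))) ⟩
    admissibleSum (suc n) j (suc f) (suc (toℕ κ)) w
      + admissibleSum n j f (toℕ κ) (λ π → w (insertFixed κ Sign.- π) + w (insertFixed κ Sign.+ π)) ∎
    where
    adm? : Decidable (Admissible j (suc f) (toℕ κ) {suc n})
    adm? = admissible? j (suc f) (toℕ κ)
    adm⁺? : Decidable (Admissible j (suc f) (suc (toℕ κ)) {suc n})
    adm⁺? = admissible? j (suc f) (suc (toℕ κ))
    fixed? : ∀ π → Dec (Admissible j (suc f) (toℕ κ) π × ∣ π ∣at κ ≡ κ)
    fixed? π = adm? π ×-dec ∣ π ∣at κ Fin.≟ κ
    strengthen : ∀ π → Admissible j (suc f) (toℕ κ) π → ¬ (Admissible j (suc f) (toℕ κ) π × ∣ π ∣at κ ≡ κ) →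
                 ∀ i → toℕ i ℕ.< suc (toℕ κ) → ∣ π ∣at i ≢ i
    strengthen π adm ¬fixed i (ℕ.s≤s i≤k) with ℕ.m≤n⇒m<n∨m≡n i≤k
    ... | inj₁ i<k = proj₂ adm i i<k
    ... | inj₂ i≡k with Fin.toℕ-injective i≡k
    ...   | ≡.refl = λ eq → ¬fixed (adm , eq)
    inserted : ∀ s π → when (fixed? (insertFixed κ s π)) (w (insertFixed κ s π))
                     ≈ when (admissible? j f (toℕ κ) π) (w (insertFixed κ s π))
    inserted s π = reflexive (when-⇔ (fixed? (insertFixed κ s π)) (admissible? j f (toℕ κ) π)
      (λ (adm , _) → admissible-delete κ s π adm)
      (λ adm → admissible-insert κ s π adm , InsertFixed.at-hole κ s π) _)

-- Eliminating the fixed points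

count-bound : ∀ n k {P : Pred (Fin n) 0ℓ} (P? : Decidable P) → (∀ i → P i → k ℕ.≤ toℕ i) →
              count P? (allFin n) ℕ.≤ n ∸ k
count-bound zero    k       P? P⇒≤ = ℕ.z≤n
count-bound (suc n) zero    P? P⇒≤ rewrite count-suc P? =
  ℕ.+-mono-≤ (at-most-one (P? Fin.zero)) (count-bound n zero (P? ∘ Fin.suc) (λ _ _ → ℕ.z≤n))
  where
  at-most-one : {Q : Set} (Q? : Dec Q) → ℕ-Sums.when Q? 1 ℕ.≤ 1
  at-most-one (yes _) = ℕ.≤-refl
  at-most-one (no _)  = ℕ.z≤n
count-bound (suc n) (suc k) P? P⇒≤ rewrite count-suc P?
  | ℕ-Sums.when-false (P? Fin.zero) (λ p → ℕ.n≮0 (P⇒≤ Fin.zero p)) 1 =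
  count-bound n k (P? ∘ Fin.suc) (λ i p → ℕ.s≤s⁻¹ (P⇒≤ (Fin.suc i) p))

fixᴮ≡0⇒moved : ∀ {n} (π : Word n) → fixᴮ π ≡ 0 → ∀ i → ∣ π ∣at i ≢ i
fixᴮ≡0⇒moved {suc n} π fix≡0 i eq = ℕ.0≢1+n (≡.trans (≡.sym fix≡0)
  (≡.trans (count-∑ (λ i → ∣ π ∣at i Fin.≟ i) (allFin (suc n)))
  (≡.trans (ℕ-Sums.∑-punchIn i _) (≡.cong (ℕ._+ ℕ-Sums.∑ (allFin n) (λ l → ℕ-Sums.when (∣ π ∣at (punchIn i l) Fin.≟ punchIn i l) 1)) (ℕ-Sums.when-true (∣ π ∣at i Fin.≟ i) eq 1)))))

admissible-strengthen : ∀ {j k k′ n} {π : Word n} → Admissible j 0 k π → Admissible j 0 k′ π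
admissible-strengthen {π = π} (adm@(_ , _ , fix≡0) , _) = adm , λ i _ → fixᴮ≡0⇒moved π fix≡0 i

-- Once the first k positions are not fixed, only n ∸ k positions are left for the fixed points, one
-- too few.
¬admissible : ∀ {j f n k} {π : Word n} → n ∸ k ≡ f → ¬ Admissible j (suc f) k π
¬admissible {f = f} {n} {k} {π} n∸k≡f ((_ , _ , fix) , moved) = ℕ.1+n≰n (ℕ.≤-trans (ℕ.≤-reflexive (≡.sym fix))
  (ℕ.≤-trans (count-bound n k (λ i → ∣ π ∣at i Fin.≟ i) (λ i eq → ℕ.≮⇒≥ (λ i<k → moved i i<k eq)))
    (ℕ.≤-reflexive n∸k≡f)))

module Deletion {c ℓ : Level} (R : CommutativeRing c ℓ) (t u v Y Z : CommutativeRing.Carrier R) where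
  open CommutativeRing R
  open RawSemiringDefs (RawRing.rawSemiring rawRing) using (_^_)
  open IntegerScalars.Solver R using (solve; _:+_; _:*_; :1; _:=_)
  open Potential R t u v Y Z
  open Descents R
  open DescentProduct R
  open Sums +-commutativeMonoid
  open WordSums +-commutativeMonoid
  open Exp semiring using (^-congʳ)
  open GroupProperties +-group using () renaming (∙-cancelʳ to +-cancelʳ)
  open SetoidReasoning setoid

  descentSum : ∀ n → ℕ → ℕ → Carrier → Carrier
  descentSum n j f r = ∑ (filter (λ π → isInvolution? π ×-dec cyc₂ π ℕ.≟ j ×-dec fixᴮ π ℕ.≟ f) (allWords n))
    (λ π → r ^ desᴮ π)

  ∑-* : {A : Set} (r : Carrier) (xs : List A) (g : A → Carrier) → ∑ xs (λ x → r * g x) ≈ r * ∑ xs g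
  ∑-* r []       g = sym (zeroʳ r)
  ∑-* r (x ∷ xs) g = trans (+-congˡ (∑-* r xs g)) (sym (distribˡ r (g x) (∑ xs g)))

  when-* : {P : Set} (P? : Dec P) → ∀ r x → when P? (r * x) ≈ r * when P? x
  when-* (yes _) r x = refl
  when-* (no _)  r x = sym (zeroʳ r)

  admissibleSum-* : ∀ {n} j f k r (w : Word n → Carrier) →
    admissibleSum n j f k (λ π → r * w π) ≈ r * admissibleSum n j f k w
  admissibleSum-* {n} j f k r w = trans (∑-cong (allWords n) (λ π → when-* (admissible? j f k π) r (w π)))
    (∑-* r (allWords n) _)

  admissibleSum-descents : ∀ {n} j f k (r s : Carrier) →
    (∀ π → IsInvolution {n} π × cyc₂ π ≡ j × fixᴮ π ≡ f → Admissible j f k π) →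
    admissibleSum n j f k (λ π → s * r ^ desᴮ π) ≈ s * descentSum n j f r
  admissibleSum-descents {n} j f k r s adm = begin
    admissibleSum n j f k (λ π → s * r ^ desᴮ π)
      ≈⟨ admissibleSum-* {n} j f k s (λ π → r ^ desᴮ π) ⟩
    s * admissibleSum n j f k (λ π → r ^ desᴮ π)
      ≈⟨ *-congˡ (trans (∑-filter (λ π → isInvolution? π ×-dec cyc₂ π ℕ.≟ j ×-dec fixᴮ π ℕ.≟ f) (allWords n) _)
           (∑-cong (allWords n) (λ π → reflexive (when-⇔ (isInvolution? π ×-dec cyc₂ π ℕ.≟ j ×-dec fixᴮ π ℕ.≟ f)
             (admissible? j f k π) (adm π) proj₁ (r ^ desᴮ π))))) ⟨
    s * descentSum n j f r ∎

  -- The steps run to position n+1, one beyond the word. The padding letter found there exceeds all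
  -- others, so the extra step is an ascent, and the slot behind the last letter has a right
  -- neighbour like any other slot.
  V : ℕ → ∀ n → Word n → Carrier
  V k n π = potential k (suc n ∸ k) (entry π)

  inserted : ∀ {n} → Fin (suc n) → Word n → Carrier
  inserted {n} κ π = V (suc (toℕ κ)) (suc n) (insertFixed κ Sign.- π) + V (suc (toℕ κ)) (suc n) (insertFixed κ Sign.+ π)

  module _ (v≈ : v ≈ 1# + - ((1# + t) * u)) (Y≈ : Y ≈ t * (1# + u * (1# + - t))) (Z≈ : Z ≈ 1# + - (u * (1# + - t))) where

    -- This is what the absence of fixed points at the first positions is for: the entry before slot
    -- k is not ±k, so `boundary`, which compares it with ±k, agrees with the comparison with ±(k+1)
    -- that `potential-insert` requires.
    boundary-moved : ∀ {n} (κ : Fin (suc n)) (π : Word n) → (∀ i → toℕ i ℕ.< toℕ κ → ∣ π ∣at i ≢ i) →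
      boundary (toℕ κ) (entry π (toℕ κ)) ≡ weight (side (toℕ κ) (entry π (toℕ κ)))
    boundary-moved {n} κ π moved = go (toℕ κ) (ℕ.s≤s⁻¹ (Fin.toℕ<n κ)) moved
      where
      go : ∀ k → k ℕ.≤ n → (∀ i → toℕ i ℕ.< k → ∣ π ∣at i ≢ i) →
           boundary k (entry π k) ≡ weight (side k (entry π k))
      go zero    _   _     = ≡.refl
      go (suc k) k<n moved with index n k
      ... | outside n≤k = ⊥-elim (ℕ.<⇒≱ k<n n≤k)
      ... | inside i rewrite entry-letter π i = ≡.cong weight (≡.sym (side-suc (toℕ i) (value (lookup π i))
          (λ eq → moved i ℕ.≤-refl (letter (lookup π i) (inj₁ eq)))
          (λ eq → moved i ℕ.≤-refl (letter (lookup π i) (inj₂ eq)))))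
        where
        letter : ∀ l → value l ≡ + suc (toℕ i) ⊎ value l ≡ -[1+ toℕ i ] → proj₂ l ≡ i
        letter (Sign.- , p) (inj₂ eq) = Fin.toℕ-injective (ℤ.-[1+-injective eq)
        letter (Sign.+ , p) (inj₁ eq) = Fin.toℕ-injective (ℕ.suc-injective (ℤ.+-injective eq))

    V-insert : ∀ {n} (κ : Fin (suc n)) (π : Word n) → (∀ i → toℕ i ℕ.< toℕ κ → ∣ π ∣at i ≢ i) →
      V (suc (toℕ κ)) n π ≈ v * V (toℕ κ) n π + u * inserted κ π
    -- The slot is at most n, so suc n ∸ k is suc (n ∸ k): there is a step from position k to k+1,
    -- possibly into the padding, at which a letter can be inserted.
    V-insert {n} κ π moved rewrite ℕ.+-∸-assoc 1 (ℕ.s≤s⁻¹ (Fin.toℕ<n κ)) =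
      potential-insert v≈ Y≈ Z≈ (toℕ κ) (n ∸ toℕ κ) (entry π)
        (entry (insertFixed κ Sign.- π)) (entry (insertFixed κ Sign.+ π)) (boundary-moved κ π moved)
        (E⁻.entry-left) (E⁺.entry-left) E⁻.entry-hole E⁺.entry-hole E⁻.entry-right E⁺.entry-right
      where
      module E⁻ = InsertFixedEntries κ Sign.- π
      module E⁺ = InsertFixedEntries κ Sign.+ π

    module _ (j : ℕ)
      -- Stands for the sum of a_f times u to the power f. Linearity and the splitting off of the
      -- summand f = 0 are all that the elimination asks of it.
      (gsum : (ℕ → Carrier) → Carrier)
      (gsum-cong : ∀ {a b} → (∀ f → a f ≈ b f) → gsum a ≈ gsum b)
      (gsum-+ : ∀ a b → gsum (λ f → a f + b f) ≈ gsum a + gsum b)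
      (gsum-* : ∀ r a → gsum (λ f → r * a f) ≈ r * gsum a)
      (gsum-suc : ∀ a → gsum a ≈ a 0 + u * gsum (λ f → a (suc f)))
      where

      total : ℕ → ℕ → Carrier
      total k f = admissibleSum (2 ℕ.* j ℕ.+ f) j f k (V k (2 ℕ.* j ℕ.+ f))

      gsum-0 : gsum (λ _ → 0#) ≈ 0#
      gsum-0 = trans (gsum-cong (λ _ → sym (zeroˡ 0#))) (trans (gsum-* 0# (λ _ → 0#)) (zeroˡ _))

      -- The sum `gsum old` of the next potential over the present words is computed in two ways.
      -- Separating the words with a fixed point at slot k gives `gsum (total (suc k))` plus u times
      -- the inserted words; applying `V-insert` to each word gives v times `gsum (total k)` plus
      -- the same inserted words. These cancel. The bound k ≤ 2j provides the slot for every f.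
      total-step : ∀ k → k ℕ.≤ 2 ℕ.* j → gsum (total (suc k)) ≈ v * gsum (total k)
      total-step k k≤2j = +-cancelʳ (u * gsum new) _ _ (begin
        gsum (total (suc k)) + u * gsum new
          ≈⟨ +-congʳ (gsum-suc (total (suc k))) ⟩
        total (suc k) 0 + u * gsum (λ f → total (suc k) (suc f)) + u * gsum new
          ≈⟨ solve 4 (λ a u x y → a :+ u :* x :+ u :* y := a :+ u :* (x :+ y)) refl _ u _ _ ⟩
        total (suc k) 0 + u * (gsum (λ f → total (suc k) (suc f)) + gsum new)
          ≈⟨ +-congˡ (*-congˡ (gsum-+ _ new)) ⟨
        total (suc k) 0 + u * gsum (λ f → total (suc k) (suc f) + new f)
          -- For f = 0 no position is fixed, so the conditions at k and at k+1 select the same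
          -- words.
          ≈⟨ +-cong (admissibleSum-⇔ {2 ℕ.* j ℕ.+ 0} j 0 (suc k) k (V (suc k) (2 ℕ.* j ℕ.+ 0))
               (λ _ → admissible-strengthen) (λ _ → admissible-strengthen))
               (*-congˡ (gsum-cong (λ f → sym (old-suc f)))) ⟩
        old 0 + u * gsum (λ f → old (suc f))
          ≈⟨ gsum-suc old ⟨
        gsum old
          ≈⟨ gsum-cong old-insert ⟩
        gsum (λ f → v * total k f + u * new f)
          ≈⟨ trans (gsum-+ _ _) (+-cong (gsum-* v (total k)) (gsum-* u new)) ⟩
        v * gsum (total k) + u * gsum new ∎)
        where
        slot : ∀ f → Fin (suc (2 ℕ.* j ℕ.+ f))
        slot f = fromℕ< (ℕ.s≤s (ℕ.≤-trans k≤2j (ℕ.m≤m+n (2 ℕ.* j) f)))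
        toℕ-slot : ∀ f → toℕ (slot f) ≡ k
        toℕ-slot f = Fin.toℕ-fromℕ< _
        old new : ℕ → Carrier
        old f = admissibleSum (2 ℕ.* j ℕ.+ f) j f k (V (suc k) (2 ℕ.* j ℕ.+ f))
        new f = admissibleSum (2 ℕ.* j ℕ.+ f) j f k (inserted (slot f))

        suc-case : ∀ n f (κ : Fin (suc n)) {k} → toℕ κ ≡ k →
          admissibleSum (suc n) j (suc f) k (V (suc k) (suc n))
            ≈ admissibleSum (suc n) j (suc f) (suc k) (V (suc k) (suc n)) + admissibleSum n j f k (inserted κ)
        suc-case n f κ ≡.refl = admissibleSum-suc j f κ (V (suc (toℕ κ)) (suc n))

        old-suc : ∀ f → old (suc f) ≈ total (suc k) (suc f) + new f
        old-suc f = begin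
          old (suc f)
            ≡⟨ ≡.cong (λ n → admissibleSum n j (suc f) k (V (suc k) n)) (ℕ.+-suc (2 ℕ.* j) f) ⟩
          admissibleSum (suc (2 ℕ.* j ℕ.+ f)) j (suc f) k (V (suc k) (suc (2 ℕ.* j ℕ.+ f)))
            ≈⟨ suc-case (2 ℕ.* j ℕ.+ f) f (slot f) (toℕ-slot f) ⟩
          admissibleSum (suc (2 ℕ.* j ℕ.+ f)) j (suc f) (suc k) (V (suc k) (suc (2 ℕ.* j ℕ.+ f))) + new f
            ≡⟨ ≡.cong (λ n → admissibleSum n j (suc f) (suc k) (V (suc k) n) + new f) (ℕ.+-suc (2 ℕ.* j) f) ⟨
          total (suc k) (suc f) + new f ∎

        insert-case : ∀ n f (κ : Fin (suc n)) {k} → toℕ κ ≡ k →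
          admissibleSum n j f k (V (suc k) n)
            ≈ v * admissibleSum n j f k (V k n) + u * admissibleSum n j f k (inserted κ)
        insert-case n f κ ≡.refl = begin
          admissibleSum n j f (toℕ κ) (V (suc (toℕ κ)) n)
            ≈⟨ admissibleSum-cong {n} j f (toℕ κ) (λ π adm → V-insert κ π (proj₂ adm)) ⟩
          admissibleSum n j f (toℕ κ) (λ π → v * V (toℕ κ) n π + u * inserted κ π)
            ≈⟨ admissibleSum-+ {n} j f (toℕ κ) _ _ ⟩
          admissibleSum n j f (toℕ κ) (λ π → v * V (toℕ κ) n π) + admissibleSum n j f (toℕ κ) (λ π → u * inserted κ π)
            ≈⟨ +-cong (admissibleSum-* {n} j f (toℕ κ) v (V (toℕ κ) n)) (admissibleSum-* {n} j f (toℕ κ) u (inserted κ)) ⟩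
          v * admissibleSum n j f (toℕ κ) (V (toℕ κ) n) + u * admissibleSum n j f (toℕ κ) (inserted κ) ∎

        old-insert : ∀ f → old f ≈ v * total k f + u * new f
        old-insert f = insert-case (2 ℕ.* j ℕ.+ f) f (slot f) (toℕ-slot f)

      total-power : ∀ k → k ℕ.≤ suc (2 ℕ.* j) → gsum (total k) ≈ v ^ k * gsum (total 0)
      total-power zero    _     = sym (*-identityˡ _)
      total-power (suc k) k<2j  = trans (total-step k (ℕ.s≤s⁻¹ k<2j))
        (trans (*-congˡ (total-power k (ℕ.<⇒≤ k<2j))) (sym (*-assoc _ _ _)))

      total-0 : ∀ f → total 0 f ≈ weight mid * descentSum (2 ℕ.* j ℕ.+ f) j f t
      total-0 f = trans (admissibleSum-cong {n} j f 0 (λ π _ → begin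
          1# * weight mid * after t 1# (entry π) 0 (suc n)
            -- With y = t and z = 1 the final step into the padding, an ascent, contributes the
            -- factor 1.
            ≈⟨ *-cong (*-identityˡ _) (trans (trans (sym (*-identityˡ _)) (sym (before-after t 1# (entry π) 0 (suc n))))
                 (before-desᴮ {t} {1#} {t} (sym (*-identityˡ t)) π)) ⟩
          weight mid * (1# ^ n * t ^ desᴮ π * 1#)
            ≈⟨ *-congˡ (trans (*-identityʳ _) (trans (*-congʳ (1^ n)) (*-identityˡ _))) ⟩
          weight mid * t ^ desᴮ π ∎))
        (admissibleSum-descents {n} j f 0 t (weight mid) (λ π p → p , λ _ ()))
        where
        n : ℕ
        n = 2 ℕ.* j ℕ.+ f
        open Units R using (1^)

      -- The boundary entry is now the padding letter n+1, which is `high` and has weight 1+α, and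
      -- the ascent into it contributes Z = 1-α. Together they restore `weight mid`, the boundary
      -- value at slot 0.
      V-end : ∀ {r} → Y ≈ Z * r → ∀ n k → k ≡ n → (π : Word n) →
        V (suc k) n π ≈ weight mid * Z ^ n * r ^ desᴮ π
      V-end {r} Y≈Zr n .n ≡.refl π = begin
        V (suc n) n π
          ≡⟨ ≡.cong₂ (λ s m → before Y Z (entry π) (suc n) * weight s * after t 1# (entry π) (suc n) m)
               (≡.trans (≡.cong (side n) (entry-padding π (ℕ.≤-refl {n})))
                 (located-unique (locate n (+ suc n)) (isHigh ℤ.≤-refl))) (ℕ.n∸n≡0 n) ⟩
        before Y Z (entry π) (suc n) * (1# + α) * 1#
          ≈⟨ *-congʳ (*-congʳ (trans (before-desᴮ Y≈Zr π) (*-congˡ Z≈))) ⟩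
        Z ^ n * r ^ desᴮ π * (1# + - α) * (1# + α) * 1#
          ≈⟨ solve 4 (λ p q a b → p :* q :* a :* b :* :1 := b :* a :* p :* q) refl (Z ^ n) (r ^ desᴮ π) (1# + - α) (1# + α) ⟩
        weight mid * Z ^ n * r ^ desᴮ π ∎

      total-end : ∀ {r} → Y ≈ Z * r →
        gsum (total (suc (2 ℕ.* j))) ≈ weight mid * (Z ^ (2 ℕ.* j) * descentSum (2 ℕ.* j ℕ.+ 0) j 0 r)
      total-end {r} Y≈Zr = begin
        gsum (total (suc (2 ℕ.* j)))
          ≈⟨ gsum-suc (total (suc (2 ℕ.* j))) ⟩
        total (suc (2 ℕ.* j)) 0 + u * gsum (λ f → total (suc (2 ℕ.* j)) (suc f))
          ≈⟨ +-congˡ (trans (*-congˡ (trans (gsum-cong vanish) gsum-0)) (zeroʳ u)) ⟩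
        total (suc (2 ℕ.* j)) 0 + 0#
          ≈⟨ +-identityʳ _ ⟩
        total (suc (2 ℕ.* j)) 0
          ≈⟨ admissibleSum-cong {N} j 0 (suc (2 ℕ.* j))
               (λ π _ → V-end Y≈Zr N (2 ℕ.* j) (≡.sym (ℕ.+-identityʳ (2 ℕ.* j))) π) ⟩
        admissibleSum N j 0 (suc (2 ℕ.* j)) (λ π → weight mid * Z ^ N * r ^ desᴮ π)
          ≈⟨ admissibleSum-descents {N} j 0 (suc (2 ℕ.* j)) r (weight mid * Z ^ N)
               (λ π p → p , λ i _ → fixᴮ≡0⇒moved π (proj₂ (proj₂ p)) i) ⟩
        weight mid * Z ^ N * descentSum N j 0 r
          ≈⟨ trans (*-assoc _ _ _) (*-congˡ (*-congʳ (^-congʳ Z (ℕ.+-identityʳ (2 ℕ.* j))))) ⟩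
        weight mid * (Z ^ (2 ℕ.* j) * descentSum N j 0 r) ∎
        where
        N : ℕ
        N = 2 ℕ.* j ℕ.+ 0
        vanish : ∀ f → total (suc (2 ℕ.* j)) (suc f) ≈ 0#
        vanish f = ∑-zero (allWords (2 ℕ.* j ℕ.+ suc f)) λ π →
          reflexive (when-false (admissible? j (suc f) (suc (2 ℕ.* j)) π) (¬admissible (≡.trans
            (≡.cong (_∸ suc (2 ℕ.* j)) (ℕ.+-suc (2 ℕ.* j) f)) (ℕ.m+n∸m≡n (2 ℕ.* j) f))) _)

      -- The sums at slot 0 and past the last slot carry the same normalisation `weight mid`; it
      -- cancels because it is a unit, and the powers of v record the 2j+1 slots in between.
      deletion : ∀ {r m⁻¹} → Y ≈ Z * r → weight mid * m⁻¹ ≈ 1# →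
        v ^ suc (2 ℕ.* j) * gsum (λ f → descentSum (2 ℕ.* j ℕ.+ f) j f t)
          ≈ Z ^ (2 ℕ.* j) * descentSum (2 ℕ.* j ℕ.+ 0) j 0 r
      deletion {r} Y≈Zr m-unit = Units.cancel-unit R m-unit (begin
        weight mid * (v ^ suc (2 ℕ.* j) * gsum (λ f → descentSum (2 ℕ.* j ℕ.+ f) j f t))
          ≈⟨ solve 3 (λ m p q → m :* (p :* q) := p :* (m :* q)) refl (weight mid) (v ^ suc (2 ℕ.* j)) _ ⟩
        v ^ suc (2 ℕ.* j) * (weight mid * gsum (λ f → descentSum (2 ℕ.* j ℕ.+ f) j f t))
          ≈⟨ *-congˡ (trans (gsum-cong total-0) (gsum-* (weight mid) _)) ⟨
        v ^ suc (2 ℕ.* j) * gsum (total 0)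
          ≈⟨ total-power (suc (2 ℕ.* j)) ℕ.≤-refl ⟨
        gsum (total (suc (2 ℕ.* j)))
          ≈⟨ total-end Y≈Zr ⟩
        weight mid * (Z ^ (2 ℕ.* j) * descentSum (2 ℕ.* j ℕ.+ 0) j 0 r) ∎)

-- Summation over the number of fixed points

module DiagonalSum {c ℓ : Level} (K : CommutativeRing c ℓ) where
  private
    module K = CommutativeRing K
  open CommutativeRing (SeriesRing.commutativeRing K)
    hiding (refl; sym; trans; reflexive; zero) renaming (_+_ to _⊕_; _*_ to _⊗_)
  open K using () renaming (_+_ to _⊞_)
  open CommutativeSemigroupProperties K.+-commutativeSemigroup using (interchange)

  -- The series Σ_f a_f u^f, whose coefficients a_f are themselves series in u.
  gsum : (ℕ → Carrier) → Carrier
  gsum a zero    = a 0 zero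
  gsum a (suc k) = a 0 (suc k) ⊞ gsum (λ f → a (suc f)) k

  gsum-cong : ∀ {a b} → (∀ f → a f ≈ b f) → gsum a ≈ gsum b
  gsum-cong a≈b zero    = a≈b 0 zero
  gsum-cong a≈b (suc k) = K.+-cong (a≈b 0 (suc k)) (gsum-cong (λ f → a≈b (suc f)) k)

  gsum-+ : ∀ a b → gsum (λ f → a f ⊕ b f) ≈ gsum a ⊕ gsum b
  gsum-+ a b zero    = K.refl
  gsum-+ a b (suc k) = K.trans (K.+-congˡ (gsum-+ (λ f → a (suc f)) (λ f → b (suc f)) k)) (interchange _ _ _ _)

  gsum-suc : ∀ a → gsum a ≈ a 0 ⊕ X K.rawRing ⊗ gsum (λ f → a (suc f))
  gsum-suc a zero    = K.sym (K.trans (K.+-congˡ (SeriesRing.X-* K (gsum (λ f → a (suc f))) 0)) (K.+-identityʳ _))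
  gsum-suc a (suc k) = K.+-congˡ (K.sym (SeriesRing.X-* K (gsum (λ f → a (suc f))) (suc k)))

  -- The factor r may involve u, so multiplication by it mixes coefficients. Both sides satisfy the
  -- recursion of `gsum-suc`, with r times the tail sum multiplied by u, and agree by induction on
  -- the coefficient.
  gsum-* : ∀ r a → gsum (λ f → r ⊗ a f) ≈ r ⊗ gsum a
  gsum-* r a k = K.trans (go k a) (K.sym (expand a k))
    where
    a⁺ : (ℕ → Carrier) → ℕ → Carrier
    a⁺ a f = a (suc f)
    expand : ∀ a → r ⊗ gsum a ≈ r ⊗ a 0 ⊕ X K.rawRing ⊗ (r ⊗ gsum (a⁺ a))
    expand a k = K.trans (*-congˡ {r} {gsum a} {a 0 ⊕ X K.rawRing ⊗ gsum (a⁺ a)} (gsum-suc a) k)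
      (K.trans (distribˡ r (a 0) (X K.rawRing ⊗ gsum (a⁺ a)) k)
        (K.+-congˡ (x∙yz≈y∙xz r (X K.rawRing) (gsum (a⁺ a)) k)))
      where open CommutativeSemigroupProperties *-commutativeSemigroup using (x∙yz≈y∙xz)
    go : ∀ k a → gsum (λ f → r ⊗ a f) k K.≈ (r ⊗ a 0 ⊕ X K.rawRing ⊗ (r ⊗ gsum (a⁺ a))) k
    go zero    a = K.sym (K.trans (K.+-congˡ (SeriesRing.X-* K (r ⊗ gsum (a⁺ a)) 0)) (K.+-identityʳ _))
    go (suc k) a = K.+-congˡ (K.trans (go k (a⁺ a)) (K.trans (K.sym (expand (a⁺ a) k))
      (K.sym (SeriesRing.X-* K (r ⊗ gsum (a⁺ a)) (suc k)))))

  -- When the summands are constant in u, the diagonal sum is the series that has them as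
  -- coefficients; this recovers the generating function of the polynomials `F j f`.
  gsum-const : ∀ (F : Carrier) → gsum (λ f → const K.rawRing (F f)) ≈ F
  gsum-const F zero    = K.refl
  gsum-const F (suc k) = K.trans (K.+-identityˡ _) (gsum-const (λ f → F (suc f)) k)

module FixedPointInsertion where
  private
    module K = CommutativeRing ℤ-series
    module S = Substitution
    module Kᵈ = RawSemiringDefs (RawRing.rawSemiring K.rawRing)
    module const = IsRingHomomorphism (SeriesRing.const-isRingHomomorphism ℤ-series)
    open Homomorphism ℤ-series ℤ-series² (const K.rawRing) (SeriesRing.const-isRingHomomorphism ℤ-series)
      using () renaming (^-homo to const^)
  open CommutativeRing ℤ-series² hiding (zero) renaming (_+_ to _⊕_; _*_ to _⊗_)
  open RawSemiringDefs (RawRing.rawSemiring rawRing) using (_^_)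
  open Bivariate using (t; u; v; Y; Z; Z⁻¹; v≈; Z-inverse)
  open Deletion ℤ-series² t u v Y Z using (descentSum)
  open DiagonalSum ℤ-series
  open Potential ℤ-series² t u v Y Z using (α; weight)

  descentPoly : ∀ {n} → List (Word n) → Poly
  descentPoly = foldr (λ π p → monomial (desᴮ π) +ₚ p) []

  eval-descentPoly : ∀ r {n} (xs : List (Word n)) →
    eval rawRing (descentPoly xs) r ≈ Sums.∑ +-commutativeMonoid xs (λ π → r ^ desᴮ π)
  eval-descentPoly r []       = λ _ _ → ≡.refl
  eval-descentPoly r (π ∷ xs) = trans {E.ev (descentPoly (π ∷ xs))} {E.ev (monomial (desᴮ π)) ⊕ E.ev (descentPoly xs)}
      {Sums.∑ +-commutativeMonoid (π ∷ xs) (λ π → r ^ desᴮ π)}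
    (E.ev-+ (monomial (desᴮ π)) (descentPoly xs))
    (+-cong {E.ev (monomial (desᴮ π))} {r ^ desᴮ π} {E.ev (descentPoly xs)} {Sums.∑ +-commutativeMonoid xs (λ π → r ^ desᴮ π)}
      (E.ev-monomial (desᴮ π)) (eval-descentPoly r xs))
    where module E = Evaluation ℤ-series² r

  coeff-monomial : ∀ d → coeff (monomial d) K.≈ S.t Kᵈ.^ d
  coeff-monomial zero    = Polynomials.coeff-1
  coeff-monomial (suc d) k = ≡.trans (shifted k)
    (≡.trans (≡.sym (SeriesRing.X-* ℤ.+-*-commutativeRing (coeff (monomial d)) k))
      (K.*-congˡ {S.t} {coeff (monomial d)} {S.t Kᵈ.^ d} (coeff-monomial d) k))
    where
    shifted : ∀ k → coeff (monomial (suc d)) k ≡ SeriesRing.shift ℤ.+-*-commutativeRing (coeff (monomial d)) k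
    shifted zero    = ≡.refl
    shifted (suc k) = ≡.refl

  const-descentPoly : ∀ {n} (xs : List (Word n)) →
    Sums.∑ +-commutativeMonoid xs (λ π → t ^ desᴮ π) ≈ const K.rawRing (coeff (descentPoly xs))
  const-descentPoly []       = λ { zero _ → ≡.refl ; (suc _) _ → ≡.refl }
  const-descentPoly (π ∷ xs) = trans {t ^ d ⊕ rest} {const K.rawRing (S.t Kᵈ.^ d) ⊕ const K.rawRing (coeff (descentPoly xs))}
      {const K.rawRing (coeff (descentPoly (π ∷ xs)))}
    (+-cong {t ^ d} {const K.rawRing (S.t Kᵈ.^ d)} {rest} {const K.rawRing (coeff (descentPoly xs))}
      (sym {const K.rawRing (S.t Kᵈ.^ d)} {t ^ d} (const^ S.t d)) (const-descentPoly xs))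
    (trans {const K.rawRing (S.t Kᵈ.^ d) ⊕ const K.rawRing (coeff (descentPoly xs))}
      {const K.rawRing (S.t Kᵈ.^ d K.+ coeff (descentPoly xs))} {const K.rawRing (coeff (descentPoly (π ∷ xs)))}
      (sym {const K.rawRing (S.t Kᵈ.^ d K.+ coeff (descentPoly xs))}
           {const K.rawRing (S.t Kᵈ.^ d) ⊕ const K.rawRing (coeff (descentPoly xs))}
        (const.+-homo (S.t Kᵈ.^ d) (coeff (descentPoly xs))))
      (const.⟦⟧-cong {S.t Kᵈ.^ d K.+ coeff (descentPoly xs)} {coeff (descentPoly (π ∷ xs))}
        (K.sym {coeff (descentPoly (π ∷ xs))} {S.t Kᵈ.^ d K.+ coeff (descentPoly xs)}
          (K.trans {coeff (descentPoly (π ∷ xs))} {coeff (monomial d) K.+ coeff (descentPoly xs)}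
            {S.t Kᵈ.^ d K.+ coeff (descentPoly xs)}
            (Polynomials.coeff-+ (monomial d) (descentPoly xs))
            (K.+-congʳ {coeff (descentPoly xs)} {coeff (monomial d)} {S.t Kᵈ.^ d} (coeff-monomial d))))))
    where
    d : ℕ
    d = desᴮ π
    rest : Carrier
    rest = Sums.∑ +-commutativeMonoid xs (λ π → t ^ desᴮ π)

  -- With `Z-inverse` for the factor 1-α, this makes `weight mid` a unit.
  1+α-inverse : (1# ⊕ α) ⊗ 1/1+_X K.rawRing (K.1# K.+ K.- S.t) ≈ 1#
  1+α-inverse = trans {(1# ⊕ α) ⊗ inv} {(1# ⊕ const K.rawRing a ⊗ u) ⊗ inv} {1#}
    (*-congʳ {inv} {1# ⊕ α} {1# ⊕ const K.rawRing a ⊗ u}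
      (+-congˡ {1#} {α} {const K.rawRing a ⊗ u}
        (trans {α} {(1# ⊕ - t) ⊗ u} {const K.rawRing a ⊗ u} (*-comm u (1# ⊕ - t))
          (*-congʳ {u} {1# ⊕ - t} {const K.rawRing a}
            (sym {const K.rawRing a} {1# ⊕ - t}
              (trans {const K.rawRing a} {const K.rawRing K.1# ⊕ const K.rawRing (K.- S.t)} {1# ⊕ - t}
                (const.+-homo K.1# (K.- S.t))
                (+-cong {const K.rawRing K.1#} {1#} {const K.rawRing (K.- S.t)} {(- t)} const.1#-homo (const.-‿homo S.t))))))))
    (GeometricSeries.1+aX-inverse ℤ-series a)
    where
    a : K.Carrier
    a = K.1# K.+ K.- S.t
    inv : Carrier
    inv = 1/1+_X K.rawRing a

  weight-unit : weight mid ⊗ (1/1+_X K.rawRing (K.1# K.+ K.- S.t) ⊗ Z⁻¹) ≈ 1#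
  weight-unit = trans {weight mid ⊗ (inv ⊗ Z⁻¹)} {(1# ⊕ α) ⊗ inv ⊗ (Z ⊗ Z⁻¹)} {1#}
    (interchange (1# ⊕ α) Z inv Z⁻¹)
    (trans {(1# ⊕ α) ⊗ inv ⊗ (Z ⊗ Z⁻¹)} {1# ⊗ 1#} {1#}
      (*-cong {(1# ⊕ α) ⊗ inv} {1#} {Z ⊗ Z⁻¹} {1#} 1+α-inverse Z-inverse) (*-identityˡ 1#))
    where
    open CommutativeSemigroupProperties *-commutativeSemigroup using (interchange)
    inv : Carrier
    inv = 1/1+_X K.rawRing (K.1# K.+ K.- S.t)

  Y≈Z* : Y ≈ Z ⊗ (Y ⊗ Z⁻¹)
  Y≈Z* = sym {Z ⊗ (Y ⊗ Z⁻¹)} {Y} (trans {Z ⊗ (Y ⊗ Z⁻¹)} {Y ⊗ (Z ⊗ Z⁻¹)} {Y} (x∙yz≈y∙xz Z Y Z⁻¹)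
    (trans {Y ⊗ (Z ⊗ Z⁻¹)} {Y ⊗ 1#} {Y} (*-congˡ {Y} {Z ⊗ Z⁻¹} {1#} Z-inverse) (*-identityʳ Y)))
    where open CommutativeSemigroupProperties *-commutativeSemigroup using (x∙yz≈y∙xz)

  deletion : ∀ j → v ^ suc (2 ℕ.* j) ⊗ (λ f → coeff (F j f)) ≈ Z ^ (2 ℕ.* j) ⊗ eval rawRing (J j) (Y ⊗ Z⁻¹)
  deletion j = trans {v ^ suc (2 ℕ.* j) ⊗ (λ f → coeff (F j f))} {v ^ suc (2 ℕ.* j) ⊗ gsum sums}
      {Z ^ (2 ℕ.* j) ⊗ eval rawRing (J j) (Y ⊗ Z⁻¹)}
    (*-congˡ {v ^ suc (2 ℕ.* j)} {λ f → coeff (F j f)} {gsum sums}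
      (sym {gsum sums} {λ f → coeff (F j f)}
        (trans {gsum sums} {gsum (λ f → const K.rawRing (coeff (F j f)))} {λ f → coeff (F j f)}
          (gsum-cong {sums} {λ f → const K.rawRing (coeff (F j f))} (λ f → const-descentPoly (words f)))
          (gsum-const (λ f → coeff (F j f))))))
    (trans {v ^ suc (2 ℕ.* j) ⊗ gsum sums} {Z ^ (2 ℕ.* j) ⊗ descentSum (2 ℕ.* j ℕ.+ 0) j 0 (Y ⊗ Z⁻¹)}
      {Z ^ (2 ℕ.* j) ⊗ eval rawRing (J j) (Y ⊗ Z⁻¹)}
      (Deletion.deletion ℤ-series² t u v Y Z v≈ (refl {Y}) (refl {Z}) j gsum
        (λ {a} {b} → gsum-cong {a} {b}) gsum-+ gsum-* gsum-suc
        {Y ⊗ Z⁻¹} {1/1+_X K.rawRing (K.1# K.+ K.- S.t) ⊗ Z⁻¹} Y≈Z* weight-unit)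
      (*-congˡ {Z ^ (2 ℕ.* j)} {descentSum (2 ℕ.* j ℕ.+ 0) j 0 (Y ⊗ Z⁻¹)} {eval rawRing (J j) (Y ⊗ Z⁻¹)}
        (sym {eval rawRing (J j) (Y ⊗ Z⁻¹)} {descentSum (2 ℕ.* j ℕ.+ 0) j 0 (Y ⊗ Z⁻¹)}
          (eval-descentPoly (Y ⊗ Z⁻¹) (words 0)))))
    where
    words : ∀ f → List (Word (2 ℕ.* j ℕ.+ f))
    words f = filter (λ π → isInvolution? π ×-dec cyc₂ π ℕ.≟ j ×-dec fixᴮ π ℕ.≟ f) (allWords (2 ℕ.* j ℕ.+ f))
    sums : ℕ → Carrier
    sums f = descentSum (2 ℕ.* j ℕ.+ f) j f t

-- The expansion, its positivity and the identification of Φ by uniqueness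

open import Data.Nat.Base using (_+_; _*_; _≤_)
open RawRing ℤ[x] using () renaming (_≈_ to _≈ₓ_)
open RawRing ℤ[x][[W]] using () renaming (_≈_ to _≈ᵂ_)

theorem1p2 : (D : ℕ → ℕ → ℤ) →
    (∀ j → IsGammaPolynomial (2 * j) (J j) (P D j)) →
    (∀ j s → s ≤ j → IsNatural (D j s)) →
    (Φ : ℕ → ℕ → Poly) →
    (∀ j f → IsGammaPolynomial (2 * j + f) (F j f) (Φ j f)) →
    (∀ j → A (P D j) j ≈ᵂ expansion (D j) j)
    × (∀ j r → A (P D j) j r ∈ℕ[x])
    × (∀ j f → Φ j f ≈ₓ binomialSum (A (P D j) j) f)
theorem1p2 D γ D∈ℕ Φ γΦ =
    (λ j → Expansion.A≈expansion (D j) j)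
  , (λ j r k → ≡.subst IsNatural (≡.sym (Expansion.A≈expansion (D j) j r k)) (expansion-natural (D j) j (D∈ℕ j) r k))
  , (λ j f → Substitution.gamma-unique (2 * j + f) (F j f) {Φ j f} {binomialSum (A (P D j) j) f} (γΦ j f)
      (Bivariate.binomialSum-isGamma (D j) j (γ j) (FixedPointInsertion.deletion j) f))
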